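{- Let $p\neq2$. The functor $C:\mathsf{ComRings}\to\mathsf{Ab}$ is a universal weak pre-Witt functor. In particular, there is a natural transformation $\eta:C\to E$ compatible with $V$ and $\langle\ \rangle$.
   Context: $p$ is an odd prime. Definition of $C$: for a ring $R$, $\tilde G(R)$ is the free abelian group on symbols $V^n_r$ ($n\in\mathbb N_0$, $0\ne r\in R$), $V^n_0:=0$, $V(V^n_r)=V^{n+1}_r$, $\langle r\rangle=V^0_r$; $H(R)$ is generated by $(V^n_{(x+y)^p}-pV^{n-1}_{x+y})-(V^n_{x^p}-pV^{n-1}_x)-(V^n_{y^p}-pV^{n-1}_y)$ ($x,y\in R$, $n\ge1$) and $V^n_r+V^n_{ -r}$; $\tilde H(R)$ is its $p$-saturation; $G^0(R)$ is the $V$-adic completion of $\tilde G(R)/\tilde H(R)$; $G(R)$ is $G^0(R)$ modulo the closed subgroup generated by $p$-power torsion. For commutative $R$ with $0\to I\to\mathbb Z[R]\to R\to0$ ($\mathbb Z[R]$ polynomial ring on the set $R$), $C(R)=G(\mathbb Z[R])/G_I(\mathbb Z[R])$, $G_I$ the closed subgroup generated by $V^n_x-V^n_y$, $x-y\in I$. Definition of $E$: for commutative $B$, $X(B)$ is the closed subgroup of $B^{\mathbb N_0}$ (product topology) generated by $V^n\langle b\rangle$, where $V(b_0,b_1,\dots)=p(0,b_0,b_1,\dots)$, $\langle b\rangle=(b,b^p,b^{p^2},\dots)$; $E(R)=X(\mathbb Z[R])/X_I(\mathbb Z[R])$, $X_I$ the closed subgroup generated by $V^n\langle a\rangle-V^n\langle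 b\rangle$ with $a-b\in I$, and $\langle x\rangle\in E(R)$ is the class of $\langle [x]\rangle$. A weak pre-Witt functor is a functor $F:\mathsf{ComRings}\to\mathsf{Ab}$ with functorial group endomorphisms $V$ and functorial set maps $\langle\ \rangle:R\to F(R)$ such that: (1) $\langle0\rangle=0$ and $\langle-x\rangle=-\langle x\rangle$; (2) $x\mapsto V\langle x^p\rangle-p\langle x\rangle$ is additive; (3) $F(R)$ is complete with respect to $\{V^nF(R)\}$; (4') if $A$ is a polynomial ring over $\mathbb Z$ then $F(A)$ is $p$-torsion free. Universal means that for every weak pre-Witt functor $F$ there is a natural transformation $C\to F$ compatible with $V$ and $\langle\ \rangle$ (initial object). $E$ is a weak pre-Witt functor. -}

module Defs where

open import Algebra.Bundles using (AbelianGroup; CommutativeRing; Ring)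
import Algebra.Construct.Pointwise as Pointwise
import Algebra.Definitions.RawMonoid as RawMult
open import Algebra.Morphism.Bundles using (GroupHomomorphism; RingHomomorphism)
import Algebra.Morphism.Construct.Composition as Composition
import Algebra.Morphism.Construct.Identity as Identity
import Algebra.Properties.AbelianGroup as AbelianGroupProperties
import Algebra.Properties.CommutativeMonoid.Mult as MultProperties
import Algebra.Properties.CommutativeSemigroup as CommutativeSemigroupProperties
import Algebra.Properties.Ring as RingProperties
import Algebra.Properties.Semiring.Exp as Exp
open import Data.List.Base using (List; []; _∷_; [_]; _++_; foldr; map)
import Data.List.Relation.Binary.Permutation.Setoid as Permutation
import Data.List.Relation.Binary.Permutation.Setoid.Properties as PermutationProperties
open import Data.Nat.Base as ℕ using (ℕ; zero; suc)
import Data.Nat.Properties as ℕ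
open import Data.Product.Base using (Σ-syntax; ∃-syntax; _×_; _,_; proj₁; proj₂)
open import Data.Product.Relation.Binary.Pointwise.NonDependent using (×-setoid)
open import Function.Base using (_∘_; id)
open import Function.Bundles using (Func)
open import Function.Definitions using (Bijective; Congruent)
open import Level using (Level) renaming (suc to lsuc)
open import Relation.Binary.Bundles using (Setoid)
open import Relation.Binary.Core using (Rel)
import Relation.Binary.PropositionalEquality as ≡
open import Relation.Binary.PropositionalEquality using (_≡_)
import Relation.Binary.Reasoning.Setoid as ≈-Reasoning
open import Relation.Unary using (Pred; _∈_; _⊆_)

private
  variable
    ℓ ℓ₁ ℓ₂ : Level

GroupHom : (A B : AbelianGroup ℓ ℓ) → Set ℓ
GroupHom A B = GroupHomomorphism (AbelianGroup.rawGroup A) (AbelianGroup.rawGroup B)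

RingHom : (R S : CommutativeRing ℓ ℓ) → Set ℓ
RingHom R S = RingHomomorphism (CommutativeRing.rawRing R) (CommutativeRing.rawRing S)

idRing : (R : CommutativeRing ℓ ℓ) → RingHom R R
idRing R = Identity.ringHomomorphism (CommutativeRing.ring R)

composeRing : (R S T : CommutativeRing ℓ ℓ) → RingHom S T → RingHom R S → RingHom R T
composeRing R S T g f = Composition.ringHomomorphism
  {M₁ = CommutativeRing.ring R} {M₂ = CommutativeRing.ring S} {M₃ = CommutativeRing.ring T} f g

module _ (A B : AbelianGroup ℓ ℓ) where

  private
    module A = AbelianGroup A
    module B = AbelianGroup B
    module BP = AbelianGroupProperties B

  mkGroupHom : (f : A.Carrier → B.Carrier) → Congruent A._≈_ B._≈_ f →
               (∀ x y → f (x A.∙ y) B.≈ f x B.∙ f y) → GroupHom A B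
  mkGroupHom f f-cong f-∙ .GroupHomomorphism.⟦_⟧ = f
  mkGroupHom f f-cong f-∙ .GroupHomomorphism.isGroupHomomorphism = record
      { isMonoidHomomorphism = record
        { isMagmaHomomorphism = record
          { isRelHomomorphism = record { cong = f-cong }
          ; homo = f-∙ }
        ; ε-homo = f-ε }
      ; ⁻¹-homo = λ x → BP.inverseˡ-unique _ _
          (B.trans (B.sym (f-∙ _ _)) (B.trans (f-cong (A.inverseˡ x)) f-ε)) }
    where
    f-ε : f A.ε B.≈ B.ε
    f-ε = BP.identityˡ-unique _ _ (B.trans (B.sym (f-∙ _ _)) (f-cong (A.identityˡ A.ε)))

module GroupHomProperties {A B : AbelianGroup ℓ ℓ} (f : GroupHom A B) where

  private
    module A = AbelianGroup A
    module B = AbelianGroup B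
    module A× = RawMult A.rawMonoid
    module B× = RawMult B.rawMonoid
  open GroupHomomorphism f renaming (homo to ∙-homo)

  -homo : ∀ x y → ⟦ x A.- y ⟧ B.≈ ⟦ x ⟧ B.- ⟦ y ⟧
  -homo x y = B.trans (∙-homo x (y A.⁻¹)) (B.∙-congˡ (⁻¹-homo y))

  ×-homo : ∀ n x → ⟦ n A×.× x ⟧ B.≈ n B×.× ⟦ x ⟧
  ×-homo zero    x = ε-homo
  ×-homo (suc n) x = B.trans (∙-homo x (n A×.× x)) (B.∙-congˡ (×-homo n x))

record VGroup (ℓ : Level) : Set (lsuc ℓ) where
  no-eta-equality
  field
    group : AbelianGroup ℓ ℓ
    endo  : GroupHom group group

  open AbelianGroup group public hiding (group)
    renaming (_∙_ to infixl 6 _+_; ε to 0#; _⁻¹ to infix 8 -_)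
  open AbelianGroupProperties group public
  open CommutativeSemigroupProperties commutativeSemigroup public using (interchange)
  open RawMult rawMonoid public using () renaming (_×_ to infixr 8 _·_)
  open MultProperties commutativeMonoid public
    using (×-congʳ; ×-distrib-+; ×-homo-+; ×-assocˡ)
  open GroupHomomorphism endo public using ()
    renaming (⟦_⟧ to V; ⟦⟧-cong to V-cong; homo to V-+; ε-homo to V-0; ⁻¹-homo to V-neg)
  open GroupHomProperties {A = group} {B = group} endo public
    renaming (-homo to V--; ×-homo to V-·)

  V^ : ℕ → Carrier → Carrier
  V^ zero    x = x
  V^ (suc n) x = V (V^ n x)

record VSubgroup (A : VGroup ℓ) : Set (lsuc ℓ) where
  no-eta-equality
  open VGroup A
  field
    mem    : Pred Carrier ℓ
    resp   : ∀ {x y} → x ≈ y → mem x → mem y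
    0-mem  : mem 0#
    +-mem  : ∀ {x y} → mem x → mem y → mem (x + y)
    neg-mem : ∀ {x} → mem x → mem (- x)
    V-mem  : ∀ {x} → mem x → mem (V x)

record VHom (A B : VGroup ℓ) : Set ℓ where
  no-eta-equality
  private
    module A = VGroup A
    module B = VGroup B
  field
    hom    : GroupHom A.group B.group
    V-homo : ∀ x → GroupHomomorphism.⟦_⟧ hom (A.V x) B.≈ B.V (GroupHomomorphism.⟦_⟧ hom x)

  open GroupHomomorphism hom public renaming (homo to ∙-homo)
  open GroupHomProperties {A = A.group} {B = B.group} hom public

  V^-homo : ∀ n x → ⟦ A.V^ n x ⟧ B.≈ B.V^ n ⟦ x ⟧
  V^-homo zero    x = B.refl
  V^-homo (suc n) x = B.trans (V-homo _) (B.V-cong (V^-homo n x))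

module _ (A : VGroup ℓ) (P : VSubgroup A) where

  private
    module A = VGroup A
    module P = VSubgroup P

  module Quotient where
    open A

    infix 4 _~_
    -- A record, so that x and y can be inferred from a proof of x ~ y.
    record _~_ (x y : Carrier) : Set ℓ where
      constructor congruent
      field difference : P.mem (x - y)

    ≈⇒~ : ∀ {x y} → x ≈ y → x ~ y
    ≈⇒~ {x} {y} x≈y = congruent (P.resp (sym (trans (∙-congʳ x≈y) (inverseʳ y))) P.0-mem)

    ~-trans : ∀ {x y z} → x ~ y → y ~ z → x ~ z
    ~-trans {x} {y} {z} (congruent p) (congruent q) = congruent (P.resp eq (P.+-mem p q))
      where
      open ≈-Reasoning setoid
      eq : (x - y) + (y - z) ≈ x - z
      eq = begin
        (x - y) + (y - z)     ≈⟨ assoc x (- y) (y - z) ⟩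
        x + (- y + (y - z))   ≈⟨ ∙-congˡ (assoc (- y) y (- z)) ⟨
        x + ((- y + y) - z)   ≈⟨ ∙-congˡ (∙-congʳ (inverseˡ y)) ⟩
        x + (0# - z)          ≈⟨ ∙-congˡ (identityˡ (- z)) ⟩
        x - z                 ∎

    ~-sym : ∀ {x y} → x ~ y → y ~ x
    ~-sym {x} {y} (congruent p) = congruent (P.resp (⁻¹-anti-homo-// x y) (P.neg-mem p))

    +-~ : ∀ {x y u v} → x ~ y → u ~ v → (x + u) ~ (y + v)
    +-~ {x} {y} {u} {v} (congruent p) (congruent q) = congruent (P.resp eq (P.+-mem p q))
      where
      eq : (x - y) + (u - v) ≈ (x + u) - (y + v)
      eq = trans (interchange x (- y) u (- v)) (∙-congˡ (⁻¹-∙-comm y v))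

    neg-~ : ∀ {x y} → x ~ y → (- x) ~ (- y)
    neg-~ {x} {y} (congruent p) = congruent (P.resp (sym (⁻¹-∙-comm x (- y))) (P.neg-mem p))

    quotientGroup : AbelianGroup _ _
    quotientGroup .AbelianGroup.Carrier = Carrier
    quotientGroup .AbelianGroup._≈_ = _~_
    quotientGroup .AbelianGroup._∙_ = _+_
    quotientGroup .AbelianGroup.ε = 0#
    quotientGroup .AbelianGroup._⁻¹ = -_
    quotientGroup .AbelianGroup.isAbelianGroup = record
        { isGroup = record
          { isMonoid = record
            { isSemigroup = record
              { isMagma = record
                { isEquivalence = record
                  { refl = ≈⇒~ refl ; sym = ~-sym ; trans = ~-trans }
                ; ∙-cong = +-~ }
              ; assoc = λ x y z → ≈⇒~ (assoc x y z) }
            ; identity = (λ x → ≈⇒~ (identityˡ x)) , (λ x → ≈⇒~ (identityʳ x)) }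
          ; inverse = (λ x → ≈⇒~ (inverseˡ x)) , (λ x → ≈⇒~ (inverseʳ x))
          ; ⁻¹-cong = neg-~ }
        ; comm = λ x y → ≈⇒~ (comm x y) }

  open Quotient using (congruent) public

  infixl 7 _/_

  _/_ : VGroup ℓ
  _/_ .VGroup.group = Quotient.quotientGroup
  _/_ .VGroup.endo = mkGroupHom quotientGroup quotientGroup A.V
                (λ {x} {y} (congruent p) → congruent (P.resp (A.V-- x y) (P.V-mem p)))
                (λ x y → ≈⇒~ (A.V-+ x y))
    where open Quotient

  private
    open A

    SubCarrier : Set ℓ
    SubCarrier = Σ[ x ∈ Carrier ] P.mem x

  infix 4 _≈ˢ_
  record _≈ˢ_ (x y : SubCarrier) : Set ℓ where
    constructor underlying
    field equal : proj₁ x ≈ proj₁ y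

  private
    open _≈ˢ_

    subGroup : AbelianGroup ℓ ℓ
    subGroup .AbelianGroup.Carrier = SubCarrier
    subGroup .AbelianGroup._≈_ = _≈ˢ_
    subGroup .AbelianGroup._∙_ (x , x∈P) (y , y∈P) = x + y , P.+-mem x∈P y∈P
    subGroup .AbelianGroup.ε = 0# , P.0-mem
    subGroup .AbelianGroup._⁻¹ (x , x∈P) = - x , P.neg-mem x∈P
    subGroup .AbelianGroup.isAbelianGroup = record
      { isGroup = record
        { isMonoid = record
          { isSemigroup = record
            { isMagma = record
              { isEquivalence = record
                { refl  = underlying refl
                ; sym   = λ e → underlying (sym (equal e))
                ; trans = λ e e′ → underlying (trans (equal e) (equal e′)) }
              ; ∙-cong = λ e e′ → underlying (∙-cong (equal e) (equal e′)) }
            ; assoc = λ x y z → underlying (assoc _ _ _) }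
          ; identity = (λ x → underlying (identityˡ _)) , (λ x → underlying (identityʳ _)) }
        ; inverse = (λ x → underlying (inverseˡ _)) , (λ x → underlying (inverseʳ _))
        ; ⁻¹-cong = λ e → underlying (⁻¹-cong (equal e)) }
      ; comm = λ x y → underlying (comm _ _) }

  sub : VGroup ℓ
  sub .VGroup.group = subGroup
  sub .VGroup.endo = mkGroupHom subGroup subGroup (λ (x , x∈P) → A.V x , P.V-mem x∈P)
    (λ e → underlying (A.V-cong (equal e))) (λ x y → underlying (A.V-+ _ _))

module _ {A B : VGroup ℓ} (f : VHom A B) (P : VSubgroup A) (Q : VSubgroup B) where

  private
    module A = VGroup A
    module B = VGroup B
    module P = VSubgroup P
    module Q = VSubgroup Q
  open VHom f

  quotientMap : (∀ {x} → P.mem x → Q.mem ⟦ x ⟧) → VHom (A / P) (B / Q)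
  quotientMap f-mem .VHom.hom = mkGroupHom (VGroup.group (A / P)) (VGroup.group (B / Q)) ⟦_⟧
                 (λ {x} {y} (congruent p) → congruent (Q.resp (-homo x y) (f-mem p)))
                 (λ x y → Quotient.≈⇒~ B Q (∙-homo x y))
  quotientMap f-mem .VHom.V-homo = λ x → Quotient.≈⇒~ B Q (V-homo x)

  subMap : (∀ {x} → P.mem x → Q.mem ⟦ x ⟧) → VHom (sub A P) (sub B Q)
  subMap f-mem .VHom.hom = mkGroupHom (VGroup.group (sub A P)) (VGroup.group (sub B Q))
                 (λ (x , x∈P) → ⟦ x ⟧ , f-mem x∈P)
                 (λ (underlying e) → underlying (⟦⟧-cong e)) (λ x y → underlying (∙-homo _ _))
  subMap f-mem .VHom.V-homo x = underlying (V-homo _)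

module _ (A : VGroup ℓ) (P Q : VSubgroup A) where
  private
    module P = VSubgroup P
    module Q = VSubgroup Q

  -- P ∩ Q as a subgroup of P.
  restrict : VSubgroup (sub A P)
  restrict .VSubgroup.mem (x , _) = Q.mem x
  restrict .VSubgroup.resp (underlying e) = Q.resp e
  restrict .VSubgroup.0-mem = Q.0-mem
  restrict .VSubgroup.+-mem = Q.+-mem
  restrict .VSubgroup.neg-mem = Q.neg-mem
  restrict .VSubgroup.V-mem = Q.V-mem

data Span (A : VGroup ℓ) (S : Pred (VGroup.Carrier A) ℓ) : Pred (VGroup.Carrier A) ℓ where
  gen  : ∀ {x} → x ∈ S → Span A S x
  resp : ∀ {x y} → VGroup._≈_ A x y → Span A S x → Span A S y
  zer  : Span A S (VGroup.0# A)
  add  : ∀ {x y} → Span A S x → Span A S y → Span A S (VGroup._+_ A x y)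
  neg  : ∀ {x} → Span A S x → Span A S (VGroup.-_ A x)

module _ (A : VGroup ℓ) (S : Pred (VGroup.Carrier A) ℓ) where
  open VGroup A

  Span-V : (∀ {x} → x ∈ S → V x ∈ Span A S) → ∀ {x} → x ∈ Span A S → V x ∈ Span A S
  Span-V S-V (gen s)    = S-V s
  Span-V S-V (resp e p) = resp (V-cong e) (Span-V S-V p)
  Span-V S-V zer        = resp (sym V-0) zer
  Span-V S-V (add p q)  = resp (sym (V-+ _ _)) (add (Span-V S-V p) (Span-V S-V q))
  Span-V S-V (neg p)    = resp (sym (V-neg _)) (neg (Span-V S-V p))

  generated : (∀ {x} → x ∈ S → V x ∈ Span A S) → VSubgroup A
  generated S-V .VSubgroup.mem = Span A S
  generated S-V .VSubgroup.resp = resp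
  generated S-V .VSubgroup.0-mem = zer
  generated S-V .VSubgroup.+-mem = add
  generated S-V .VSubgroup.neg-mem = neg
  generated S-V .VSubgroup.V-mem = Span-V S-V

module _ {A B : VGroup ℓ} (f : VHom A B)
         {S : Pred (VGroup.Carrier A) ℓ} {T : Pred (VGroup.Carrier B) ℓ} where
  private module B = VGroup B
  open VHom f

  Span-map : (∀ {x} → x ∈ S → ⟦ x ⟧ ∈ Span B T) → ∀ {x} → x ∈ Span A S → ⟦ x ⟧ ∈ Span B T
  Span-map f-S (gen s)    = f-S s
  Span-map f-S (resp e p) = resp (⟦⟧-cong e) (Span-map f-S p)
  Span-map f-S zer        = resp (B.sym ε-homo) zer
  Span-map f-S (add p q)  = resp (B.sym (∙-homo _ _)) (add (Span-map f-S p) (Span-map f-S q))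
  Span-map f-S (neg p)    = resp (B.sym (⁻¹-homo _)) (neg (Span-map f-S p))

-- For a family s n x ∈ A with V (s n x) = s (n + 1) x, the differences
-- s n x - s n y for related x and y.
module _ (A : VGroup ℓ) {X : Set ℓ} (s : ℕ → X → VGroup.Carrier A) (_∼_ : Rel X ℓ) where
  open VGroup A

  data Difference : Pred Carrier ℓ where
    difference : ∀ n x y → x ∼ y → Difference (s n x - s n y)

  Difference-V : (∀ n x → V (s n x) ≈ s (suc n) x) →
                 ∀ {u} → u ∈ Difference → V u ∈ Span A Difference
  Difference-V V-s (difference n x y x∼y) = resp
    (sym (trans (V-- (s n x) (s n y)) (∙-cong (V-s n x) (⁻¹-cong (V-s n y)))))
    (gen (difference (suc n) x y x∼y))

module _ {A B : VGroup ℓ} (f : VHom A B) {X Y : Set ℓ}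
         (s : ℕ → X → VGroup.Carrier A) (_∼_ : Rel X ℓ)
         (t : ℕ → Y → VGroup.Carrier B) (_≃_ : Rel Y ℓ) (h : X → Y) where
  private module B = VGroup B
  open VHom f

  Difference-map : (∀ n x → ⟦ s n x ⟧ B.≈ t n (h x)) → (∀ {x y} → x ∼ y → h x ≃ h y) →
                   ∀ {u} → u ∈ Difference A s _∼_ → ⟦ u ⟧ ∈ Span B (Difference B t _≃_)
  Difference-map f-s h-∼ (difference n x y x∼y) = resp
    (B.sym (B.trans (-homo (s n x) (s n y)) (B.∙-cong (f-s n x) (B.⁻¹-cong (f-s n y)))))
    (gen (difference n (h x) (h y) (h-∼ x∼y)))

-- A linear topology, given by a decreasing sequence of subgroups forming a
-- neighbourhood basis of 0.
Topology : VGroup ℓ → Set (lsuc ℓ)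
Topology A = ℕ → VSubgroup A

module _ (A : VGroup ℓ) (U : Topology A) (S : Pred (VGroup.Carrier A) ℓ) where
  open VGroup A
  private module U n = VSubgroup (U n)

  record Closure (x : Carrier) : Set ℓ where
    constructor closure
    field approximate : ∀ n → ∃[ s ] s ∈ Span A S × U.mem n (x - s)

  open Closure

  Span⊆Closure : Span A S ⊆ Closure
  Span⊆Closure {x} x∈ = closure λ n → x , x∈ , U.resp n (sym (inverseʳ x)) (U.0-mem n)

  closedSubgroup : (∀ {x} → x ∈ S → V x ∈ Span A S) → VSubgroup A
  closedSubgroup S-V .VSubgroup.mem = Closure
  closedSubgroup S-V .VSubgroup.resp e p = closure λ n → let (s , s∈ , d) = approximate p n in
    s , s∈ , U.resp n (∙-congʳ e) d
  closedSubgroup S-V .VSubgroup.0-mem = closure λ n →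
    0# , zer , U.resp n (sym (inverseʳ 0#)) (U.0-mem n)
  closedSubgroup S-V .VSubgroup.+-mem p q = closure λ n →
    let (s , s∈ , d) = approximate p n ; (t , t∈ , e) = approximate q n in
    s + t , add s∈ t∈ , Quotient._~_.difference (Quotient.+-~ A (U n) (congruent d) (congruent e))
  closedSubgroup S-V .VSubgroup.neg-mem p = closure λ n → let (s , s∈ , d) = approximate p n in
    - s , neg s∈ , Quotient._~_.difference (Quotient.neg-~ A (U n) (congruent d))
  closedSubgroup S-V .VSubgroup.V-mem p = closure λ n → let (s , s∈ , d) = approximate p n in
    V s , Span-V A S S-V s∈ , U.resp n (V-- _ _) (U.V-mem n d)

module _ {A B : VGroup ℓ} (f : VHom A B) (U : Topology A) (W : Topology B)
         {S : Pred (VGroup.Carrier A) ℓ} {T : Pred (VGroup.Carrier B) ℓ} where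
  open VHom f

  Closure-map : (∀ n {x} → VSubgroup.mem (U n) x → VSubgroup.mem (W n) ⟦ x ⟧) →
                (∀ {x} → x ∈ S → ⟦ x ⟧ ∈ Span B T) →
                ∀ {x} → Closure A U S x → Closure B W T ⟦ x ⟧
  Closure-map f-U f-S p = closure λ n → let (s , s∈ , d) = Closure.approximate p n in
    ⟦ s ⟧ , Span-map f f-S s∈ , VSubgroup.resp (W n) (-homo _ _) (f-U n d)

module _ (A : VGroup ℓ) where
  open VGroup A

  V^-0 : ∀ n → V^ n 0# ≈ 0#
  V^-0 zero    = refl
  V^-0 (suc n) = trans (V-cong (V^-0 n)) V-0
  V^-+ : ∀ n x y → V^ n (x + y) ≈ V^ n x + V^ n y
  V^-+ zero    x y = refl
  V^-+ (suc n) x y = trans (V-cong (V^-+ n x y)) (V-+ _ _)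
  V^-neg : ∀ n x → V^ n (- x) ≈ - V^ n x
  V^-neg zero    x = refl
  V^-neg (suc n) x = trans (V-cong (V^-neg n x)) (V-neg _)
  V-V^ : ∀ n x → V (V^ n x) ≈ V^ n (V x)
  V-V^ zero    x = refl
  V-V^ (suc n) x = V-cong (V-V^ n x)

  record V^Image (n : ℕ) (x : Carrier) : Set ℓ where
    constructor image
    field
      {preimage} : Carrier
      equation   : x ≈ V^ n preimage

  V-adic : Topology A
  V-adic n .VSubgroup.mem = V^Image n
  V-adic n .VSubgroup.resp e (image p) = image (trans (sym e) p)
  V-adic n .VSubgroup.0-mem = image (sym (V^-0 n))
  V-adic n .VSubgroup.+-mem (image p) (image q) = image (trans (∙-cong p q) (sym (V^-+ n _ _)))
  V-adic n .VSubgroup.neg-mem (image p) = image (trans (⁻¹-cong p) (sym (V^-neg n _)))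
  V-adic n .VSubgroup.V-mem (image p) = image (trans (V-cong p) (V-V^ n _))

module _ {A B : VGroup ℓ} (f : VHom A B) where
  private module B = VGroup B
  open VHom f

  V-adic-map : ∀ n {x} → VSubgroup.mem (V-adic A n) x → VSubgroup.mem (V-adic B n) ⟦ x ⟧
  V-adic-map n (image p) = image (B.trans (⟦⟧-cong p) (V^-homo n _))

module _ (A : VGroup ℓ) where
  open VGroup A
  private
    module I n = VSubgroup (V-adic A n)
    module Q n = Quotient A (V-adic A n)

  -- Elements of the inverse limit of the quotients A / Vⁿ A, the n-th
  -- coordinate being given by a representative in A.
  record Coherent : Set ℓ where
    no-eta-equality
    field
      seq      : ℕ → Carrier
      coherent : ∀ n → Q._~_ n (seq (suc n)) (seq n)

  open Coherent

  infix 4 _≈ᶜ_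
  record _≈ᶜ_ (x y : Coherent) : Set ℓ where
    constructor coordinatewise
    field coordinate : ∀ n → Q._~_ n (seq x n) (seq y n)

  open _≈ᶜ_

  infixl 6 _+ᶜ_
  infix  8 -ᶜ_

  _+ᶜ_ : Coherent → Coherent → Coherent
  (x +ᶜ y) .seq n = seq x n + seq y n
  (x +ᶜ y) .coherent n = Q.+-~ n (coherent x n) (coherent y n)

  -ᶜ_ : Coherent → Coherent
  (-ᶜ x) .seq n = - seq x n
  (-ᶜ x) .coherent n = Q.neg-~ n (coherent x n)

  toCompletion : Carrier → Coherent
  toCompletion x .seq _ = x
  toCompletion x .coherent n = Q.≈⇒~ n refl

  private
    completionGroup : AbelianGroup ℓ ℓ
    completionGroup .AbelianGroup.Carrier = Coherent
    completionGroup .AbelianGroup._≈_ = _≈ᶜ_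
    completionGroup .AbelianGroup._∙_ = _+ᶜ_
    completionGroup .AbelianGroup.ε = toCompletion 0#
    completionGroup .AbelianGroup._⁻¹ = -ᶜ_
    completionGroup .AbelianGroup.isAbelianGroup = record
        { isGroup = record
          { isMonoid = record
            { isSemigroup = record
              { isMagma = record
                { isEquivalence = record
                  { refl  = coordinatewise λ n → Q.≈⇒~ n refl
                  ; sym   = λ p → coordinatewise λ n → Q.~-sym n (coordinate p n)
                  ; trans = λ p q → coordinatewise λ n → Q.~-trans n (coordinate p n) (coordinate q n) }
                ; ∙-cong = λ p q → coordinatewise λ n → Q.+-~ n (coordinate p n) (coordinate q n) }
              ; assoc = λ x y z → coordinatewise λ n → Q.≈⇒~ n (assoc _ _ _) }
            ; identity = (λ x → coordinatewise λ n → Q.≈⇒~ n (identityˡ _))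
                       , (λ x → coordinatewise λ n → Q.≈⇒~ n (identityʳ _)) }
          ; inverse = (λ x → coordinatewise λ n → Q.≈⇒~ n (inverseˡ _))
                    , (λ x → coordinatewise λ n → Q.≈⇒~ n (inverseʳ _))
          ; ⁻¹-cong = λ p → coordinatewise λ n → Q.neg-~ n (coordinate p n) }
        ; comm = λ x y → coordinatewise λ n → Q.≈⇒~ n (comm _ _) }

    V-~ : ∀ n {x y} → Q._~_ n x y → Q._~_ n (V x) (V y)
    V-~ n {x} {y} (congruent p) = congruent (I.resp n (V-- x y) (I.V-mem n p))

  V-coherent : Coherent → Coherent
  V-coherent x .seq n = V (seq x n)
  V-coherent x .coherent n = V-~ n (coherent x n)

  completion : VGroup ℓ
  completion .VGroup.group = completionGroup
  completion .VGroup.endo = mkGroupHom completionGroup completionGroup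
        V-coherent
        (λ p → coordinatewise λ n → V-~ n (coordinate p n))
        (λ x y → coordinatewise λ n → Q.≈⇒~ n (V-+ _ _))

  -- A → lim A / Vⁿ A is bijective: the V-adic topology is both separated and
  -- complete.
  IsVComplete : Set ℓ
  IsVComplete = Bijective _≈_ _≈ᶜ_ toCompletion

module _ {A B : VGroup ℓ} (f : VHom A B) where
  private
    module A = VGroup A
    module B = VGroup B
    module QA n = Quotient A (V-adic A n)
    module QB n = Quotient B (V-adic B n)
  open VHom f
  open Coherent

  private
    map-~ : ∀ n {x y} → QA._~_ n x y → QB._~_ n ⟦ x ⟧ ⟦ y ⟧
    map-~ n {x} {y} (congruent p) =
      congruent (VSubgroup.resp (V-adic B n) (-homo x y) (V-adic-map f n p))

  map-coherent : Coherent A → Coherent B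
  map-coherent x .seq n = ⟦ seq x n ⟧
  map-coherent x .coherent n = map-~ n (coherent x n)

  completionMap : VHom (completion A) (completion B)
  completionMap .VHom.hom = mkGroupHom (VGroup.group (completion A)) (VGroup.group (completion B))
        map-coherent
        (λ p → coordinatewise λ n → map-~ n (_≈ᶜ_.coordinate p n))
        (λ x y → coordinatewise λ n → QB.≈⇒~ n (∙-homo _ _))
  completionMap .VHom.V-homo = λ x → coordinatewise λ n → QB.≈⇒~ n (V-homo _)

module Free (S : Setoid ℓ ℓ) where
  private module S = Setoid S

  infixl 6 _⊕_
  infix  8 ⊖_
  infix  4 _≋_

  data Formal : Set ℓ where
    ⟦_⟧ : S.Carrier → Formal
    𝟘   : Formal
    _⊕_ : Formal → Formal → Formal
    ⊖_  : Formal → Formal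

  data _≋_ : Formal → Formal → Set ℓ where
    ≋-refl    : ∀ {u} → u ≋ u
    ≋-sym     : ∀ {u v} → u ≋ v → v ≋ u
    ≋-trans   : ∀ {u v w} → u ≋ v → v ≋ w → u ≋ w
    ⟦⟧-cong   : ∀ {s t} → s S.≈ t → ⟦ s ⟧ ≋ ⟦ t ⟧
    ⊕-cong    : ∀ {u u′ v v′} → u ≋ u′ → v ≋ v′ → u ⊕ v ≋ u′ ⊕ v′
    ⊖-cong    : ∀ {u v} → u ≋ v → ⊖ u ≋ ⊖ v
    ⊕-assoc   : ∀ u v w → (u ⊕ v) ⊕ w ≋ u ⊕ (v ⊕ w)
    ⊕-comm    : ∀ u v → u ⊕ v ≋ v ⊕ u
    ⊕-identityˡ : ∀ u → 𝟘 ⊕ u ≋ u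
    ⊕-inverseˡ  : ∀ u → ⊖ u ⊕ u ≋ 𝟘

  freeAbelianGroup : AbelianGroup ℓ ℓ
  freeAbelianGroup .AbelianGroup.Carrier = Formal
  freeAbelianGroup .AbelianGroup._≈_ = _≋_
  freeAbelianGroup .AbelianGroup._∙_ = _⊕_
  freeAbelianGroup .AbelianGroup.ε = 𝟘
  freeAbelianGroup .AbelianGroup._⁻¹ = ⊖_
  freeAbelianGroup .AbelianGroup.isAbelianGroup = record
      { isGroup = record
        { isMonoid = record
          { isSemigroup = record
            { isMagma = record
              { isEquivalence = record { refl = ≋-refl ; sym = ≋-sym ; trans = ≋-trans }
              ; ∙-cong = ⊕-cong }
            ; assoc = ⊕-assoc }
          ; identity = ⊕-identityˡ , λ u → ≋-trans (⊕-comm u 𝟘) (⊕-identityˡ u) }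
        ; inverse = ⊕-inverseˡ , λ u → ≋-trans (⊕-comm u (⊖ u)) (⊕-inverseˡ u)
        ; ⁻¹-cong = ⊖-cong }
      ; comm = ⊕-comm }

  module _ (A : AbelianGroup ℓ₁ ℓ₂) where
    open AbelianGroup A

    lift : (S.Carrier → Carrier) → Formal → Carrier
    lift f ⟦ s ⟧   = f s
    lift f 𝟘       = ε
    lift f (u ⊕ v) = lift f u ∙ lift f v
    lift f (⊖ u)   = lift f u ⁻¹

    lift-cong : ∀ {f} → Congruent S._≈_ _≈_ f → Congruent _≋_ _≈_ (lift f)
    lift-cong f-cong ≋-refl          = refl
    lift-cong f-cong (≋-sym p)       = sym (lift-cong f-cong p)
    lift-cong f-cong (≋-trans p q)   = trans (lift-cong f-cong p) (lift-cong f-cong q)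
    lift-cong f-cong (⟦⟧-cong e)     = f-cong e
    lift-cong f-cong (⊕-cong p q)    = ∙-cong (lift-cong f-cong p) (lift-cong f-cong q)
    lift-cong f-cong (⊖-cong p)      = ⁻¹-cong (lift-cong f-cong p)
    lift-cong f-cong (⊕-assoc u v w) = assoc _ _ _
    lift-cong f-cong (⊕-comm u v)    = comm _ _
    lift-cong f-cong (⊕-identityˡ u) = identityˡ _
    lift-cong f-cong (⊕-inverseˡ u)  = inverseˡ _

    lift-ext : ∀ {f g} → (∀ s → f s ≈ g s) → ∀ u → lift f u ≈ lift g u
    lift-ext e ⟦ s ⟧   = e s
    lift-ext e 𝟘       = refl
    lift-ext e (u ⊕ v) = ∙-cong (lift-ext e u) (lift-ext e v)
    lift-ext e (⊖ u)   = ⁻¹-cong (lift-ext e u)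

module _ (S T : Setoid ℓ ℓ) where
  private
    module S = Free S
    module T = Free T

  freeMap : Func S T → GroupHom S.freeAbelianGroup T.freeAbelianGroup
  freeMap f = mkGroupHom S.freeAbelianGroup T.freeAbelianGroup
    (S.lift T.freeAbelianGroup (T.⟦_⟧ ∘ Func.to f))
    (S.lift-cong T.freeAbelianGroup (λ e → T.⟦⟧-cong (Func.cong f e)))
    (λ _ _ → T.≋-refl)

-- ℤ[ S ] consists of formal ℤ-linear combinations of monomials, a
-- monomial being a finite multiset of variables from S.
module Polynomial (S : Setoid ℓ ℓ) where
  private module S = Setoid S
  open Permutation S using (_↭_; ↭-setoid; ↭-refl)
  open PermutationProperties S using (++⁺; ++-comm; ++-assoc; ++-identityˡ)

  Monomial : Set ℓ
  Monomial = List S.Carrier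

  open Free ↭-setoid public renaming (Formal to Poly)
  open AbelianGroupProperties freeAbelianGroup using (⁻¹-∙-comm; ε⁻¹≈ε)
  open CommutativeSemigroupProperties (AbelianGroup.commutativeSemigroup freeAbelianGroup)
    using (interchange)

  infixl 7 _⊗_

  _⊗_ : Poly → Poly → Poly
  u ⊗ v = lift freeAbelianGroup
    (λ m → lift freeAbelianGroup (λ m′ → ⟦ m ++ m′ ⟧) v) u

  𝟙 : Poly
  𝟙 = ⟦ [] ⟧

  var : S.Carrier → Poly
  var s = ⟦ [ s ] ⟧

  private
    ⊗-congʳ : ∀ u {v v′} → v ≋ v′ → u ⊗ v ≋ u ⊗ v′
    ⊗-congʳ u p = lift-ext freeAbelianGroup
      (λ m → lift-cong freeAbelianGroup (λ e → ⟦⟧-cong (++⁺ (↭-refl {m}) e)) p) u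

    ⊗-congˡ : ∀ v {u u′} → u ≋ u′ → u ⊗ v ≋ u′ ⊗ v
    ⊗-congˡ v = lift-cong freeAbelianGroup
      (λ e → lift-ext freeAbelianGroup (λ m → ⟦⟧-cong (++⁺ e (↭-refl {m}))) v)

    ⊗-zeroʳ : ∀ u → u ⊗ 𝟘 ≋ 𝟘
    ⊗-zeroʳ ⟦ m ⟧   = ≋-refl
    ⊗-zeroʳ 𝟘       = ≋-refl
    ⊗-zeroʳ (u ⊕ v) = ≋-trans (⊕-cong (⊗-zeroʳ u) (⊗-zeroʳ v)) (⊕-identityˡ 𝟘)
    ⊗-zeroʳ (⊖ u)   = ≋-trans (⊖-cong (⊗-zeroʳ u)) ε⁻¹≈ε

    ⊗-negʳ : ∀ u v → u ⊗ ⊖ v ≋ ⊖ (u ⊗ v)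
    ⊗-negʳ ⟦ m ⟧   v = ≋-refl
    ⊗-negʳ 𝟘       v = ≋-sym ε⁻¹≈ε
    ⊗-negʳ (u ⊕ w) v = ≋-trans (⊕-cong (⊗-negʳ u v) (⊗-negʳ w v)) (⁻¹-∙-comm _ _)
    ⊗-negʳ (⊖ u)   v = ⊖-cong (⊗-negʳ u v)

    ⊗-distribˡ : ∀ u v w → u ⊗ (v ⊕ w) ≋ u ⊗ v ⊕ u ⊗ w
    ⊗-distribˡ ⟦ m ⟧    v w = ≋-refl
    ⊗-distribˡ 𝟘        v w = ≋-sym (⊕-identityˡ 𝟘)
    ⊗-distribˡ (u ⊕ u′) v w =
      ≋-trans (⊕-cong (⊗-distribˡ u v w) (⊗-distribˡ u′ v w)) (interchange _ _ _ _)
    ⊗-distribˡ (⊖ u)    v w =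
      ≋-trans (⊖-cong (⊗-distribˡ u v w)) (≋-sym (⁻¹-∙-comm _ _))

    ⊗-comm : ∀ u v → u ⊗ v ≋ v ⊗ u
    ⊗-comm ⟦ m ⟧    ⟦ m′ ⟧   = ⟦⟧-cong (++-comm m m′)
    ⊗-comm ⟦ m ⟧    𝟘        = ≋-refl
    ⊗-comm ⟦ m ⟧    (v ⊕ v′) = ⊕-cong (⊗-comm ⟦ m ⟧ v) (⊗-comm ⟦ m ⟧ v′)
    ⊗-comm ⟦ m ⟧    (⊖ v)    = ⊖-cong (⊗-comm ⟦ m ⟧ v)
    ⊗-comm 𝟘        v        = ≋-sym (⊗-zeroʳ v)
    ⊗-comm (u ⊕ u′) v        =
      ≋-trans (⊕-cong (⊗-comm u v) (⊗-comm u′ v)) (≋-sym (⊗-distribˡ v u u′))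
    ⊗-comm (⊖ u)    v        = ≋-trans (⊖-cong (⊗-comm u v)) (≋-sym (⊗-negʳ v u))

    ⊗-assoc : ∀ u v w → (u ⊗ v) ⊗ w ≋ u ⊗ (v ⊗ w)
    ⊗-assoc ⟦ m ⟧ ⟦ m′ ⟧ ⟦ m″ ⟧   = ⟦⟧-cong (++-assoc m m′ m″)
    ⊗-assoc ⟦ m ⟧ ⟦ m′ ⟧ 𝟘        = ≋-refl
    ⊗-assoc ⟦ m ⟧ ⟦ m′ ⟧ (w ⊕ w′) =
      ⊕-cong (⊗-assoc ⟦ m ⟧ ⟦ m′ ⟧ w) (⊗-assoc ⟦ m ⟧ ⟦ m′ ⟧ w′)
    ⊗-assoc ⟦ m ⟧ ⟦ m′ ⟧ (⊖ w)    = ⊖-cong (⊗-assoc ⟦ m ⟧ ⟦ m′ ⟧ w)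
    ⊗-assoc ⟦ m ⟧ 𝟘        w = ≋-refl
    ⊗-assoc ⟦ m ⟧ (v ⊕ v′) w = ⊕-cong (⊗-assoc ⟦ m ⟧ v w) (⊗-assoc ⟦ m ⟧ v′ w)
    ⊗-assoc ⟦ m ⟧ (⊖ v)    w = ⊖-cong (⊗-assoc ⟦ m ⟧ v w)
    ⊗-assoc 𝟘        v w = ≋-refl
    ⊗-assoc (u ⊕ u′) v w = ⊕-cong (⊗-assoc u v w) (⊗-assoc u′ v w)
    ⊗-assoc (⊖ u)    v w = ⊖-cong (⊗-assoc u v w)

    ⊗-identityˡ : ∀ u → 𝟙 ⊗ u ≋ u
    ⊗-identityˡ ⟦ m ⟧   = ⟦⟧-cong (++-identityˡ m)
    ⊗-identityˡ 𝟘       = ≋-refl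
    ⊗-identityˡ (u ⊕ v) = ⊕-cong (⊗-identityˡ u) (⊗-identityˡ v)
    ⊗-identityˡ (⊖ u)   = ⊖-cong (⊗-identityˡ u)

  polynomialRing : CommutativeRing ℓ ℓ
  polynomialRing .CommutativeRing.Carrier = Poly
  polynomialRing .CommutativeRing._≈_ = _≋_
  polynomialRing .CommutativeRing._+_ = _⊕_
  polynomialRing .CommutativeRing._*_ = _⊗_
  polynomialRing .CommutativeRing.-_ = ⊖_
  polynomialRing .CommutativeRing.0# = 𝟘
  polynomialRing .CommutativeRing.1# = 𝟙
  polynomialRing .CommutativeRing.isCommutativeRing = record
      { isRing = record
        { +-isAbelianGroup = AbelianGroup.isAbelianGroup freeAbelianGroup
        ; *-cong = λ {u} {u′} {v} {v′} p q → ≋-trans (⊗-congˡ v p) (⊗-congʳ u′ q)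
        ; *-assoc = ⊗-assoc
        ; *-identity = ⊗-identityˡ , λ u → ≋-trans (⊗-comm u 𝟙) (⊗-identityˡ u)
        ; distrib = ⊗-distribˡ , λ u v w → ≋-refl }
      ; *-comm = ⊗-comm }

ℤ[_] : Setoid ℓ ℓ → CommutativeRing ℓ ℓ
ℤ[ S ] = Polynomial.polynomialRing S

module _ {S : Setoid ℓ ℓ} (R : CommutativeRing ℓ ℓ) (f : Func S (CommutativeRing.setoid R)) where
  private
    module R = CommutativeRing R
    module RP = RingProperties R.ring
  open Polynomial S
  open Permutation S using (_↭_)
  open PermutationProperties R.setoid using (foldr-commMonoid)
  open PermutationProperties S using (map⁺)
  open Func f using (to)

  private
    evalMonomial : Monomial → R.Carrier
    evalMonomial m = foldr R._*_ R.1# (map to m)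

    evalMonomial-cong : ∀ {m m′} → m ↭ m′ → evalMonomial m R.≈ evalMonomial m′
    evalMonomial-cong e = foldr-commMonoid R.*-isCommutativeMonoid
      (map⁺ R.setoid (Func.cong f) e)

    evalMonomial-++ : ∀ m m′ → evalMonomial (m ++ m′) R.≈ evalMonomial m R.* evalMonomial m′
    evalMonomial-++ []      m′ = R.sym (R.*-identityˡ _)
    evalMonomial-++ (s ∷ m) m′ =
      R.trans (R.*-congˡ (evalMonomial-++ m m′)) (R.sym (R.*-assoc _ _ _))

    ev : Poly → R.Carrier
    ev = lift R.+-abelianGroup evalMonomial

    ev-* : ∀ u v → ev (u ⊗ v) R.≈ ev u R.* ev v
    ev-* ⟦ m ⟧    ⟦ m′ ⟧   = evalMonomial-++ m m′
    ev-* ⟦ m ⟧    𝟘        = R.sym (R.zeroʳ _)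
    ev-* ⟦ m ⟧    (v ⊕ v′) =
      R.trans (R.+-cong (ev-* ⟦ m ⟧ v) (ev-* ⟦ m ⟧ v′)) (R.sym (R.distribˡ _ _ _))
    ev-* ⟦ m ⟧    (⊖ v)    = R.trans (R.-‿cong (ev-* ⟦ m ⟧ v)) (RP.-‿distribʳ-* _ _)
    ev-* 𝟘        v        = R.sym (R.zeroˡ _)
    ev-* (u ⊕ u′) v        =
      R.trans (R.+-cong (ev-* u v) (ev-* u′ v)) (R.sym (R.distribʳ _ _ _))
    ev-* (⊖ u)    v        = R.trans (R.-‿cong (ev-* u v)) (RP.-‿distribˡ-* _ _)

  eval : RingHom ℤ[ S ] R
  eval .RingHomomorphism.⟦_⟧ = ev
  eval .RingHomomorphism.isRingHomomorphism = record
      { isSemiringHomomorphism = record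
        { isNearSemiringHomomorphism = record
          { +-isMonoidHomomorphism = record
            { isMagmaHomomorphism = record
              { isRelHomomorphism = record
                { cong = lift-cong R.+-abelianGroup evalMonomial-cong }
              ; homo = λ _ _ → R.refl }
            ; ε-homo = R.refl }
          ; *-homo = ev-* }
        ; 1#-homo = R.refl }
      ; -‿homo = λ _ → R.refl }

  eval-var : ∀ s → RingHomomorphism.⟦_⟧ eval (var s) R.≈ to s
  eval-var s = R.*-identityʳ (to s)

module _ {S : Setoid ℓ ℓ} {R : CommutativeRing ℓ ℓ} (h k : RingHom ℤ[ S ] R) where
  private
    module R = CommutativeRing R
    module h = RingHomomorphism h
    module k = RingHomomorphism k
  open Polynomial S

  polynomialRing-ext : (∀ s → h.⟦ var s ⟧ R.≈ k.⟦ var s ⟧) → ∀ u → h.⟦ u ⟧ R.≈ k.⟦ u ⟧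
  polynomialRing-ext e = go
    where
    monomial : ∀ m → h.⟦ ⟦ m ⟧ ⟧ R.≈ k.⟦ ⟦ m ⟧ ⟧
    monomial []      = R.trans h.1#-homo (R.sym k.1#-homo)
    monomial (s ∷ m) = R.trans (h.*-homo (var s) ⟦ m ⟧)
      (R.trans (R.*-cong (e s) (monomial m)) (R.sym (k.*-homo (var s) ⟦ m ⟧)))
    go : ∀ u → h.⟦ u ⟧ R.≈ k.⟦ u ⟧
    go ⟦ m ⟧   = monomial m
    go 𝟘       = R.trans h.0#-homo (R.sym k.0#-homo)
    go (u ⊕ v) = R.trans (h.+-homo u v)
      (R.trans (R.+-cong (go u) (go v)) (R.sym (k.+-homo u v)))
    go (⊖ u)   = R.trans (h.-‿homo u) (R.trans (R.-‿cong (go u)) (R.sym (k.-‿homo u)))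

module _ (R : CommutativeRing ℓ ℓ) where
  private module R = CommutativeRing R

  ℤ⟨_⟩ : CommutativeRing ℓ ℓ
  ℤ⟨_⟩ = ℤ[ R.setoid ]

  private
    idFunc : Func R.setoid R.setoid
    idFunc = record { to = id ; cong = id }

  present : RingHom ℤ⟨_⟩ R
  present = eval R idFunc

  present-var : ∀ r → RingHomomorphism.⟦_⟧ present (Polynomial.var R.setoid r) R.≈ r
  present-var = eval-var R idFunc

  I : Pred (CommutativeRing.Carrier ℤ⟨_⟩) ℓ
  I u = RingHomomorphism.⟦_⟧ present u R.≈ R.0#

  record _≡I_ (u v : CommutativeRing.Carrier ℤ⟨_⟩) : Set ℓ where
    constructor mod-I
    field difference-∈ : CommutativeRing._-_ ℤ⟨_⟩ u v ∈ I

  var-cong : ∀ {r s} → r R.≈ s →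
             CommutativeRing._≈_ ℤ⟨_⟩ (Polynomial.var R.setoid r) (Polynomial.var R.setoid s)
  var-cong e = Free.⟦⟧-cong (Permutation.prep e (Permutation.↭-refl R.setoid))

module _ {R S : CommutativeRing ℓ ℓ} (f : RingHom R S) where
  private
    module R = CommutativeRing R
    module S = CommutativeRing S
    module f = RingHomomorphism f
    module πR = RingHomomorphism (present R)
    module πS = RingHomomorphism (present S)
    module PS = CommutativeRing ℤ⟨ S ⟩

    f∘var : Func R.setoid PS.setoid
    f∘var = record
      { to   = λ r → Polynomial.var S.setoid f.⟦ r ⟧
      ; cong = λ e → Free.⟦⟧-cong (Permutation.prep (f.⟦⟧-cong e) (Permutation.↭-refl S.setoid)) }

  ℤ⟨⟩-map : RingHom ℤ⟨ R ⟩ ℤ⟨ S ⟩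
  ℤ⟨⟩-map = eval ℤ⟨ S ⟩ f∘var

  private module ℤf = RingHomomorphism ℤ⟨⟩-map

  ℤ⟨⟩-map-var : ∀ r → ℤf.⟦ Polynomial.var R.setoid r ⟧ PS.≈ Polynomial.var S.setoid f.⟦ r ⟧
  ℤ⟨⟩-map-var = eval-var ℤ⟨ S ⟩ f∘var

  present-natural : ∀ u → πS.⟦ ℤf.⟦ u ⟧ ⟧ S.≈ f.⟦ πR.⟦ u ⟧ ⟧
  present-natural = polynomialRing-ext
    {S = R.setoid} {R = S}
    (composeRing ℤ⟨ R ⟩ ℤ⟨ S ⟩ S (present S) ℤ⟨⟩-map) (composeRing ℤ⟨ R ⟩ R S f (present R))
    (λ r → S.trans (πS.⟦⟧-cong (ℤ⟨⟩-map-var r))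
      (S.trans (present-var S f.⟦ r ⟧) (S.sym (f.⟦⟧-cong (present-var R r)))))

  ≡I-map : ∀ {x y} → _≡I_ R x y → _≡I_ S ℤf.⟦ x ⟧ ℤf.⟦ y ⟧
  ≡I-map {x} {y} (mod-I p) = mod-I (S.trans (present-natural (CommutativeRing._-_ ℤ⟨ R ⟩ x y))
    (S.trans (f.⟦⟧-cong {πR.⟦ CommutativeRing._-_ ℤ⟨ R ⟩ x y ⟧} {R.0#} p) f.0#-homo))

  ℤ⟨⟩-map-ext : (g : RingHom R S) → (∀ r → f.⟦ r ⟧ S.≈ RingHomomorphism.⟦_⟧ g r) →
                (h : RingHom ℤ⟨ R ⟩ ℤ⟨ S ⟩) →
                (∀ r → RingHomomorphism.⟦_⟧ h (Polynomial.var R.setoid r) PS.≈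
                       Polynomial.var S.setoid (RingHomomorphism.⟦_⟧ g r)) →
                ∀ u → ℤf.⟦ u ⟧ PS.≈ RingHomomorphism.⟦_⟧ h u
  ℤ⟨⟩-map-ext g f≗g h h-var = polynomialRing-ext {S = R.setoid} {R = ℤ⟨ S ⟩} ℤ⟨⟩-map h
    (λ r → PS.trans (ℤ⟨⟩-map-var r)
      (PS.trans (Free.⟦⟧-cong (Permutation.prep (f≗g r) (Permutation.↭-refl S.setoid)))
                (PS.sym (h-var r))))

module _ {R S : CommutativeRing ℓ ℓ} where
  private
    module S = CommutativeRing S
    module PS = CommutativeRing ℤ⟨ S ⟩

  ℤ⟨⟩-map-cong : (f g : RingHom R S) →
                 (∀ r → RingHomomorphism.⟦_⟧ f r S.≈ RingHomomorphism.⟦_⟧ g r) →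
                 ∀ u → RingHomomorphism.⟦_⟧ (ℤ⟨⟩-map {R = R} {S = S} f) u PS.≈
                       RingHomomorphism.⟦_⟧ (ℤ⟨⟩-map {R = R} {S = S} g) u
  ℤ⟨⟩-map-cong f g f≗g = ℤ⟨⟩-map-ext {R = R} {S = S} f g f≗g
    (ℤ⟨⟩-map {R = R} {S = S} g) (ℤ⟨⟩-map-var {R = R} {S = S} g)

module _ (R : CommutativeRing ℓ ℓ) where
  private
    module R = CommutativeRing R
    module PR = CommutativeRing ℤ⟨ R ⟩

  ℤ⟨⟩-map-id : ∀ u → RingHomomorphism.⟦_⟧ (ℤ⟨⟩-map {R = R} {S = R} (idRing R)) u PR.≈ u
  ℤ⟨⟩-map-id = ℤ⟨⟩-map-ext {R = R} {S = R} (idRing R) (idRing R) (λ _ → R.refl)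
    (idRing ℤ⟨ R ⟩) (λ _ → PR.refl)

module _ {R S T : CommutativeRing ℓ ℓ} (g : RingHom S T) (f : RingHom R S) where
  private
    module T = CommutativeRing T
    module PT = CommutativeRing ℤ⟨ T ⟩
    g∘f = composeRing R S T g f
    ℤf = ℤ⟨⟩-map {R = R} {S = S} f
    ℤg = ℤ⟨⟩-map {R = S} {S = T} g
    module ℤf = RingHomomorphism ℤf
    module ℤg = RingHomomorphism ℤg

  ℤ⟨⟩-map-∘ : ∀ u → RingHomomorphism.⟦_⟧ (ℤ⟨⟩-map {R = R} {S = T} g∘f) u PT.≈ ℤg.⟦ ℤf.⟦ u ⟧ ⟧
  ℤ⟨⟩-map-∘ = ℤ⟨⟩-map-ext {R = R} {S = T} g∘f g∘f (λ _ → T.refl)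
    (composeRing ℤ⟨ R ⟩ ℤ⟨ S ⟩ ℤ⟨ T ⟩ ℤg ℤf)
    (λ r → PT.trans (ℤg.⟦⟧-cong (ℤ⟨⟩-map-var {R = R} {S = S} f r)) (ℤ⟨⟩-map-var {R = S} {S = T} g _))

module _ (A : VGroup ℓ) (p : ℕ) where
  open VGroup A

  Torsion : Pred Carrier ℓ
  Torsion x = ∃[ k ] (p ℕ.^ k) · x ≈ 0#

  private
    Torsion-V : ∀ {x} → x ∈ Torsion → V x ∈ Span A Torsion
    Torsion-V {x} (k , e) = gen (k , trans (sym (V-· (p ℕ.^ k) x)) (trans (V-cong e) V-0))

  closedTorsion : VSubgroup A
  closedTorsion = closedSubgroup A (V-adic A) Torsion Torsion-V

module _ {A B : VGroup ℓ} (f : VHom A B) (p : ℕ) where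
  private
    module B = VGroup B
  open VHom f

  closedTorsion-map : ∀ {x} → VSubgroup.mem (closedTorsion A p) x →
                      VSubgroup.mem (closedTorsion B p) ⟦ x ⟧
  closedTorsion-map = Closure-map f (V-adic A) (V-adic B) (V-adic-map f)
    (λ {x} (k , e) → gen (k ,
      B.trans (B.sym (×-homo (p ℕ.^ k) x)) (B.trans (⟦⟧-cong e) ε-homo)))

module _ (A : VGroup ℓ) (P : VSubgroup A) (p : ℕ) where
  open VGroup A
  private module P = VSubgroup P

  private
    ·-mem : ∀ n {x} → P.mem x → P.mem (n · x)
    ·-mem zero    x∈P = P.0-mem
    ·-mem (suc n) x∈P = P.+-mem x∈P (·-mem n x∈P)

    ·-0 : ∀ n → n · 0# ≈ 0#
    ·-0 zero    = refl
    ·-0 (suc n) = trans (identityˡ _) (·-0 n)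

    ·-neg : ∀ n x → n · (- x) ≈ - (n · x)
    ·-neg zero    x = sym ε⁻¹≈ε
    ·-neg (suc n) x = trans (∙-congˡ (·-neg n x)) (⁻¹-∙-comm x (n · x))

    ^-split : ∀ k l x → (p ℕ.^ (l ℕ.+ k)) · x ≈ (p ℕ.^ l) · ((p ℕ.^ k) · x)
    ^-split k l x = trans
      (reflexive (≡.cong (_· x) (ℕ.^-distribˡ-+-* p l k)))
      (sym (×-assocˡ x (p ℕ.^ l) (p ℕ.^ k)))

  saturation : VSubgroup A
  saturation .VSubgroup.mem = λ x → ∃[ k ] P.mem ((p ℕ.^ k) · x)
  saturation .VSubgroup.resp = λ e (k , m) → k , P.resp (×-congʳ (p ℕ.^ k) e) m
  saturation .VSubgroup.0-mem = 0 , P.resp (sym (·-0 1)) P.0-mem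
  saturation .VSubgroup.+-mem {x} {y} (k , m) (l , m′) = l ℕ.+ k , P.resp
        (sym (trans (×-distrib-+ x y (p ℕ.^ (l ℕ.+ k)))
          (∙-cong (^-split k l x)
            (trans (reflexive (≡.cong (λ j → (p ℕ.^ j) · y) (ℕ.+-comm l k))) (^-split l k y)))))
        (P.+-mem (·-mem (p ℕ.^ l) m) (·-mem (p ℕ.^ k) m′))
  saturation .VSubgroup.neg-mem {x} (k , m) = k , P.resp (sym (·-neg (p ℕ.^ k) x)) (P.neg-mem m)
  saturation .VSubgroup.V-mem {x} (k , m) = k , P.resp (V-· (p ℕ.^ k) x) (P.V-mem m)

module _ {A B : VGroup ℓ} (f : VHom A B) (P : VSubgroup A) (Q : VSubgroup B) (p : ℕ) where
  open VHom f

  saturation-map : (∀ {x} → VSubgroup.mem P x → VSubgroup.mem Q ⟦ x ⟧) → ∀ {x} →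
                   VSubgroup.mem (saturation A P p) x → VSubgroup.mem (saturation B Q p) ⟦ x ⟧
  saturation-map f-mem {x} (k , m) =
    k , VSubgroup.resp Q (×-homo (p ℕ.^ k) x) (f-mem m)

module RingPowers {R S : Ring ℓ ℓ} (f : RingHomomorphism (Ring.rawRing R) (Ring.rawRing S)) where
  private
    module R = Ring R
    module S = Ring S
  open RingHomomorphism f
  open Exp R.semiring using () renaming (_^_ to _^ᴿ_)
  open Exp S.semiring using () renaming (_^_ to _^ˢ_)

  ^-homo : ∀ n x → ⟦ x ^ᴿ n ⟧ S.≈ ⟦ x ⟧ ^ˢ n
  ^-homo zero    x = 1#-homo
  ^-homo (suc n) x = S.trans (*-homo x (x ^ᴿ n)) (S.*-congˡ (^-homo n x))

-- The relations defining H(R), for a VGroup A with elements v n r in the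
-- role of the symbols Vⁿᵣ.  The exponent n ≥ 1 is written suc n.
module Relations (p : ℕ) (R : Ring ℓ ℓ) (A : VGroup ℓ)
                 (v : ℕ → Ring.Carrier R → VGroup.Carrier A) where
  private module R = Ring R
  open VGroup A
  open Exp R.semiring using (_^_)

  δ : ℕ → R.Carrier → Carrier
  δ n x = v (suc n) (x ^ p) - p · v n x

  data Relation : Pred Carrier ℓ where
    additive : ∀ n x y → Relation ((δ n (x R.+ y) - δ n x) - δ n y)
    odd      : ∀ n r → Relation (v n r + v n (R.- r))

  module _ (V-v : ∀ n r → V (v n r) ≈ v (suc n) r) where

    private
      V-δ : ∀ n x → V (δ n x) ≈ δ (suc n) x
      V-δ n x = trans (V-- _ _)
        (∙-cong (V-v (suc n) (x ^ p)) (⁻¹-cong (trans (V-· p (v n x)) (×-congʳ p (V-v n x)))))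

    Relation-V : ∀ {u} → u ∈ Relation → V u ∈ Span A Relation
    Relation-V (additive n x y) = resp
      (sym (trans (V-- _ _)
        (∙-cong (trans (V-- _ _) (∙-cong (V-δ n (x R.+ y)) (⁻¹-cong (V-δ n x))))
                (⁻¹-cong (V-δ n y)))))
      (gen (additive (suc n) x y))
    Relation-V (odd n r) = resp
      (sym (trans (V-+ _ _) (∙-cong (V-v n r) (V-v n (R.- r)))))
      (gen (odd (suc n) r))

module _ (p : ℕ) {R S : Ring ℓ ℓ} (f : RingHomomorphism (Ring.rawRing R) (Ring.rawRing S))
         {A B : VGroup ℓ} (φ : VHom A B)
         (v : ℕ → Ring.Carrier R → VGroup.Carrier A)
         (w : ℕ → Ring.Carrier S → VGroup.Carrier B) where
  private
    module R = Ring R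
    module S = Ring S
    module B = VGroup B
    module f = RingHomomorphism f
    module v = Relations p R A v
    module w = Relations p S B w
  open VHom φ

  module _ (w-cong : ∀ n {r s} → r S.≈ s → w n r B.≈ w n s)
           (φ-v : ∀ n r → ⟦ v n r ⟧ B.≈ w n f.⟦ r ⟧) where

    private
      δ-cong : ∀ n {x y} → x S.≈ y → w.δ n x B.≈ w.δ n y
      δ-cong n e = B.∙-cong (w-cong (suc n) (Exp.^-congˡ S.semiring p e))
        (B.⁻¹-cong (B.×-congʳ p (w-cong n e)))

      φ-δ : ∀ n x → ⟦ v.δ n x ⟧ B.≈ w.δ n f.⟦ x ⟧
      φ-δ n x = B.trans (-homo _ _) (B.∙-cong
        (B.trans (φ-v (suc n) _) (w-cong (suc n) (RingPowers.^-homo {R = R} {S = S} f p x)))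
        (B.⁻¹-cong (B.trans (×-homo p (v n x)) (B.×-congʳ p (φ-v n x)))))

    Relation-map : ∀ {u} → u ∈ v.Relation → ⟦ u ⟧ ∈ Span B w.Relation
    Relation-map (v.additive n x y) = resp
      (B.sym (B.trans (-homo _ _)
        (B.∙-cong
          (B.trans (-homo _ _)
            (B.∙-cong (B.trans (φ-δ n (x R.+ y)) (δ-cong n (f.+-homo x y))) (B.⁻¹-cong (φ-δ n x))))
          (B.⁻¹-cong (φ-δ n y)))))
      (gen (w.additive n f.⟦ x ⟧ f.⟦ y ⟧))
    Relation-map (v.odd n r) = resp
      (B.sym (B.trans (∙-homo _ _)
        (B.∙-cong (φ-v n r) (B.trans (φ-v n (R.- r)) (w-cong n (f.-‿homo r))))))
      (gen (w.odd n f.⟦ r ⟧))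

module G-construction (p : ℕ) (R : Ring ℓ ℓ) where
  private module R = Ring R

  -- The pair (n , r) is the symbol Vⁿᵣ.
  Symbol : Setoid ℓ ℓ
  Symbol = ×-setoid (≡.setoid ℕ) R.setoid

  module F = Free Symbol

  shift : Func Symbol Symbol
  shift = record { to = λ (n , r) → suc n , r ; cong = λ (e , e′) → ≡.cong suc e , e′ }

  freeVGroup : VGroup ℓ
  freeVGroup .VGroup.group = F.freeAbelianGroup
  freeVGroup .VGroup.endo = freeMap Symbol Symbol shift

  -- There are generators Vⁿᵣ for all r ∈ R, those with r = 0 being killed
  -- afterwards; no decision of r = 0 is needed to interpret Vⁿᵣ.
  data ZeroSymbol : Pred F.Formal ℓ where
    zeroSymbol : ∀ n → ZeroSymbol F.⟦ n , R.0# ⟧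

  zeroSymbols : VSubgroup freeVGroup
  zeroSymbols = generated freeVGroup ZeroSymbol λ { (zeroSymbol n) → gen (zeroSymbol (suc n)) }

  G̃ : VGroup ℓ
  G̃ = freeVGroup / zeroSymbols

  module G̃ = VGroup G̃

  v : ℕ → R.Carrier → G̃.Carrier
  v n r = F.⟦ n , r ⟧

  v-cong : ∀ n {r s} → r R.≈ s → v n r G̃.≈ v n s
  v-cong n e = Quotient.≈⇒~ freeVGroup zeroSymbols (F.⟦⟧-cong (≡.refl , e))

  open Relations p R G̃ v

  H : VSubgroup G̃
  H = generated G̃ Relation (Relation-V (λ n r → G̃.refl))

  H̃ : VSubgroup G̃
  H̃ = saturation G̃ H p

  G⁰ : VGroup ℓ
  G⁰ = completion (G̃ / H̃)

  T : VSubgroup G⁰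
  T = closedTorsion G⁰ p

  G : VGroup ℓ
  G = G⁰ / T

  symbol : ℕ → R.Carrier → VGroup.Carrier G
  symbol n r = toCompletion (G̃ / H̃) (v n r)

  module G = VGroup G

  G-≈ : ∀ {x y : G.Carrier} →
        (∀ n → Coherent.seq x n F.≋ Coherent.seq y n) → x G.≈ y
  G-≈ e = Quotient.≈⇒~ G⁰ T (coordinatewise (λ n →
    Quotient.≈⇒~ (G̃ / H̃) (V-adic (G̃ / H̃) n)
      (Quotient.≈⇒~ G̃ H̃ (Quotient.≈⇒~ freeVGroup zeroSymbols (e n)))))

  symbol-cong : ∀ n {r s} → r R.≈ s → symbol n r G.≈ symbol n s
  symbol-cong n e = G-≈ (λ _ → F.⟦⟧-cong (≡.refl , e))

  V-symbol : ∀ n r → G.V (symbol n r) G.≈ symbol (suc n) r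
  V-symbol n r = G-≈ (λ _ → F.≋-refl)

module _ (p : ℕ) {R S : Ring ℓ ℓ} (f : RingHomomorphism (Ring.rawRing R) (Ring.rawRing S)) where
  private
    module R = Ring R
    module S = Ring S
    module GR = G-construction p R
    module GS = G-construction p S
    open RingHomomorphism f

    symbolMap : Func GR.Symbol GS.Symbol
    symbolMap = record { to = λ (n , r) → n , ⟦ r ⟧ ; cong = λ (e , e′) → e , ⟦⟧-cong e′ }

  formalMap : GR.F.Formal → GS.F.Formal
  formalMap = GroupHomomorphism.⟦_⟧ (freeMap GR.Symbol GS.Symbol symbolMap)

  private
    formalMap-V : ∀ u → formalMap (VGroup.V GR.freeVGroup u) GS.F.≋ VGroup.V GS.freeVGroup (formalMap u)
    formalMap-V GR.F.⟦ s ⟧     = GS.F.≋-refl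
    formalMap-V GR.F.𝟘         = GS.F.≋-refl
    formalMap-V (u GR.F.⊕ v)   = GS.F.⊕-cong (formalMap-V u) (formalMap-V v)
    formalMap-V (GR.F.⊖ u)     = GS.F.⊖-cong (formalMap-V u)

    freeVMap : VHom GR.freeVGroup GS.freeVGroup
    freeVMap = record { hom = freeMap GR.Symbol GS.Symbol symbolMap ; V-homo = formalMap-V }

    ZeroSymbol-map : ∀ {u} → u ∈ GR.ZeroSymbol → formalMap u ∈ Span GS.freeVGroup GS.ZeroSymbol
    ZeroSymbol-map (GR.zeroSymbol n) =
      resp (GS.F.⟦⟧-cong (≡.refl , S.sym 0#-homo)) (gen (GS.zeroSymbol n))

    zeroSymbols-map : ∀ {u} → Span GR.freeVGroup GR.ZeroSymbol u →
                      Span GS.freeVGroup GS.ZeroSymbol (formalMap u)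
    zeroSymbols-map = Span-map {A = GR.freeVGroup} {B = GS.freeVGroup} freeVMap ZeroSymbol-map

    G̃-map : VHom GR.G̃ GS.G̃
    G̃-map = quotientMap {A = GR.freeVGroup} {B = GS.freeVGroup} freeVMap
      GR.zeroSymbols GS.zeroSymbols zeroSymbols-map

    relations-map : ∀ {u} → u ∈ Relations.Relation p R GR.G̃ GR.v →
                    formalMap u ∈ Span GS.G̃ (Relations.Relation p S GS.G̃ GS.v)
    relations-map = Relation-map p {R = R} {S = S} f {A = GR.G̃} {B = GS.G̃} G̃-map GR.v GS.v
      GS.v-cong (λ n r → GS.G̃.refl)

    H-map : ∀ {u} → VSubgroup.mem GR.H u → VSubgroup.mem GS.H (formalMap u)
    H-map = Span-map {A = GR.G̃} {B = GS.G̃} G̃-map relations-map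

    H̃-map : ∀ {u} → VSubgroup.mem GR.H̃ u → VSubgroup.mem GS.H̃ (formalMap u)
    H̃-map = saturation-map {A = GR.G̃} {B = GS.G̃} G̃-map GR.H GS.H p H-map

    G⁰-map : VHom GR.G⁰ GS.G⁰
    G⁰-map = completionMap {A = GR.G̃ / GR.H̃} {B = GS.G̃ / GS.H̃}
      (quotientMap {A = GR.G̃} {B = GS.G̃} G̃-map GR.H̃ GS.H̃ H̃-map)

    T-map : ∀ {x} → VSubgroup.mem GR.T x → VSubgroup.mem GS.T (VHom.⟦_⟧ G⁰-map x)
    T-map {x} = closedTorsion-map {A = GR.G⁰} {B = GS.G⁰} G⁰-map p {x}

  G-map : VHom GR.G GS.G
  G-map = quotientMap {A = GR.G⁰} {B = GS.G⁰} G⁰-map GR.T GS.T T-map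

module _ (p : ℕ) {R S T : Ring ℓ ℓ}
         (h : RingHomomorphism (Ring.rawRing R) (Ring.rawRing T))
         (g : RingHomomorphism (Ring.rawRing S) (Ring.rawRing T))
         (f : RingHomomorphism (Ring.rawRing R) (Ring.rawRing S)) where
  private
    module T = Ring T
    module FR = Free (G-construction.Symbol p R)
    module FS = Free (G-construction.Symbol p S)
    module FT = Free (G-construction.Symbol p T)
    module h = RingHomomorphism h
    module g = RingHomomorphism g
    module f = RingHomomorphism f
  open FT

  formalMap-∘ : (∀ r → h.⟦ r ⟧ T.≈ g.⟦ f.⟦ r ⟧ ⟧) → ∀ u →
                formalMap p {R = R} {S = T} h u ≋
                formalMap p {R = S} {S = T} g (formalMap p {R = R} {S = S} f u)
  formalMap-∘ e FR.⟦ n , r ⟧ = ⟦⟧-cong (≡.refl , e r)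
  formalMap-∘ e FR.𝟘         = ≋-refl
  formalMap-∘ e (u FR.⊕ v)   = ⊕-cong (formalMap-∘ e u) (formalMap-∘ e v)
  formalMap-∘ e (FR.⊖ u)     = ⊖-cong (formalMap-∘ e u)

module _ (p : ℕ) {R S : Ring ℓ ℓ} where
  private
    module S = Ring S
    module FR = Free (G-construction.Symbol p R)
    module FS = Free (G-construction.Symbol p S)

  formalMap-cong : (f g : RingHomomorphism (Ring.rawRing R) (Ring.rawRing S)) →
                   (∀ r → RingHomomorphism.⟦_⟧ f r S.≈ RingHomomorphism.⟦_⟧ g r) → ∀ u →
                   formalMap p {R = R} {S = S} f u FS.≋ formalMap p {R = R} {S = S} g u
  formalMap-cong f g e = FR.lift-ext FS.freeAbelianGroup (λ (n , r) → FS.⟦⟧-cong (≡.refl , e r))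

module _ (p : ℕ) (R : Ring ℓ ℓ) where
  private module R = Ring R
  open Free (G-construction.Symbol p R)

  formalMap-id : (f : RingHomomorphism (Ring.rawRing R) (Ring.rawRing R)) →
                 (∀ r → RingHomomorphism.⟦_⟧ f r R.≈ r) → ∀ u →
                 formalMap p {R = R} {S = R} f u ≋ u
  formalMap-id f e ⟦ n , r ⟧ = ⟦⟧-cong (≡.refl , e r)
  formalMap-id f e 𝟘         = ≋-refl
  formalMap-id f e (u ⊕ v)   = ⊕-cong (formalMap-id f e u) (formalMap-id f e v)
  formalMap-id f e (⊖ u)     = ⊖-cong (formalMap-id f e u)

record Functor (ℓ : Level) : Set (lsuc ℓ) where
  field
    F₀ : CommutativeRing ℓ ℓ → AbelianGroup ℓ ℓ
    F₁ : ∀ R S → RingHom R S → GroupHom (F₀ R) (F₀ S)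

  map₁ : ∀ R S → RingHom R S → AbelianGroup.Carrier (F₀ R) → AbelianGroup.Carrier (F₀ S)
  map₁ R S f = GroupHomomorphism.⟦_⟧ (F₁ R S f)

  field
    F₁-cong : ∀ R S (f g : RingHom R S) →
              (∀ r → CommutativeRing._≈_ S (RingHomomorphism.⟦_⟧ f r) (RingHomomorphism.⟦_⟧ g r)) →
              ∀ x → AbelianGroup._≈_ (F₀ S) (map₁ R S f x) (map₁ R S g x)
    F₁-id   : ∀ R x → AbelianGroup._≈_ (F₀ R) (map₁ R R (idRing R) x) x
    F₁-∘    : ∀ R S T (g : RingHom S T) (f : RingHom R S) x →
              AbelianGroup._≈_ (F₀ T) (map₁ R T (composeRing R S T g f) x)
                                      (map₁ S T g (map₁ R S f x))

-- teich R r is ⟨ r ⟩ ∈ F(R).  None of the axioms of a weak pre-Witt functor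
-- beyond functoriality is included here.
record V⟨⟩-Functor (ℓ : Level) : Set (lsuc ℓ) where
  field
    functor : Functor ℓ

  open Functor functor public

  field
    V             : ∀ R → GroupHom (F₀ R) (F₀ R)
    V-natural     : ∀ R S (f : RingHom R S) x →
                    AbelianGroup._≈_ (F₀ S)
                      (map₁ R S f (GroupHomomorphism.⟦_⟧ (V R) x))
                      (GroupHomomorphism.⟦_⟧ (V S) (map₁ R S f x))
    teich         : ∀ R → CommutativeRing.Carrier R → AbelianGroup.Carrier (F₀ R)
    teich-cong    : ∀ R → Congruent (CommutativeRing._≈_ R) (AbelianGroup._≈_ (F₀ R)) (teich R)
    teich-natural : ∀ R S (f : RingHom R S) r →
                    AbelianGroup._≈_ (F₀ S)
                      (map₁ R S f (teich R r)) (teich S (RingHomomorphism.⟦_⟧ f r))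

  value : CommutativeRing ℓ ℓ → VGroup ℓ
  value R .VGroup.group = F₀ R
  value R .VGroup.endo  = V R

record _⟶_ (F F′ : V⟨⟩-Functor ℓ) : Set (lsuc ℓ) where
  private
    module F  = V⟨⟩-Functor F
    module F′ = V⟨⟩-Functor F′
  field
    component   : ∀ R → GroupHom (F.F₀ R) (F′.F₀ R)

  at : ∀ R → AbelianGroup.Carrier (F.F₀ R) → AbelianGroup.Carrier (F′.F₀ R)
  at R = GroupHomomorphism.⟦_⟧ (component R)

  field
    natural     : ∀ R S (f : RingHom R S) x →
                  AbelianGroup._≈_ (F′.F₀ S) (at S (F.map₁ R S f x)) (F′.map₁ R S f (at R x))
    V-compat    : ∀ R x → AbelianGroup._≈_ (F′.F₀ R)
                    (at R (VGroup.V (F.value R) x)) (VGroup.V (F′.value R) (at R x))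
    teich-compat : ∀ R r → AbelianGroup._≈_ (F′.F₀ R) (at R (F.teich R r)) (F′.teich R r)

record IsWeakPreWitt (p : ℕ) (F : V⟨⟩-Functor ℓ) : Set (lsuc ℓ) where
  open V⟨⟩-Functor F using (teich; value)

  field
    teich-0 : ∀ R → let open VGroup (value R) in
              teich R (CommutativeRing.0# R) ≈ 0#
    teich-neg : ∀ R x → let open VGroup (value R) in
                teich R (CommutativeRing.-_ R x) ≈ - teich R x
    additive : ∀ R x y → let
                 open VGroup (value R)
                 open CommutativeRing R using () renaming (Carrier to C; _+_ to _+ᴿ_; semiring to semiringᴿ)
                 open Exp semiringᴿ using (_^_)
                 δ : C → Carrier
                 δ z = V (teich R (z ^ p)) - p · teich R z
               in δ (x +ᴿ y) ≈ δ x + δ y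
    complete : ∀ R → IsVComplete (value R)
    p-torsion-free : ∀ (S : Setoid ℓ ℓ) x → let open VGroup (value ℤ[ S ]) in
                     p · x ≈ 0# → x ≈ 0#

record IsUniversalWeakPreWitt (p : ℕ) (F : V⟨⟩-Functor ℓ) : Set (lsuc ℓ) where
  field
    isWeakPreWitt : IsWeakPreWitt p F
    exists : ∀ F′ → IsWeakPreWitt p F′ → F ⟶ F′
    unique : ∀ F′ → IsWeakPreWitt p F′ → (θ θ′ : F ⟶ F′) → ∀ R x →
             AbelianGroup._≈_ (V⟨⟩-Functor.F₀ F′ R) (_⟶_.at θ R x) (_⟶_.at θ′ R x)

module C-construction (p : ℕ) (R : CommutativeRing ℓ ℓ) where
  ℤR : CommutativeRing ℓ ℓ
  ℤR = ℤ⟨ R ⟩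

  open G-construction p (CommutativeRing.ring ℤR) using (Symbol; G; G-≈; symbol; V-symbol)

  -- Generated by Vⁿₓ - Vⁿ_y with x - y ∈ I.
  G-I : VSubgroup G
  G-I = closedSubgroup G (V-adic G) (Difference G symbol (_≡I_ R))
    (Difference-V G symbol (_≡I_ R) V-symbol)

  C : VGroup ℓ
  C = G / G-I

  teichC : CommutativeRing.Carrier R → VGroup.Carrier C
  teichC r = symbol 0 (Polynomial.var (CommutativeRing.setoid R) r)

  C-≈ : ∀ {x y : VGroup.Carrier C} →
        (∀ n → Free._≋_ Symbol (Coherent.seq x n) (Coherent.seq y n)) → VGroup._≈_ C x y
  C-≈ {x} {y} e = Quotient.≈⇒~ G G-I (G-≈ {x} {y} e)

module _ (p : ℕ) {R S : CommutativeRing ℓ ℓ} (f : RingHom R S) where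
  private
    module CR = C-construction p R
    module CS = C-construction p S
    module GR = G-construction p (CommutativeRing.ring CR.ℤR)
    module GS = G-construction p (CommutativeRing.ring CS.ℤR)

    ℤf : RingHom CR.ℤR CS.ℤR
    ℤf = ℤ⟨⟩-map {R = R} {S = S} f

    module ℤf = RingHomomorphism ℤf

    Gf : VHom GR.G GS.G
    Gf = G-map p {R = CommutativeRing.ring CR.ℤR} {S = CommutativeRing.ring CS.ℤR} ℤf

    symbol-map : ∀ n x → VHom.⟦_⟧ Gf (GR.symbol n x) GS.G.≈ GS.symbol n ℤf.⟦ x ⟧
    symbol-map n x = GS.G-≈ (λ _ → GS.F.≋-refl)

    Differences-map : ∀ {u} → u ∈ Difference GR.G GR.symbol (_≡I_ R) →
                      VHom.⟦_⟧ Gf u ∈ Span GS.G (Difference GS.G GS.symbol (_≡I_ S))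
    Differences-map {u} = Difference-map {A = GR.G} {B = GS.G} Gf
      GR.symbol (_≡I_ R) GS.symbol (_≡I_ S) ℤf.⟦_⟧
      symbol-map (≡I-map {R = R} {S = S} f) {u}

    G-I-map : ∀ {u} → VSubgroup.mem CR.G-I u → VSubgroup.mem CS.G-I (VHom.⟦_⟧ Gf u)
    G-I-map {u} = Closure-map {A = GR.G} {B = GS.G} Gf (V-adic GR.G) (V-adic GS.G)
      {S = Difference GR.G GR.symbol (_≡I_ R)} {T = Difference GS.G GS.symbol (_≡I_ S)}
      (V-adic-map {A = GR.G} {B = GS.G} Gf) Differences-map {u}

  C-map : VHom CR.C CS.C
  C-map = quotientMap {A = GR.G} {B = GS.G} Gf CR.G-I CS.G-I G-I-map

  C-map-teich : ∀ r → VGroup._≈_ CS.C (VHom.⟦_⟧ C-map (CR.teichC r)) (CS.teichC (RingHomomorphism.⟦_⟧ f r))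
  C-map-teich r = Quotient.≈⇒~ GS.G CS.G-I (GS.G.trans (symbol-map 0 _)
    (GS.symbol-cong 0 (ℤ⟨⟩-map-var {R = R} {S = S} f r)))

C : (p : ℕ) → V⟨⟩-Functor ℓ
C p .V⟨⟩-Functor.functor .Functor.F₀ R = VGroup.group (C-construction.C p R)
C p .V⟨⟩-Functor.functor .Functor.F₁ R S f = VHom.hom (C-map p {R = R} {S = S} f)
C p .V⟨⟩-Functor.functor .Functor.F₁-cong R S f g f≗g x =
  C-construction.C-≈ p S λ n →
    formalMap-cong p {R = CommutativeRing.ring ℤ⟨ R ⟩} {S = CommutativeRing.ring ℤ⟨ S ⟩}
      (ℤ⟨⟩-map {R = R} {S = S} f) (ℤ⟨⟩-map {R = R} {S = S} g)
      (ℤ⟨⟩-map-cong {R = R} {S = S} f g f≗g) (Coherent.seq x n)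
C p .V⟨⟩-Functor.functor .Functor.F₁-id R x =
  C-construction.C-≈ p R λ n →
    formalMap-id p (CommutativeRing.ring ℤ⟨ R ⟩) (ℤ⟨⟩-map {R = R} {S = R} (idRing R))
      (ℤ⟨⟩-map-id R) (Coherent.seq x n)
C p .V⟨⟩-Functor.functor .Functor.F₁-∘ R S T g f x =
  C-construction.C-≈ p T λ n →
    formalMap-∘ p {R = CommutativeRing.ring ℤ⟨ R ⟩} {S = CommutativeRing.ring ℤ⟨ S ⟩}
      {T = CommutativeRing.ring ℤ⟨ T ⟩}
      (ℤ⟨⟩-map {R = R} {S = T} (composeRing R S T g f))
      (ℤ⟨⟩-map {R = S} {S = T} g) (ℤ⟨⟩-map {R = R} {S = S} f)
      (ℤ⟨⟩-map-∘ {R = R} {S = S} {T = T} g f) (Coherent.seq x n)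
C p .V⟨⟩-Functor.V R = VGroup.endo (C-construction.C p R)
C p .V⟨⟩-Functor.V-natural R S f = VHom.V-homo (C-map p {R = R} {S = S} f)
C p .V⟨⟩-Functor.teich R = C-construction.teichC p R
C p .V⟨⟩-Functor.teich-cong R e =
  C-construction.C-≈ p R λ _ → Free.⟦⟧-cong (≡.refl , var-cong R e)
C p .V⟨⟩-Functor.teich-natural R S f = C-map-teich p {R = R} {S = S} f

module X-construction (p : ℕ) (B : CommutativeRing ℓ ℓ) where
  private module B = CommutativeRing B
  open Exp B.semiring using (_^_)
  open RawMult B.+-rawMonoid using () renaming (_×_ to infixr 8 _·_)
  open MultProperties B.+-commutativeMonoid using (×-congʳ; ×-distrib-+)

  -- V (b₀ , b₁ , …) = p (0 , b₀ , b₁ , …), with p · 0 simplified to 0.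
  V-sequence : (ℕ → B.Carrier) → ℕ → B.Carrier
  V-sequence b zero    = B.0#
  V-sequence b (suc i) = p · b i

  private
    sequenceGroup : AbelianGroup ℓ ℓ
    sequenceGroup = Pointwise.abelianGroup ℕ B.+-abelianGroup

  sequences : VGroup ℓ
  sequences .VGroup.group = sequenceGroup
  sequences .VGroup.endo  = mkGroupHom sequenceGroup sequenceGroup V-sequence
    (λ { e zero → B.refl ; e (suc i) → ×-congʳ p (e i) })
    (λ { b c zero → B.sym (B.+-identityˡ B.0#) ; b c (suc i) → ×-distrib-+ (b i) (c i) p })

  open VGroup sequences using (Carrier; V^)

  private
    p·0 : ∀ n → n · B.0# B.≈ B.0#
    p·0 zero    = B.refl
    p·0 (suc n) = B.trans (B.+-identityˡ _) (p·0 n)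

  -- The product topology on B^ℕ for discrete B: the n-th neighbourhood of 0
  -- consists of the sequences whose first n entries vanish.
  productTopology : Topology sequences
  productTopology n .VSubgroup.mem b = ∀ i → i ℕ.< n → b i B.≈ B.0#
  productTopology n .VSubgroup.resp e b∈ i i<n = B.trans (B.sym (e i)) (b∈ i i<n)
  productTopology n .VSubgroup.0-mem i i<n = B.refl
  productTopology n .VSubgroup.+-mem b∈ c∈ i i<n =
    B.trans (B.+-cong (b∈ i i<n) (c∈ i i<n)) (B.+-identityˡ B.0#)
  productTopology n .VSubgroup.neg-mem b∈ i i<n =
    B.trans (B.-‿cong (b∈ i i<n)) (RingProperties.-0#≈0# B.ring)
  productTopology n .VSubgroup.V-mem b∈ zero    i<n = B.refl
  productTopology n .VSubgroup.V-mem b∈ (suc i) i<n =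
    B.trans (×-congʳ p (b∈ i (ℕ.<-trans (ℕ.n<1+n i) i<n))) (p·0 p)

  -- ⟨ b ⟩ = (b , b^p , b^p² , …)
  powers : B.Carrier → Carrier
  powers b i = b ^ (p ℕ.^ i)

  powers-cong : ∀ {b c} → b B.≈ c → ∀ i → powers b i B.≈ powers c i
  powers-cong e i = Exp.^-congˡ B.semiring (p ℕ.^ i) e

  data Generator : Pred Carrier ℓ where
    generator : ∀ n b → Generator (V^ n (powers b))

  closedGenerated : VSubgroup sequences
  closedGenerated = closedSubgroup sequences productTopology Generator
    λ { (generator n b) → gen (generator (suc n) b) }

  X : VGroup ℓ
  X = sub sequences closedGenerated

  X-topology : Topology X
  X-topology n = restrict sequences closedGenerated (productTopology n)

  -- Vⁿ⟨ b ⟩ as an element of X(B).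
  generatorX : ℕ → B.Carrier → VGroup.Carrier X
  generatorX n b = VGroup.V^ X n
    (powers b , Span⊆Closure sequences productTopology Generator (gen (generator 0 b)))

  generatorX-V : ∀ n b → VGroup._≈_ X (VGroup.V X (generatorX n b)) (generatorX (suc n) b)
  generatorX-V n b = VGroup.refl X

module _ (p : ℕ) {B B′ : CommutativeRing ℓ ℓ} (f : RingHom B B′) where
  private
    module B = CommutativeRing B
    module B′ = CommutativeRing B′
    module XB = X-construction p B
    module XB′ = X-construction p B′
    open RingHomomorphism f

    ring-+-hom : GroupHom B.+-abelianGroup B′.+-abelianGroup
    ring-+-hom = mkGroupHom B.+-abelianGroup B′.+-abelianGroup ⟦_⟧ ⟦⟧-cong +-homo

    V-sequence-map : ∀ b i → ⟦ XB.V-sequence b i ⟧ B′.≈ XB′.V-sequence (λ j → ⟦ b j ⟧) i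
    V-sequence-map b zero    = 0#-homo
    V-sequence-map b (suc i) =
      GroupHomProperties.×-homo {A = B.+-abelianGroup} {B = B′.+-abelianGroup} ring-+-hom p (b i)

    sequencesMap : VHom XB.sequences XB′.sequences
    sequencesMap .VHom.hom = mkGroupHom (VGroup.group XB.sequences) (VGroup.group XB′.sequences)
      (λ b i → ⟦ b i ⟧) (λ e i → ⟦⟧-cong (e i)) (λ b c i → +-homo (b i) (c i))
    sequencesMap .VHom.V-homo = V-sequence-map

    productTopology-map : ∀ n {b} → VSubgroup.mem (XB.productTopology n) b →
                          VSubgroup.mem (XB′.productTopology n) (λ i → ⟦ b i ⟧)
    productTopology-map n b∈ i i<n = B′.trans (⟦⟧-cong (b∈ i i<n)) 0#-homo

    powers-map : ∀ b i → ⟦ XB.powers b i ⟧ B′.≈ XB′.powers ⟦ b ⟧ i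
    powers-map b i = RingPowers.^-homo {R = B.ring} {S = B′.ring} f (p ℕ.^ i) b

    Generator-map : ∀ {b} → b ∈ XB.Generator → (λ i → ⟦ b i ⟧) ∈ Span XB′.sequences XB′.Generator
    Generator-map (XB.generator n b) = resp
      (VGroup.sym XB′.sequences (VGroup.trans XB′.sequences
        (VHom.V^-homo sequencesMap n (XB.powers b))
        (V^-cong n (powers-map b))))
      (gen (XB′.generator n ⟦ b ⟧))
      where
      V^-cong : ∀ n {b c} → VGroup._≈_ XB′.sequences b c →
                VGroup._≈_ XB′.sequences (VGroup.V^ XB′.sequences n b) (VGroup.V^ XB′.sequences n c)
      V^-cong zero    e = e
      V^-cong (suc n) e = VGroup.V-cong XB′.sequences (V^-cong n e)

    closedGenerated-map : ∀ {b} → VSubgroup.mem XB.closedGenerated b →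
                          VSubgroup.mem XB′.closedGenerated (λ i → ⟦ b i ⟧)
    closedGenerated-map {b} = Closure-map {A = XB.sequences} {B = XB′.sequences} sequencesMap
      XB.productTopology XB′.productTopology {S = XB.Generator} {T = XB′.Generator}
      productTopology-map Generator-map {b}

  X-map : VHom XB.X XB′.X
  X-map = subMap {A = XB.sequences} {B = XB′.sequences} sequencesMap
    XB.closedGenerated XB′.closedGenerated closedGenerated-map

  X-topology-map : ∀ n {b} → VSubgroup.mem (XB.X-topology n) b →
                   VSubgroup.mem (XB′.X-topology n) (VHom.⟦_⟧ X-map b)
  X-topology-map n = productTopology-map n

  generatorX-map : ∀ n b → VGroup._≈_ XB′.X (VHom.⟦_⟧ X-map (XB.generatorX n b)) (XB′.generatorX n ⟦ b ⟧)
  generatorX-map zero    b = underlying (powers-map b)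
  generatorX-map (suc n) b = VGroup.trans XB′.X (VHom.V-homo X-map (XB.generatorX n b))
    (VGroup.V-cong XB′.X (generatorX-map n b))

module E-construction (p : ℕ) (R : CommutativeRing ℓ ℓ) where
  ℤR : CommutativeRing ℓ ℓ
  ℤR = ℤ⟨ R ⟩

  open X-construction p ℤR

  -- Generated by Vⁿ⟨ a ⟩ - Vⁿ⟨ b ⟩ with a - b ∈ I; closed for the topology
  -- induced on X from the product topology.
  X-I : VSubgroup X
  X-I = closedSubgroup X X-topology (Difference X generatorX (_≡I_ R))
    (Difference-V X generatorX (_≡I_ R) generatorX-V)

  E : VGroup ℓ
  E = X / X-I

  teichE : CommutativeRing.Carrier R → VGroup.Carrier E
  teichE r = generatorX 0 (Polynomial.var (CommutativeRing.setoid R) r)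

  E-≈ : ∀ {x y : VGroup.Carrier E} →
        (∀ i → CommutativeRing._≈_ ℤR (proj₁ x i) (proj₁ y i)) → VGroup._≈_ E x y
  E-≈ {x} {y} e = Quotient.≈⇒~ X X-I {x} {y} (underlying e)

module _ (p : ℕ) {R S : CommutativeRing ℓ ℓ} (f : RingHom R S) where
  private
    module ER = E-construction p R
    module ES = E-construction p S
    module XR = X-construction p ER.ℤR
    module XS = X-construction p ES.ℤR

    ℤf : RingHom ER.ℤR ES.ℤR
    ℤf = ℤ⟨⟩-map {R = R} {S = S} f

    module ℤf = RingHomomorphism ℤf

    Xf : VHom XR.X XS.X
    Xf = X-map p {B = ER.ℤR} {B′ = ES.ℤR} ℤf

    Differences-map : ∀ {u} → u ∈ Difference XR.X XR.generatorX (_≡I_ R) →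
                      VHom.⟦_⟧ Xf u ∈ Span XS.X (Difference XS.X XS.generatorX (_≡I_ S))
    Differences-map {u} = Difference-map {A = XR.X} {B = XS.X} Xf
      XR.generatorX (_≡I_ R) XS.generatorX (_≡I_ S) ℤf.⟦_⟧
      (generatorX-map p {B = ER.ℤR} {B′ = ES.ℤR} ℤf) (≡I-map {R = R} {S = S} f) {u}

    X-I-map : ∀ {u} → VSubgroup.mem ER.X-I u → VSubgroup.mem ES.X-I (VHom.⟦_⟧ Xf u)
    X-I-map {u} = Closure-map {A = XR.X} {B = XS.X} Xf XR.X-topology XS.X-topology
      {S = Difference XR.X XR.generatorX (_≡I_ R)} {T = Difference XS.X XS.generatorX (_≡I_ S)}
      (X-topology-map p {B = ER.ℤR} {B′ = ES.ℤR} ℤf) Differences-map {u}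

  E-map : VHom ER.E ES.E
  E-map = quotientMap {A = XR.X} {B = XS.X} Xf ER.X-I ES.X-I X-I-map

  E-map-teich : ∀ r → VGroup._≈_ ES.E (VHom.⟦_⟧ E-map (ER.teichE r)) (ES.teichE (RingHomomorphism.⟦_⟧ f r))
  E-map-teich r = Quotient.≈⇒~ XS.X ES.X-I (VGroup.trans XS.X
    (generatorX-map p {B = ER.ℤR} {B′ = ES.ℤR} ℤf 0 _)
    (underlying (XS.powers-cong (ℤ⟨⟩-map-var {R = R} {S = S} f r))))

E : (p : ℕ) → V⟨⟩-Functor ℓ
E p .V⟨⟩-Functor.functor .Functor.F₀ R = VGroup.group (E-construction.E p R)
E p .V⟨⟩-Functor.functor .Functor.F₁ R S f = VHom.hom (E-map p {R = R} {S = S} f)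
E p .V⟨⟩-Functor.functor .Functor.F₁-cong R S f g f≗g x =
  E-construction.E-≈ p S λ i → ℤ⟨⟩-map-cong {R = R} {S = S} f g f≗g (proj₁ x i)
E p .V⟨⟩-Functor.functor .Functor.F₁-id R x =
  E-construction.E-≈ p R λ i → ℤ⟨⟩-map-id R (proj₁ x i)
E p .V⟨⟩-Functor.functor .Functor.F₁-∘ R S T g f x =
  E-construction.E-≈ p T λ i → ℤ⟨⟩-map-∘ {R = R} {S = S} {T = T} g f (proj₁ x i)
E p .V⟨⟩-Functor.V R = VGroup.endo (E-construction.E p R)
E p .V⟨⟩-Functor.V-natural R S f = VHom.V-homo (E-map p {R = R} {S = S} f)
E p .V⟨⟩-Functor.teich R = E-construction.teichE p R
E p .V⟨⟩-Functor.teich-cong R e =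
  E-construction.E-≈ p R (X-construction.powers-cong p ℤ⟨ R ⟩ (var-cong R e))
E p .V⟨⟩-Functor.teich-natural R S f = E-map-teich p {R = R} {S = S} f

{-# OPTIONS --safe #-}

-- Let Γ = G̃ / H̃, so that G⁰ = lim Γ / Vⁿ Γ.  The axiom on C that needs work is
-- p-torsion freeness over A = ℤ[S].  There C(A) is a retract of G(A), and it
-- suffices that p u ∈ Vⁿ⁺¹ Γ implies u ∈ Vⁿ Γ; then G⁰(A) itself has no
-- p-torsion.  Let N be the free abelian group on A modulo [r] + [-r], with the
-- endomorphism φ [r] = [rᵖ].  In N[V] every relation in H becomes a multiple of
-- V φ - p.  As r ↦ rᵖ is injective on A, φ is injective modulo p, and comparing
-- coefficients gives u ≡ Σ_{j<n} Vʲ δ(aⱼ) modulo Vⁿ Γ, where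
-- δ(a) = V⟨aᵖ⟩ - p⟨a⟩.  The ghost vector of δ(a) is (-p a, 0, 0, …), so the
-- vanishing of the first n ghost components of u forces aⱼ = 0.
--
-- Equality in ℤ[S] need not be decidable.  Equality in a free abelian group
-- therefore enters through permutations of lists of generators, and injectivity
-- of r ↦ rᵖ is proved p-adically rather than with leading terms.
--
-- The group C(R) is topologically generated by the Vⁿ⟨r⟩, which gives
-- uniqueness of C ⟶ F; it exists because F(ℤ[R]) is complete and p-torsion
-- free.  The map C ⟶ E is induced by the ghost map Γ → ℤ[R]^ℕ, which extends to
-- the completion since it sends Vⁿ Γ to sequences with n vanishing components.
module Submission where

open import Algebra.Bundles using (AbelianGroup; CommutativeMonoid; CommutativeRing; Ring)
import Algebra.Definitions.RawMonoid as RawMult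
open import Algebra.Morphism.Bundles using (GroupHomomorphism; RingHomomorphism)
import Algebra.Properties.AbelianGroup as AbelianGroupProperties
import Algebra.Properties.CommutativeMonoid.Mult as MultProperties
import Algebra.Properties.CommutativeSemigroup as CommutativeSemigroupProperties
import Algebra.Properties.CommutativeSemiring.Binomial as Binomial
import Algebra.Properties.CommutativeSemiring.Exp as CommutativeExp
import Algebra.Properties.Monoid.Sum as MonoidSum
import Algebra.Properties.Ring as RingProperties
import Algebra.Properties.Semiring.Exp as Exp
import Algebra.Properties.Semiring.Mult as SemiringMult
import Algebra.Solver.CommutativeMonoid as MonoidSolver
import Algebra.Solver.Ring.NaturalCoefficients.Default as RingSolver
open import Data.Empty using (⊥; ⊥-elim)
open import Data.Fin.Base using (Fin; zero; suc; toℕ; inject₁; fromℕ)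
open import Data.Fin.Patterns using (0F; 1F; 2F; 3F; 4F; 5F)
import Data.Fin.Properties as Fin
open import Data.List.Base using (List; []; _∷_; [_]; _++_; foldr; map; length)
import Data.List.Membership.Setoid as Membership
import Data.List.Membership.Setoid.Properties as MembershipProperties
import Data.List.Properties as List
import Data.List.Relation.Binary.Permutation.Setoid as Permutation
import Data.List.Relation.Binary.Permutation.Setoid.Properties as PermutationProperties
open import Data.List.Relation.Unary.Any using (here; there)
open import Data.Nat.Base as ℕ using (ℕ; zero; suc; _!)
open import Data.Nat.Combinatorics using (nCn≡1; nC1≡n; nCk≡n!/k![n-k]!; k![n∸k]!∣n!) renaming (_C_ to _choose_)
open import Data.Nat.DivMod using (m/n*n≡m; m≡m%n+[m/n]*n; m%n<n)
open import Data.Nat.Divisibility using (_∣_; divides; ∣-refl; ∣m⇒∣m*n; ∣⇒≤)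
open import Data.Nat.Primality using (Prime; euclidsLemma; prime⇒irreducible; ¬prime[0]; ¬prime[1])
import Data.Nat.Properties as ℕ
open import Data.Product.Base using (∃-syntax; _×_; _,_; proj₁; proj₂)
open import Data.Sum.Base using (_⊎_; inj₁; inj₂)
open import Data.Vec.Base using (Vec; []; _∷_; lookup)
open import Data.Vec.Functional using (Vector)
open import Function.Base using (_∘_)
open import Function.Bundles using (Func)
open import Function.Definitions using (Congruent)
open import Level using (Level)
open import Relation.Binary.Bundles using (Setoid)
open import Relation.Binary.Core using (Rel)
open import Relation.Binary.PropositionalEquality as ≡ using (_≡_; _≢_)
import Relation.Binary.Reasoning.Setoid as ≈-Reasoning
open import Relation.Nullary using (¬_)
open import Relation.Unary using (Pred; _∈_)
open import Defs

-- The group N is never formed as a quotient. Antisymmetrization [r] ↦ [r] - [-r] embeds it, with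
-- [0] = 0, in a free abelian group, where coefficients can be compared. That p is odd enters three
-- times: (-r)ᵖ = -rᵖ makes φ commute with antisymmetrization; antisymmetrizing twice is doubling,
-- so divisibility by an odd p descends from the free group to N; and p-th powers are injective,
-- whereas r and -r have the same square.
--
-- Cancelling p costs one power of V. In p u = (V φ - p) g + Vⁿ⁺¹ w the factor V in front of φ uses
-- up a degree before divisibility of g by p can be read off. The completion tolerates this, since
-- neighbouring coordinates agree modulo Vⁿ.
--
-- What remains is an element (V φ - p) g′. Coefficients do not show that it lies in Vⁿ Γ; its ghost
-- components do.

private
  variable
    ℓ ℓ₁ ℓ₂ : Level

-- Linear identities in abelian groups

data Term (n : ℕ) : Set where
  var      : Fin n → Term n
  nil      : Term n
  _⊞_ _⊟_ : Term n → Term n → Term n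
  ⊟_      : Term n → Term n

infixl 6 _⊞_ _⊟_
infix 8 ⊟_

pattern v0 = var 0F
pattern v1 = var 1F
pattern v2 = var 2F
pattern v3 = var 3F
pattern v4 = var 4F

module GroupSolver (A : AbelianGroup ℓ₁ ℓ₂) where
  open AbelianGroup A
  open AbelianGroupProperties A
  open CommutativeSemigroupProperties commutativeSemigroup using (interchange)
  private module M = MonoidSolver commutativeMonoid
  open ≈-Reasoning setoid

  eval-term : ∀ {n} → Term n → Vec Carrier n → Carrier
  eval-term (var i)  ρ = lookup ρ i
  eval-term nil      ρ = ε
  eval-term (t ⊞ u) ρ = eval-term t ρ ∙ eval-term u ρ
  eval-term (t ⊟ u) ρ = eval-term t ρ - eval-term u ρ
  eval-term (⊟ t)   ρ = eval-term t ρ ⁻¹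

  private
    positive negative : ∀ {n} → Term n → M.Expr n
    positive (var i)  = M.var i
    positive nil      = M.id
    positive (t ⊞ u) = positive t M.⊕ positive u
    positive (t ⊟ u) = positive t M.⊕ negative u
    positive (⊟ t)   = negative t
    negative (var i)  = M.id
    negative nil      = M.id
    negative (t ⊞ u) = negative t M.⊕ negative u
    negative (t ⊟ u) = negative t M.⊕ positive u
    negative (⊟ t)   = positive t

    move : ∀ {x y z} → x ∙ y ≈ z → x ⁻¹ ∙ z ≈ y
    move {x} {y} {z} e = begin
      x ⁻¹ ∙ z         ≈⟨ ∙-congˡ e ⟨
      x ⁻¹ ∙ (x ∙ y)   ≈⟨ \\-leftDividesʳ x y ⟩
      y ∎

    split : ∀ {n} (t : Term n) ρ → eval-term t ρ ∙ M.⟦ negative t ⟧ ρ ≈ M.⟦ positive t ⟧ ρ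
    split (var i)  ρ = identityʳ _
    split nil      ρ = identityʳ _
    split (t ⊞ u) ρ = trans (interchange _ _ _ _) (∙-cong (split t ρ) (split u ρ))
    split (t ⊟ u) ρ = trans (interchange _ _ _ _) (∙-cong (split t ρ) (move (split u ρ)))
    split (⊟ t)   ρ = move (split t ρ)

  -- Moving all negative parts to the other side turns an identity of abelian groups into one of
  -- commutative monoids, which is settled by normal forms. For closed terms the hypothesis is
  -- `≡.refl`.
  prove : ∀ {n} (ρ : Vec Carrier n) (t u : Term n) →
          M.normalise (positive t M.⊕ negative u) ≡ M.normalise (positive u M.⊕ negative t) →
          eval-term t ρ ≈ eval-term u ρ
  prove ρ t u e = ∙-cancelʳ (M.⟦ negative t ⟧ ρ ∙ M.⟦ negative u ⟧ ρ) _ _ (begin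
    eval-term t ρ ∙ (M.⟦ negative t ⟧ ρ ∙ M.⟦ negative u ⟧ ρ)  ≈⟨ assoc _ _ _ ⟨
    eval-term t ρ ∙ M.⟦ negative t ⟧ ρ ∙ M.⟦ negative u ⟧ ρ    ≈⟨ ∙-congʳ (split t ρ) ⟩
    M.⟦ positive t M.⊕ negative u ⟧ ρ                          ≈⟨ M.normalise-correct (positive t M.⊕ negative u) ρ ⟨
    _                                                ≡⟨ ≡.cong (λ nf → M.⟦ nf ⟧⇓ ρ) e ⟩
    _                                                ≈⟨ M.normalise-correct (positive u M.⊕ negative t) ρ ⟩
    M.⟦ positive u M.⊕ negative t ⟧ ρ                          ≈⟨ ∙-congʳ (split u ρ) ⟨
    eval-term u ρ ∙ M.⟦ negative u ⟧ ρ ∙ M.⟦ negative t ⟧ ρ    ≈⟨ assoc _ _ _ ⟩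
    eval-term u ρ ∙ (M.⟦ negative u ⟧ ρ ∙ M.⟦ negative t ⟧ ρ)  ≈⟨ ∙-congˡ (comm _ _) ⟩
    eval-term u ρ ∙ (M.⟦ negative t ⟧ ρ ∙ M.⟦ negative u ⟧ ρ)  ∎)

-- Complete V-groups

module _ (A : VGroup ℓ) where
  open VGroup A
  open GroupSolver group using (prove)
  open ≈-Reasoning setoid
  private module I n = VSubgroup (V-adic A n)

  V^-cong : ∀ n {x y} → x ≈ y → V^ n x ≈ V^ n y
  V^-cong zero    e = e
  V^-cong (suc n) e = V-cong (V^-cong n e)

  V^-∸ : ∀ n x y → V^ n (x - y) ≈ V^ n x - V^ n y
  V^-∸ n x y = trans (V^-+ A n x (- y)) (∙-congˡ (V^-neg A n y))

  V^-assoc : ∀ m n x → V^ (m ℕ.+ n) x ≈ V^ m (V^ n x)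
  V^-assoc zero    n x = refl
  V^-assoc (suc m) n x = V-cong (V^-assoc m n x)

  V^-comm : ∀ m n x → V^ m (V^ n x) ≈ V^ n (V^ m x)
  V^-comm zero    n x = refl
  V^-comm (suc m) n x = trans (V-cong (V^-comm m n x)) (V-V^ A n _)

  ∸-mem : ∀ (P : VSubgroup A) {x y} → VSubgroup.mem P x → VSubgroup.mem P y → VSubgroup.mem P (x - y)
  ∸-mem P x∈ y∈ = VSubgroup.+-mem P x∈ (VSubgroup.neg-mem P y∈)

  V^-mem : ∀ (P : VSubgroup A) n {x} → VSubgroup.mem P x → VSubgroup.mem P (V^ n x)
  V^-mem P zero    x∈ = x∈
  V^-mem P (suc n) x∈ = VSubgroup.V-mem P (V^-mem P n x∈)

  image-suc : ∀ n {x} → V^Image A (suc n) x → V^Image A n x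
  image-suc n (image e) = image (trans e (V-V^ A n _))

  image-≤ : ∀ {m n x} → m ℕ.≤′ n → V^Image A n x → V^Image A m x
  image-≤ ℕ.≤′-refl     i = i
  image-≤ (ℕ.≤′-step p) i = image-≤ p (image-suc _ i)

  partialSum : (ℕ → Carrier) → ℕ → Carrier
  partialSum y zero    = 0#
  partialSum y (suc n) = partialSum y n + V^ n (y n)

  Separated : Set ℓ
  Separated = ∀ x → (∀ n → V^Image A n x) → x ≈ 0#

  -- Completeness is phrased with series because their terms satisfy no coherence condition: a
  -- series in a quotient lifts term by term, while a coherent sequence would have to be lifted
  -- compatibly.
  SeriesConverge : Set ℓ
  SeriesConverge = ∀ y → ∃[ x ] ∀ n → V^Image A n (x - partialSum y n)

  isVComplete : Separated → SeriesConverge → IsVComplete A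
  isVComplete sep conv = injective , surjective
    where
    injective : ∀ {x y} → _≈ᶜ_ A (toCompletion A x) (toCompletion A y) → x ≈ y
    injective {x} {y} (coordinatewise e) =
      x∙y⁻¹≈ε⇒x≈y x y (sep _ λ n → Quotient._~_.difference (e n))

    surjective : ∀ c → ∃[ x ] (∀ {z} → z ≈ x → _≈ᶜ_ A (toCompletion A z) c)
    surjective c = x₀ + proj₁ (conv y) , λ {z} e → coordinatewise λ n → congruent
      (I.resp n (begin
        (proj₁ (conv y) - partialSum y n) + - (seq n - (x₀ + partialSum y n))
          ≈⟨ prove (proj₁ (conv y) ∷ partialSum y n ∷ seq n ∷ x₀ ∷ [])
               ((v0 ⊟ v1) ⊞ ⊟ (v2 ⊟ (v3 ⊞ v1))) ((v3 ⊞ v0) ⊟ v2) ≡.refl ⟩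
        (x₀ + proj₁ (conv y)) - seq n
          ≈⟨ ∙-congʳ e ⟨
        z - seq n ∎)
        (∸-mem (V-adic A n) (proj₂ (conv y) n) (I.resp n (sym (near n)) (I.0-mem n))))
      where
      open Coherent c
      x₀ = seq 0
      -- Consecutive terms of `c` differ by `V^ n (y n)`, so `c` telescopes into its first term and
      -- a series.
      y : ℕ → Carrier
      y n = V^Image.preimage (Quotient._~_.difference (coherent n))

      near : ∀ n → seq n - (x₀ + partialSum y n) ≈ 0#
      near zero    = prove (x₀ ∷ []) (v0 ⊟ (v0 ⊞ nil)) nil ≡.refl
      near (suc n) = begin
        seq (suc n) - (x₀ + (partialSum y n + V^ n (y n)))
          ≈⟨ prove (seq (suc n) ∷ seq n ∷ x₀ ∷ partialSum y n ∷ V^ n (y n) ∷ [])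
               (v0 ⊟ (v2 ⊞ (v3 ⊞ v4))) ((v0 ⊟ v1) ⊟ v4 ⊞ (v1 ⊟ (v2 ⊞ v3))) ≡.refl ⟩
        (seq (suc n) - seq n) - V^ n (y n) + (seq n - (x₀ + partialSum y n))
          ≈⟨ ∙-cong (x≈y⇒x∙y⁻¹≈ε (V^Image.equation (Quotient._~_.difference (coherent n)))) (near n) ⟩
        0# + 0#  ≈⟨ identityˡ 0# ⟩
        0# ∎

  partialSum-coherent : (ℕ → Carrier) → Coherent A
  partialSum-coherent y .Coherent.seq = partialSum y
  partialSum-coherent y .Coherent.coherent n = congruent (image {preimage = y n}
    (prove (partialSum y n ∷ V^ n (y n) ∷ []) ((v0 ⊞ v1) ⊟ v0) v1 ≡.refl))

  module VComplete (complete : IsVComplete A) where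

    separated : Separated
    separated x x∈ = proj₁ complete (coordinatewise λ n →
      congruent (I.resp n (sym (prove (x ∷ []) (v0 ⊟ nil) v0 ≡.refl)) (x∈ n)))

    limit : Coherent A → Carrier
    limit c = proj₁ (proj₂ complete c)

    limit-near : ∀ c n → V^Image A n (limit c - Coherent.seq c n)
    limit-near c n = Quotient._~_.difference (_≈ᶜ_.coordinate (proj₂ (proj₂ complete c) refl) n)

    seriesConverge : SeriesConverge
    seriesConverge y = limit (partialSum-coherent y) , limit-near (partialSum-coherent y)

    ≈-limit : ∀ {x y} → (∀ n → V^Image A n (x - y)) → x ≈ y
    ≈-limit {x} {y} d = x∙y⁻¹≈ε⇒x≈y x y (separated _ d)

module _ (A : VGroup ℓ) (P : VSubgroup A) where
  open VGroup A
  open GroupSolver group using (prove)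
  open ≈-Reasoning setoid
  private
    module P = VSubgroup P
    module I n = VSubgroup (V-adic A n)

  Closed : Set ℓ
  Closed = ∀ x → (∀ n → ∃[ s ] P.mem s × V^Image A n (x - s)) → P.mem x

  quotient-V^ : ∀ n x → VGroup._≈_ (A / P) (VGroup.V^ (A / P) n x) (V^ n x)
  quotient-V^ n x = Quotient.≈⇒~ A P (reflexive (eq n))
    where
    eq : ∀ n → VGroup.V^ (A / P) n x ≡ V^ n x
    eq zero    = ≡.refl
    eq (suc n) = ≡.cong V (eq n)

  quotient-image : ∀ n {x} → V^Image (A / P) n x → ∃[ s ] P.mem s × V^Image A n (x - s)
  quotient-image n {x} (image {y} e)
    with congruent x-y ← VGroup.trans (A / P) e (quotient-V^ n y) =
    x - V^ n y , x-y , image (prove (x ∷ V^ n y ∷ []) (v0 ⊟ (v0 ⊟ v1)) v1 ≡.refl)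

  image-quotient : ∀ n {x} → V^Image A n x → V^Image (A / P) n x
  image-quotient n (image e) = image
    (VGroup.trans (A / P) (Quotient.≈⇒~ A P e) (VGroup.sym (A / P) (quotient-V^ n _)))

  quotient-partialSum : ∀ y n → VGroup._≈_ (A / P) (partialSum (A / P) y n) (partialSum A y n)
  quotient-partialSum y zero    = VGroup.refl (A / P)
  quotient-partialSum y (suc n) = VGroup.∙-cong (A / P) (quotient-partialSum y n) (quotient-V^ n (y n))

  -- Closedness of `P` yields separatedness. As `A / P` has the carrier of `A`, a series in it
  -- converges to the limit of the same series in `A`.
  quotient-isVComplete : IsVComplete A → Closed → IsVComplete (A / P)
  quotient-isVComplete complete closed = isVComplete (A / P)
    (λ x x∈ → congruent (P.resp (sym (prove (x ∷ []) (v0 ⊟ nil) v0 ≡.refl))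
      (closed x λ n → quotient-image n (x∈ n))))
    (λ y → let (x , near) = VComplete.seriesConverge A complete y in
      x , λ n → VSubgroup.resp (V-adic (A / P) n)
        (VGroup.∙-congˡ (A / P) (VGroup.⁻¹-cong (A / P) (VGroup.sym (A / P) (quotient-partialSum y n))))
        (image-quotient n (near n)))

module _ (A : VGroup ℓ) (S : Pred (VGroup.Carrier A) ℓ) where
  open VGroup A
  open GroupSolver group using (prove)

  Closure-idempotent : ∀ x → (∀ n → ∃[ s ] Closure A (V-adic A) S s × V^Image A n (x - s)) →
                       Closure A (V-adic A) S x
  Closure-idempotent x near = closure λ n →
    let (s , closure approx , d) = near n ; (t , t∈ , e) = approx n in
    t , t∈ , VSubgroup.resp (V-adic A n)
      (prove (x ∷ s ∷ t ∷ []) (v0 ⊟ v1 ⊞ (v1 ⊟ v2)) (v0 ⊟ v2) ≡.refl)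
      (VSubgroup.+-mem (V-adic A n) d e)

-- The V-adic completion is V-adically complete

module _ (Γ : VGroup ℓ) where
  open VGroup Γ
  open GroupSolver group using (prove)
  open ≈-Reasoning setoid
  private
    module I n = VSubgroup (V-adic Γ n)
    module Γ^ = VGroup (completion Γ)
    module Q n = Quotient Γ (V-adic Γ n)
  open Coherent

  completion-V^-seq : ∀ n x k → seq (Γ^.V^ n x) k ≈ V^ n (seq x k)
  completion-V^-seq zero    x k = refl
  completion-V^-seq (suc n) x k = V-cong (completion-V^-seq n x k)

  completion-image-seq : ∀ n {x} → V^Image (completion Γ) n x → ∀ k → k ℕ.≤′ n → V^Image Γ k (seq x k)
  completion-image-seq n {x} (image {y} (coordinatewise e)) k k≤n = I.resp k
    (prove (seq x k ∷ seq (Γ^.V^ n y) k ∷ []) ((v0 ⊟ v1) ⊞ v1) v0 ≡.refl)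
    (I.+-mem k (Quotient._~_.difference (e k))
      (image-≤ Γ k≤n (image (completion-V^-seq n y k))))

  seq-tail : ∀ x n k → V^Image Γ n (seq x (k ℕ.+ n) - seq x n)
  seq-tail x n zero    = I.resp n (sym (inverseʳ _)) (I.0-mem n)
  seq-tail x n (suc k) = I.resp n
    (prove (seq x (suc k ℕ.+ n) ∷ seq x (k ℕ.+ n) ∷ seq x n ∷ [])
      ((v0 ⊟ v1) ⊞ (v1 ⊟ v2)) (v0 ⊟ v2) ≡.refl)
    (I.+-mem n (image-≤ Γ (ℕ.≤⇒≤′ (ℕ.m≤n+m n k)) (Quotient._~_.difference (coherent x (k ℕ.+ n))))
      (seq-tail x n k))

  -- The kernel of Γ̂ → Γ / Vⁿ Γ is Vⁿ Γ̂: if xₙ = Vⁿ y and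
  -- xₙ₊ᵢ₊₁ - xₙ₊ᵢ = Vⁿ⁺ⁱ yᵢ, then x = Vⁿ (y + Σ Vⁱ yᵢ).
  seq-completion-image : ∀ n {x} → V^Image Γ n (seq x n) → V^Image (completion Γ) n x
  seq-completion-image n {x} (image {y} e) = image {preimage = z} (coordinatewise λ k → congruent
    (I.resp k (begin
      - (seq x (k ℕ.+ n) - seq x k)
        ≈⟨ prove (seq x (k ℕ.+ n) ∷ seq x k ∷ []) (⊟ (v0 ⊟ v1)) (v1 ⊟ v0) ≡.refl ⟩
      seq x k - seq x (k ℕ.+ n)             ≈⟨ ∙-congˡ (⁻¹-cong (V^z k)) ⟩
      seq x k - V^ n (seq z k)              ≈⟨ ∙-congˡ (⁻¹-cong (completion-V^-seq n z k)) ⟨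
      seq x k - seq (Γ^.V^ n z) k           ∎)
      (I.neg-mem k (tail k))))
    where
    tail : ∀ k → V^Image Γ k (seq x (k ℕ.+ n) - seq x k)
    tail k = ≡.subst (λ m → V^Image Γ k (seq x m - seq x k)) (ℕ.+-comm n k) (seq-tail x k n)

    yᵢ : ℕ → Carrier
    yᵢ i = V^Image.preimage (Quotient._~_.difference (coherent x (i ℕ.+ n)))

    z : Coherent Γ
    z .seq k = y + partialSum Γ yᵢ k
    z .coherent k = congruent (image {preimage = yᵢ k}
      (prove (y ∷ partialSum Γ yᵢ k ∷ V^ k (yᵢ k) ∷ []) ((v0 ⊞ (v1 ⊞ v2)) ⊟ (v0 ⊞ v1)) v2 ≡.refl))

    V^z : ∀ k → seq x (k ℕ.+ n) ≈ V^ n (seq z k)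
    V^z zero    = trans e (V^-cong Γ n (sym (identityʳ y)))
    V^z (suc k) = begin
      seq x (suc k ℕ.+ n)
        ≈⟨ prove (seq x (suc k ℕ.+ n) ∷ seq x (k ℕ.+ n) ∷ []) v0 (v1 ⊞ (v0 ⊟ v1)) ≡.refl ⟩
      seq x (k ℕ.+ n) + (seq x (suc k ℕ.+ n) - seq x (k ℕ.+ n))
        ≈⟨ ∙-cong (V^z k) (V^Image.equation (Quotient._~_.difference (coherent x (k ℕ.+ n)))) ⟩
      V^ n (seq z k) + V^ (k ℕ.+ n) (yᵢ k)
        ≈⟨ ∙-congˡ (trans (V^-assoc Γ k n (yᵢ k)) (V^-comm Γ k n (yᵢ k))) ⟩
      V^ n (seq z k) + V^ n (V^ k (yᵢ k))   ≈⟨ V^-+ Γ n _ _ ⟨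
      V^ n (seq z k + V^ k (yᵢ k))
        ≈⟨ V^-cong Γ n (assoc y (partialSum Γ yᵢ k) (V^ k (yᵢ k))) ⟩
      V^ n (seq z (suc k)) ∎

  completion-near : ∀ x n → V^Image (completion Γ) n (x Γ^.- toCompletion Γ (seq x n))
  completion-near x n = seq-completion-image n (I.resp n (sym (inverseʳ (seq x n))) (I.0-mem n))

  completion-separated : Separated (completion Γ)
  completion-separated x x∈ = coordinatewise λ n → congruent
    (I.resp n (sym (prove (seq x n ∷ []) (v0 ⊟ nil) v0 ≡.refl))
      (completion-image-seq n {x} (x∈ n) n ℕ.≤′-refl))

  completion-seriesConverge : SeriesConverge (completion Γ)
  completion-seriesConverge y = x , λ n → seq-completion-image n
      (I.resp n (sym (trans (∙-congˡ (⁻¹-cong (partial-seq n n))) (inverseʳ _))) (I.0-mem n))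
    where
    -- The k-th coordinate of the n-th partial sum, computed inside `Γ`. The limit is the diagonal:
    -- beyond n summands, the n-th coordinate changes only by elements of the image of Vⁿ.
    s : ℕ → ℕ → Carrier
    s zero    k = 0#
    s (suc n) k = s n k + V^ n (seq (y n) k)

    partial-seq : ∀ n k → seq (partialSum (completion Γ) y n) k ≈ s n k
    partial-seq zero    k = refl
    partial-seq (suc n) k = ∙-cong (partial-seq n k) (completion-V^-seq n (y n) k)

    s-step : ∀ n k → V^Image Γ k (s n (suc k) - s n k)
    s-step zero    k = I.resp k (sym (inverseʳ 0#)) (I.0-mem k)
    s-step (suc n) k = I.resp k
      (trans (∙-congˡ (V^-∸ Γ n (seq (y n) (suc k)) (seq (y n) k)))
        (prove (s n (suc k) ∷ V^ n (seq (y n) (suc k)) ∷ s n k ∷ V^ n (seq (y n) k) ∷ [])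
          ((v0 ⊟ v2) ⊞ (v1 ⊟ v3)) ((v0 ⊞ v1) ⊟ (v2 ⊞ v3)) ≡.refl))
      (I.+-mem k (s-step n k)
        (V^-mem Γ (V-adic Γ k) n (Quotient._~_.difference (coherent (y n) k))))

    x : Coherent Γ
    x .seq n = s n n
    x .coherent n = congruent (I.resp n
      (prove (s n (suc n) ∷ V^ n (seq (y n) (suc n)) ∷ s n n ∷ [])
        ((v0 ⊟ v2) ⊞ v1) ((v0 ⊞ v1) ⊟ v2) ≡.refl)
      (I.+-mem n (s-step n n) (image refl)))

  completion-isVComplete : IsVComplete (completion Γ)
  completion-isVComplete = isVComplete (completion Γ) completion-separated completion-seriesConverge

-- Multisets and free abelian groups

module Multiset (S : Setoid ℓ ℓ) where
  open Setoid S renaming (Carrier to A)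
  open Permutation S public using (_↭_; ↭-refl; ↭-sym; ↭-trans; ↭-prep; ↭-swap; prep; ↭-reflexive; ↭-setoid)
  open PermutationProperties S public
    using (++-commutativeMonoid; ++⁺; ++⁺ˡ; ++⁺ʳ; ++-comm; xs↭ys⇒|xs|≡|ys|; drop-∷; dropMiddle; ∈-resp-↭; ++-identityʳ)
  open Membership S using () renaming (_∈_ to _∈ˡ_)
  private module M = MonoidSolver ++-commutativeMonoid
  open M using () renaming (_⊕_ to _:++_; var to :v) public
  open RawMult (CommutativeMonoid.rawMonoid ++-commutativeMonoid) public using () renaming (_×_ to copies)
  open MultProperties ++-commutativeMonoid public using ()
    renaming (×-congʳ to copies-cong; ×-distrib-+ to copies-++)

  rearrange : ∀ {n} (ρ : Vec (List A) n) (e f : M.Expr n) →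
              M.normalise e ≡ M.normalise f → M.⟦ e ⟧ ρ ↭ M.⟦ f ⟧ ρ
  rearrange ρ e f eq = ↭-trans (↭-sym (M.normalise-correct e ρ))
    (↭-trans (↭-reflexive (≡.cong (λ nf → M.⟦ nf ⟧⇓ ρ) eq)) (M.normalise-correct f ρ))

  ++-cancelˡ : ∀ zs {xs ys} → zs ++ xs ↭ zs ++ ys → xs ↭ ys
  ++-cancelˡ zs = dropMiddle {vs = zs} [] []

  ¬[]↭∷ : ∀ {x xs} → [] ↭ x ∷ xs → ⊥
  ¬[]↭∷ e with () ← xs↭ys⇒|xs|≡|ys| e

  extract-∈ : ∀ {x xs} → x ∈ˡ xs → ∃[ xs′ ] xs ↭ x ∷ xs′
  extract-∈ (here e) = _ , prep (sym e) ↭-refl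
  extract-∈ (there x∈) = let (xs′ , p) = extract-∈ x∈ in
    _ ∷ xs′ , ↭-trans (↭-prep _ p) (↭-swap _ _ ↭-refl)

  ∈-copies : ∀ n {x xs} → x ∈ˡ copies n xs → x ∈ˡ xs
  ∈-copies (suc n) {xs = xs} x∈ with MembershipProperties.∈-++⁻ S xs x∈
  ... | inj₁ x∈xs = x∈xs
  ... | inj₂ x∈n  = ∈-copies n x∈n

  extract-++ : ∀ {x xs} as {bs} → x ∷ xs ↭ as ++ bs →
               (∃[ as′ ] as ↭ x ∷ as′) ⊎ (∃[ bs′ ] bs ↭ x ∷ bs′)
  extract-++ as p with MembershipProperties.∈-++⁻ S as (∈-resp-↭ p (here refl))
  ... | inj₁ x∈as = inj₁ (extract-∈ x∈as)
  ... | inj₂ x∈bs = inj₂ (extract-∈ x∈bs)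

  extract-copies : ∀ n {x xs ws} → x ∷ xs ↭ copies n ws → ∃[ ws′ ] ws ↭ x ∷ ws′
  extract-copies n p = extract-∈ (∈-copies n (∈-resp-↭ p (here refl)))

  copies-∷ : ∀ n x xs → copies n (x ∷ xs) ↭ copies n [ x ] ++ copies n xs
  copies-∷ n x xs = copies-++ [ x ] xs n

  copies-[] : ∀ n → copies n [] ≡ []
  copies-[] zero    = ≡.refl
  copies-[] (suc n) = copies-[] n

  copies-injective : ∀ n xs {ys} → copies (suc n) xs ↭ copies (suc n) ys → xs ↭ ys
  copies-injective n [] {[]}     p = ↭-refl
  copies-injective n [] {y ∷ ys} p = ⊥-elim (¬[]↭∷ (proj₂ (extract-copies (suc n) (↭-sym p))))
  copies-injective n (x ∷ xs) {ys} p = let (ys′ , q) = extract-copies (suc n) p in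
    ↭-trans (↭-prep x (copies-injective n xs (++-cancelˡ (copies (suc n) [ x ])
      (↭-trans (↭-sym (copies-∷ (suc n) x xs))
        (↭-trans p (↭-trans (copies-cong (suc n) q) (copies-∷ (suc n) x ys′)))))))
      (↭-sym q)

  -- Pigeonhole: `xs` is too short to hold all `k` copies of `y`, so the permutation sends one of
  -- them into `copies N zs`. Following the permutation replaces a decision of equality.
  extract-many : ∀ {k N y} rest zs xs → length xs ℕ.< k →
                 copies k [ y ] ++ rest ↭ copies N zs ++ xs → ∃[ zs′ ] zs ↭ y ∷ zs′
  extract-many {suc k} {N} {y} rest zs xs (ℕ.s≤s l) p with extract-++ (copies N zs) p
  ... | inj₁ (ws , q) = extract-copies N (↭-sym q)
  ... | inj₂ (xs′ , q) = extract-many {k} {N} rest zs xs′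
          (ℕ.≤-trans (ℕ.≤-reflexive (≡.sym (xs↭ys⇒|xs|≡|ys| q))) l)
          (drop-∷ (↭-trans p (↭-trans (++⁺ˡ (copies N zs) q)
            (rearrange (copies N zs ∷ [ y ] ∷ xs′ ∷ []) (:v 0F :++ (:v 1F :++ :v 2F))
              (:v 1F :++ (:v 0F :++ :v 2F)) ≡.refl))))

  -- By pigeonhole every element of `ys` occurs in `zs`, and its N copies cancel on both sides. Once
  -- `ys` is exhausted, a remaining element of `zs` would need N places in `xs`.
  copies-separate : ∀ {N xs xs′} ys zs → length xs ℕ.< N → length xs′ ℕ.< N →
                    xs ++ copies N ys ↭ copies N zs ++ xs′ → xs ↭ xs′
  copies-separate {N} {xs} {xs′} [] [] l l′ p rewrite copies-[] N = ↭-trans (↭-sym (++-identityʳ xs)) p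
  copies-separate {N} {xs} {xs′} [] (z ∷ zs) l l′ p =
    ⊥-elim (¬[]↭∷ (proj₂ (extract-many {N} {N} (copies N zs ++ xs′) [] xs l
      (↭-trans (rearrange (copies N [ z ] ∷ copies N zs ∷ xs′ ∷ [])
                 (:v 0F :++ (:v 1F :++ :v 2F))
                 ((:v 0F :++ :v 1F) :++ :v 2F) ≡.refl)
        (↭-trans (++⁺ʳ xs′ (↭-sym (copies-∷ N z zs)))
          (↭-trans (↭-sym p) (++-comm xs (copies N []))))))))
  copies-separate {N} {xs} {xs′} (y ∷ ys) zs l l′ p = copies-separate ys zs′ l l′
    (++-cancelˡ (copies N [ y ]) (↭-trans (↭-trans
        (rearrange (xs ∷ copies N [ y ] ∷ copies N ys ∷ [])
          (:v 1F :++ (:v 0F :++ :v 2F))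
          (:v 1F :++ (:v 2F :++ :v 0F)) ≡.refl) p′)
      (↭-trans (++⁺ʳ xs′ (↭-trans (copies-cong N q) (copies-∷ N y zs′)))
        (rearrange (copies N [ y ] ∷ copies N zs′ ∷ xs′ ∷ [])
          ((:v 0F :++ :v 1F) :++ :v 2F)
          (:v 0F :++ (:v 1F :++ :v 2F)) ≡.refl))))
    where
    p′ : copies N [ y ] ++ (copies N ys ++ xs) ↭ copies N zs ++ xs′
    p′ = ↭-trans (rearrange (xs ∷ copies N [ y ] ∷ copies N ys ∷ [])
           (:v 1F :++ (:v 2F :++ :v 0F))
           (:v 0F :++ (:v 1F :++ :v 2F)) ≡.refl)
         (↭-trans (++⁺ˡ xs (↭-sym (copies-∷ N y ys))) p)
    zs′ = proj₁ (extract-many {N} {N} (copies N ys ++ xs) zs xs′ l′ p′)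
    q = proj₂ (extract-many {N} {N} (copies N ys ++ xs) zs xs′ l′ p′)

module MultisetMap {S T : Setoid ℓ ℓ} (f : Func S T)
                   (f-injective : ∀ {x y} → Setoid._≈_ T (Func.to f x) (Func.to f y) → Setoid._≈_ S x y) where
  private
    module S where
      open Setoid S public
      open Multiset S public
    module T where
      open Setoid T public
      open Multiset T public
  open Func f

  map-↭ : ∀ {xs ys} → xs S.↭ ys → map to xs T.↭ map to ys
  map-↭ = PermutationProperties.map⁺ S T cong

  extract-map : ∀ {w ws} xs → w ∷ ws T.↭ map to xs →
                ∃[ x ] ∃[ xs′ ] xs S.↭ x ∷ xs′ × to x T.≈ w
  extract-map xs p with MembershipProperties.∈-map⁻ S T (T.∈-resp-↭ p (here T.refl))
  ... | x , x∈ , e = x , proj₁ (S.extract-∈ x∈) , proj₂ (S.extract-∈ x∈) , T.sym e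

  extract-fibre : ∀ k x xs {rest} → map to xs T.↭ T.copies k [ to x ] ++ rest →
                  ∃[ xs′ ] xs S.↭ S.copies k [ x ] ++ xs′ × map to xs′ T.↭ rest
  extract-fibre zero    x xs p = xs , S.↭-refl , p
  extract-fibre (suc k) x xs p =
    let (y , ys , q , e) = extract-map xs (T.↭-sym p)
        (xs′ , q′ , r)   = extract-fibre k x ys
          (T.drop-∷ (T.↭-trans (T.prep (T.sym e) T.↭-refl) (T.↭-trans (T.↭-sym (map-↭ q)) p)))
    in xs′ , S.↭-trans q (S.prep (f-injective e) q′) , r

  extract-class : ∀ n w xs {rest} → map to xs T.↭ T.copies (suc n) [ w ] ++ rest →
                  ∃[ x ] ∃[ xs′ ] xs S.↭ S.copies (suc n) [ x ] ++ xs′ × map to xs′ T.↭ rest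
  extract-class n w xs {rest} p = x , extract-fibre (suc n) x xs
    (T.↭-trans p (T.++⁺ʳ rest (T.copies-cong (suc n) {[ w ]} {[ to x ]} (T.prep (T.sym e) T.↭-refl))))
    where
    found : ∃[ x ] ∃[ xs′ ] xs S.↭ x ∷ xs′ × to x T.≈ w
    found = extract-map xs (T.↭-sym p)
    x = proj₁ found
    e = proj₂ (proj₂ (proj₂ found))

  private
    divide-step : ∀ n {xs ws} →
                  (∃[ x ] ∃[ xs′ ] xs S.↭ S.copies (suc n) [ x ] ++ xs′ × map to xs′ T.↭ T.copies (suc n) ws) →
                  (∀ xs′ → map to xs′ T.↭ T.copies (suc n) ws → ∃[ ys ] xs′ S.↭ S.copies (suc n) ys) →
                  ∃[ ys ] xs S.↭ S.copies (suc n) ys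
    divide-step n (x , xs′ , q , r) divide with divide xs′ r
    ... | ys , q′ = x ∷ ys , S.↭-trans q
          (S.↭-trans (S.++⁺ˡ (S.copies (suc n) [ x ]) q′) (S.↭-sym (S.copies-∷ (suc n) x ys)))

  -- Since `f` is injective, the copies of an element `w` in the image all come from one element `x`
  -- up to equality, so they can be removed from `xs` as a block.
  divide-copies : ∀ n ws xs → map to xs T.↭ T.copies (suc n) ws → ∃[ ys ] xs S.↭ S.copies (suc n) ys
  divide-copies n []       []       p = [] , S.↭-reflexive (≡.sym (S.copies-[] n))
  divide-copies n []       (x ∷ xs) p =
    ⊥-elim (T.¬[]↭∷ (T.↭-sym (T.↭-trans p (T.↭-reflexive (T.copies-[] (suc n))))))
  divide-copies n (w ∷ ws) xs       p = divide-step n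
    (extract-class n w xs (T.↭-trans p (T.copies-∷ (suc n) w ws))) (divide-copies n ws)

  -- Each element of `zs` also occurs in `ws`. Cancelling its copies reduces to the case without
  -- subtracted terms.
  divide-difference : ∀ n xs zs ws → map to xs ++ T.copies (suc n) zs T.↭ T.copies (suc n) ws →
                      ∃[ ys ] xs S.↭ S.copies (suc n) ys
  divide-difference n xs [] ws p rewrite T.copies-[] n =
    divide-copies n ws xs (T.↭-trans (T.↭-sym (T.++-identityʳ _)) p)
  divide-difference n xs (z ∷ zs) ws p = divide-difference n xs zs (proj₁ e)
    (T.++-cancelˡ (T.copies (suc n) [ z ]) (T.↭-trans (T.↭-trans
        (T.rearrange (map to xs ∷ T.copies (suc n) [ z ] ∷ T.copies (suc n) zs ∷ [])
          (T.:v 1F T.:++ (T.:v 0F T.:++ T.:v 2F))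
          (T.:v 0F T.:++ (T.:v 1F T.:++ T.:v 2F)) ≡.refl)
        (T.++⁺ˡ (map to xs) (T.↭-sym (T.copies-∷ (suc n) z zs))))
      (T.↭-trans p (T.↭-trans (T.copies-cong (suc n) (proj₂ e)) (T.copies-∷ (suc n) z (proj₁ e))))))
    where
    e : ∃[ ws′ ] ws T.↭ z ∷ ws′
    e = T.extract-copies (suc n) (T.↭-trans (T.++-comm (T.copies (suc n) (z ∷ zs)) (map to xs)) p)

module Involution (S : Setoid ℓ ℓ) (ν : Func S S)
                  (ν-involutive : ∀ x → Setoid._≈_ S (Func.to ν (Func.to ν x)) x) where
  open Setoid S renaming (Carrier to A)
  open Multiset S
  open Func ν

  data Paired : List A → Set ℓ where
    empty : Paired []
    fixed : ∀ {x xs xs′} → to x ≈ x → xs′ ↭ x ∷ xs → Paired xs → Paired xs′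
    pair  : ∀ {x xs xs′} → xs′ ↭ x ∷ to x ∷ xs → Paired xs → Paired xs′

  private
    map-↭ : ∀ {xs ys} → xs ↭ ys → map to xs ↭ map to ys
    map-↭ = PermutationProperties.map⁺ S S cong

    -- The permutation itself tells whether the head `x` equals its own image or the image of a
    -- later element, which is then its partner. The bound `n` is needed because a pair removes an
    -- element from inside the tail.
    go : ∀ n xs → length xs ℕ.≤ n → xs ↭ map to xs → Paired xs
    go n       []       l       p = empty
    go (suc n) (x ∷ xs) (ℕ.s≤s l) p with extract-++ [ to x ] p
    ... | inj₁ (as , q) = fixed e ↭-refl (go n xs l
            (drop-∷ (↭-trans p (prep e ↭-refl))))
      where
      e : to x ≈ x
      e with here e ← ∈-resp-↭ (↭-sym q) (here refl) = sym e
    ... | inj₂ (bs , q) with MembershipProperties.∈-map⁻ S S (∈-resp-↭ (↭-sym q) (here refl))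
    ...   | y , y∈ , e with extract-∈ y∈
    ...     | ys , r = pair (↭-prep x (↭-trans r (prep y≈νx ↭-refl))) (go n ys l′
                (drop-∷ (drop-∷ (↭-trans (↭-prep x (↭-trans (prep (sym y≈νx) ↭-refl) (↭-sym r)))
                  (↭-trans p (↭-trans (↭-prep (to x) (↭-trans (map-↭ r) (prep (sym e) ↭-refl)))
                    (↭-swap (to x) x ↭-refl)))))))
      where
      y≈νx : y ≈ to x
      y≈νx = trans (sym (ν-involutive y)) (cong (sym e))
      l′ : length ys ℕ.≤ n
      l′ = ℕ.≤-trans (ℕ.n≤1+n _) (ℕ.≤-trans (ℕ.≤-reflexive (≡.sym (xs↭ys⇒|xs|≡|ys| r))) l)

  paired : ∀ {xs} → xs ↭ map to xs → Paired xs
  paired {xs} = go (length xs) xs ℕ.≤-refl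

module GroupMult (A : AbelianGroup ℓ₁ ℓ₂) where
  open AbelianGroup A
  open AbelianGroupProperties A
  open RawMult rawMonoid using () renaming (_×_ to infixr 8 _·_)
  open MultProperties commutativeMonoid public using ()
    renaming (×-congʳ to ·-cong; ×-distrib-+ to ·-∙; ×-assocˡ to ·-assoc)

  ·-ε : ∀ n → n · ε ≈ ε
  ·-ε zero    = refl
  ·-ε (suc n) = trans (identityˡ _) (·-ε n)

  ·-⁻¹ : ∀ n x → n · (x ⁻¹) ≈ (n · x) ⁻¹
  ·-⁻¹ zero    x = sym ε⁻¹≈ε
  ·-⁻¹ (suc n) x = trans (∙-congˡ (·-⁻¹ n x)) (⁻¹-∙-comm x (n · x))

  ·-- : ∀ n x y → n · (x - y) ≈ n · x - n · y
  ·-- n x y = trans (·-∙ x (y ⁻¹) n) (∙-congˡ (·-⁻¹ n y))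

  ·-≡ : ∀ {m n} x → m ≡ n → m · x ≈ n · x
  ·-≡ x ≡.refl = refl

  ·-comm : ∀ m n x → m · (n · x) ≈ n · (m · x)
  ·-comm m n x = trans (·-assoc x m n) (trans (·-≡ x (ℕ.*-comm m n)) (sym (·-assoc x n m)))

TorsionFree : AbelianGroup ℓ₁ ℓ₂ → ℕ → Set _
TorsionFree A n = ∀ x → n · x ≈ ε → x ≈ ε
  where
  open AbelianGroup A
  open RawMult rawMonoid using () renaming (_×_ to _·_)

-- Equality in free abelian groups through multisets

module FreeProperties (S : Setoid ℓ ℓ) where
  open Setoid S using () renaming (Carrier to A)
  open Free S
  open Multiset S
  open AbelianGroup freeAbelianGroup using (setoid; commutativeMonoid; _-_)
  open RawMult (AbelianGroup.rawMonoid freeAbelianGroup) using () renaming (_×_ to infixr 8 _·_)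
  open GroupMult freeAbelianGroup
  open GroupSolver freeAbelianGroup using (prove)
  open ≈-Reasoning setoid

  positive negative : Formal → List A
  positive ⟦ s ⟧   = [ s ]
  positive 𝟘       = []
  positive (u ⊕ v) = positive u ++ positive v
  positive (⊖ u)   = negative u
  negative ⟦ s ⟧   = []
  negative 𝟘       = []
  negative (u ⊕ v) = negative u ++ negative v
  negative (⊖ u)   = positive u

  -- The relation `≋` is generated by rules, including transitivity, and cannot be inverted
  -- directly. As a permutation it lets single symbols be traced. In the transitive case both parts
  -- of the middle term appear on each side and cancel.
  balance : ∀ {u v} → u ≋ v → positive u ++ negative v ↭ positive v ++ negative u
  balance ≋-refl = ↭-refl
  balance (≋-sym p) = ↭-sym (balance p)
  balance (≋-trans {u} {v} {w} p q) = ++-cancelˡ (positive v ++ negative v) (↭-trans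
    (rearrange (positive u ∷ negative v ∷ positive v ∷ negative w ∷ [])
      ((:v 2F :++ :v 1F) :++ (:v 0F :++ :v 3F))
      ((:v 0F :++ :v 1F) :++ (:v 2F :++ :v 3F)) ≡.refl)
    (↭-trans (++⁺ (balance p) (balance q))
      (rearrange (positive v ∷ negative u ∷ positive w ∷ negative v ∷ [])
        ((:v 0F :++ :v 1F) :++ (:v 2F :++ :v 3F))
        ((:v 0F :++ :v 3F) :++ (:v 2F :++ :v 1F)) ≡.refl)))
  balance (⟦⟧-cong e) = prep e ↭-refl
  balance (⊕-cong {u} {u′} {v} {v′} p q) = ↭-trans
    (rearrange (positive u ∷ positive v ∷ negative u′ ∷ negative v′ ∷ [])
      ((:v 0F :++ :v 1F) :++ (:v 2F :++ :v 3F))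
      ((:v 0F :++ :v 2F) :++ (:v 1F :++ :v 3F)) ≡.refl)
    (↭-trans (++⁺ (balance p) (balance q))
      (rearrange (positive u′ ∷ negative u ∷ positive v′ ∷ negative v ∷ [])
        ((:v 0F :++ :v 1F) :++ (:v 2F :++ :v 3F))
        ((:v 0F :++ :v 2F) :++ (:v 1F :++ :v 3F)) ≡.refl))
  balance (⊖-cong {u} {v} p) = ↭-trans (++-comm (negative u) (positive v))
    (↭-trans (↭-sym (balance p)) (++-comm (positive u) (negative v)))
  balance (⊕-assoc u v w) = rearrange
    (positive u ∷ positive v ∷ positive w ∷ negative u ∷ negative v ∷ negative w ∷ [])
    (((:v 0F :++ :v 1F) :++ :v 2F) :++ (:v 3F :++ (:v 4F :++ :v 5F)))
    ((:v 0F :++ (:v 1F :++ :v 2F)) :++ ((:v 3F :++ :v 4F) :++ :v 5F))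
    ≡.refl
  balance (⊕-comm u v) = ++⁺ (++-comm (positive u) (positive v)) (++-comm (negative v) (negative u))
  balance (⊕-identityˡ u) = ↭-refl
  balance (⊕-inverseˡ u) = ↭-trans (++-identityʳ _) (++-comm (negative u) (positive u))

  sumList : List A → Formal
  sumList xs = foldr _⊕_ 𝟘 (map ⟦_⟧ xs)

  sumList-↭ : ∀ {xs ys} → xs ↭ ys → sumList xs ≋ sumList ys
  sumList-↭ p = PermutationProperties.foldr-commMonoid setoid
    (CommutativeMonoid.isCommutativeMonoid commutativeMonoid)
    (PermutationProperties.map⁺ S setoid ⟦⟧-cong p)

  sumList-++ : ∀ xs ys → sumList (xs ++ ys) ≋ sumList xs ⊕ sumList ys
  sumList-++ []       ys = ≋-sym (⊕-identityˡ _)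
  sumList-++ (x ∷ xs) ys = ≋-trans (⊕-cong ≋-refl (sumList-++ xs ys)) (≋-sym (⊕-assoc _ _ _))

  sumList-copies : ∀ n xs → sumList (copies n xs) ≋ n · sumList xs
  sumList-copies zero    xs = ≋-refl
  sumList-copies (suc n) xs =
    ≋-trans (sumList-++ xs (copies n xs)) (⊕-cong ≋-refl (sumList-copies n xs))

  ≋-positive-negative : ∀ u → u ≋ sumList (positive u) - sumList (negative u)
  ≋-positive-negative ⟦ s ⟧   = prove (⟦ s ⟧ ∷ []) v0 ((v0 ⊞ nil) ⊟ nil) ≡.refl
  ≋-positive-negative 𝟘       = prove [] nil (nil ⊟ nil) ≡.refl
  ≋-positive-negative (u ⊕ v) = begin
    u ⊕ v
      ≈⟨ ⊕-cong (≋-positive-negative u) (≋-positive-negative v) ⟩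
    (sumList (positive u) - sumList (negative u)) ⊕ (sumList (positive v) - sumList (negative v))
      ≈⟨ prove (sumList (positive u) ∷ sumList (negative u) ∷ sumList (positive v) ∷ sumList (negative v) ∷ [])
           ((v0 ⊟ v1) ⊞ (v2 ⊟ v3)) ((v0 ⊞ v2) ⊟ (v1 ⊞ v3)) ≡.refl ⟩
    (sumList (positive u) ⊕ sumList (positive v)) - (sumList (negative u) ⊕ sumList (negative v))
      ≈⟨ ⊕-cong (sumList-++ (positive u) _) (⊖-cong (sumList-++ (negative u) _)) ⟨
    sumList (positive (u ⊕ v)) - sumList (negative (u ⊕ v)) ∎
  ≋-positive-negative (⊖ u)   = ≋-trans (⊖-cong (≋-positive-negative u))
    (prove (sumList (positive u) ∷ sumList (negative u) ∷ []) (⊟ (v0 ⊟ v1)) (v1 ⊟ v0) ≡.refl)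

  unbalance : ∀ u v → positive u ++ negative v ↭ positive v ++ negative u → u ≋ v
  unbalance u v p = begin
    u
      ≈⟨ ≋-positive-negative u ⟩
    sumList (positive u) - sumList (negative u)
      ≈⟨ prove (sumList (positive u) ∷ sumList (negative u) ∷ sumList (negative v) ∷ [])
           (v0 ⊟ v1) ((v0 ⊞ v2) ⊟ (v1 ⊞ v2)) ≡.refl ⟩
    (sumList (positive u) ⊕ sumList (negative v)) - (sumList (negative u) ⊕ sumList (negative v))
      ≈⟨ ⊕-cong (≋-trans (≋-sym (sumList-++ (positive u) _)) (≋-trans (sumList-↭ p) (sumList-++ (positive v) _))) ≋-refl ⟩
    (sumList (positive v) ⊕ sumList (negative u)) - (sumList (negative u) ⊕ sumList (negative v))
      ≈⟨ prove (sumList (positive v) ∷ sumList (negative u) ∷ sumList (negative v) ∷ [])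
           ((v0 ⊞ v1) ⊟ (v1 ⊞ v2)) (v0 ⊟ v2) ≡.refl ⟩
    sumList (positive v) - sumList (negative v)
      ≈⟨ ≋-positive-negative v ⟨
    v ∎

  positive-· : ∀ n u → positive (n · u) ≡ copies n (positive u)
  positive-· zero    u = ≡.refl
  positive-· (suc n) u = ≡.cong (positive u ++_) (positive-· n u)

  negative-· : ∀ n u → negative (n · u) ≡ copies n (negative u)
  negative-· zero    u = ≡.refl
  negative-· (suc n) u = ≡.cong (negative u ++_) (negative-· n u)

  ·-injective : ∀ n {u v} → suc n · u ≋ suc n · v → u ≋ v
  ·-injective n {u} {v} p = unbalance u v (copies-injective n _
    (↭-trans (copies-++ (positive u) (negative v) (suc n))
      (↭-trans p′ (↭-sym (copies-++ (positive v) (negative u) (suc n))))))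
    where
    p′ : copies (suc n) (positive u) ++ copies (suc n) (negative v) ↭
         copies (suc n) (positive v) ++ copies (suc n) (negative u)
    p′ = ≡.subst₂ _↭_
      (≡.cong₂ _++_ (positive-· (suc n) u) (negative-· (suc n) v))
      (≡.cong₂ _++_ (positive-· (suc n) v) (negative-· (suc n) u)) (balance p)

  -- Choosing n to be the number of symbols in `u` makes `N n` exceed the lengths of both its
  -- positive and its negative part; `copies-separate` then identifies the two parts.
  ·-separated : ∀ u (N : ℕ → ℕ) → (∀ n → n ℕ.< N n) → (∀ n → ∃[ v ] u ≋ N n · v) → u ≋ 𝟘
  ·-separated u N N> div = unbalance u 𝟘 (↭-trans (++-identityʳ _) (copies-separate (negative v) (positive v)
    (ℕ.≤-<-trans (ℕ.m≤m+n _ _) (N> n)) (ℕ.≤-<-trans (ℕ.m≤n+m _ _) (N> n))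
    (≡.subst₂ _↭_
      (≡.cong (positive u ++_) (negative-· (N n) v)) (≡.cong (_++ negative u) (positive-· (N n) v))
      (balance (proj₂ (div n))))))
    where
    n = length (positive u) ℕ.+ length (negative u)
    v = proj₁ (div n)

module _ {S T : Setoid ℓ ℓ} (f : Func S T)
         (f-injective : ∀ {x y} → Setoid._≈_ T (Func.to f x) (Func.to f y) → Setoid._≈_ S x y) where
  private
    module FS = Free S
    module FT = Free T
    module S = FreeProperties S
    module T = FreeProperties T
    module MS = Multiset S
    module MT = Multiset T
    module S· = RawMult (AbelianGroup.rawMonoid FS.freeAbelianGroup)
    module T· = RawMult (AbelianGroup.rawMonoid FT.freeAbelianGroup)
  open Func f

  private
    f* : FS.Formal → FT.Formal
    f* = FS.lift FT.freeAbelianGroup (FT.⟦_⟧ ∘ to)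

    positive-f* : ∀ u → T.positive (f* u) ≡ map to (S.positive u)
    negative-f* : ∀ u → T.negative (f* u) ≡ map to (S.negative u)
    positive-f* FS.⟦ s ⟧   = ≡.refl
    positive-f* FS.𝟘       = ≡.refl
    positive-f* (u FS.⊕ v) = ≡.trans (≡.cong₂ _++_ (positive-f* u) (positive-f* v)) (≡.sym (List.map-++ to (S.positive u) _))
    positive-f* (FS.⊖ u)   = negative-f* u
    negative-f* FS.⟦ s ⟧   = ≡.refl
    negative-f* FS.𝟘       = ≡.refl
    negative-f* (u FS.⊕ v) = ≡.trans (≡.cong₂ _++_ (negative-f* u) (negative-f* v)) (≡.sym (List.map-++ to (S.negative u) _))
    negative-f* (FS.⊖ u)   = positive-f* u

    map-copies : ∀ n xs → map to (MS.copies n xs) ≡ MT.copies n (map to xs)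
    map-copies zero    xs = ≡.refl
    map-copies (suc n) xs = ≡.trans (List.map-++ to xs _) (≡.cong (map to xs ++_) (map-copies n xs))

  -- Adding a multiple of suc n makes u effective, so that only multisets
  -- have to be divided.
  freeMap-divisible : ∀ n {u k} → f* u FT.≋ suc n T·.× k → ∃[ k′ ] u FS.≋ suc n S·.× k′
  freeMap-divisible n {u} {k} p = k′ , (begin
    u
      ≈⟨ S.≋-positive-negative u ⟩
    σa - σb
      ≈⟨ prove (σa ∷ σb ∷ n S·.× σb ∷ []) (v0 ⊟ v1) ((v0 ⊞ v2) ⊟ (v1 ⊞ v2)) ≡.refl ⟩
    (σa FS.⊕ n S·.× σb) - (suc n S·.× σb)
      ≈⟨ FS.⊕-cong (FS.⊕-cong FS.≋-refl (S.sumList-copies n b)) FS.≋-refl ⟨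
    (σa FS.⊕ S.sumList (MS.copies n b)) - (suc n S·.× σb)
      ≈⟨ FS.⊕-cong (S.sumList-++ a _) FS.≋-refl ⟨
    S.sumList (a ++ MS.copies n b) - (suc n S·.× σb)
      ≈⟨ FS.⊕-cong (S.sumList-↭ (proj₂ divided)) FS.≋-refl ⟩
    S.sumList (MS.copies (suc n) ys) - (suc n S·.× σb)
      ≈⟨ FS.⊕-cong (S.sumList-copies (suc n) ys) FS.≋-refl ⟩
    (suc n S·.× S.sumList ys) - (suc n S·.× σb)
      ≈⟨ ·-- (suc n) (S.sumList ys) σb ⟨
    suc n S·.× k′ ∎)
    where
    open AbelianGroup FS.freeAbelianGroup using (setoid; _-_)
    open GroupSolver FS.freeAbelianGroup using (prove)
    open GroupMult FS.freeAbelianGroup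
    open ≈-Reasoning setoid
    a = S.positive u
    b = S.negative u
    σa = S.sumList a
    σb = S.sumList b

    balanced : map to a ++ MT.copies (suc n) (T.negative k) MT.↭ MT.copies (suc n) (T.positive k) ++ map to b
    balanced = ≡.subst₂ MT._↭_
      (≡.cong₂ _++_ (positive-f* u) (T.negative-· (suc n) k))
      (≡.cong₂ _++_ (T.positive-· (suc n) k) (negative-f* u)) (T.balance p)

    effective : map to (a ++ MS.copies n b) ++ MT.copies (suc n) (T.negative k) MT.↭
                MT.copies (suc n) (T.positive k ++ map to b)
    effective = MT.↭-trans (MT.↭-trans
      (MT.++⁺ʳ (MT.copies (suc n) (T.negative k)) (MT.↭-reflexive
        (≡.trans (List.map-++ to a _) (≡.cong (map to a ++_) (map-copies n b)))))
      (MT.rearrange (map to a ∷ MT.copies n (map to b) ∷ MT.copies (suc n) (T.negative k) ∷ [])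
        ((MT.:v 0F MT.:++ MT.:v 1F) MT.:++ MT.:v 2F)
        ((MT.:v 0F MT.:++ MT.:v 2F) MT.:++ MT.:v 1F) ≡.refl))
      (MT.↭-trans (MT.++⁺ʳ (MT.copies n (map to b)) balanced)
        (MT.↭-trans (MT.rearrange (MT.copies (suc n) (T.positive k) ∷ map to b ∷ MT.copies n (map to b) ∷ [])
            ((MT.:v 0F MT.:++ MT.:v 1F) MT.:++ MT.:v 2F)
            (MT.:v 0F MT.:++ (MT.:v 1F MT.:++ MT.:v 2F)) ≡.refl)
          (MT.↭-sym (MT.copies-++ (T.positive k) (map to b) (suc n)))))

    divided : ∃[ ys ] (a ++ MS.copies n b) MS.↭ MS.copies (suc n) ys
    divided = MultisetMap.divide-difference f f-injective n _ (T.negative k) _ effective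
    ys = proj₁ divided
    k′ = S.sumList ys - σb

module _ (S : Setoid ℓ ℓ) (ν : Func S S)
         (ν-involutive : ∀ x → Setoid._≈_ S (Func.to ν (Func.to ν x)) x) where
  open Setoid S using (_≈_) renaming (Carrier to A)
  open Free S
  open FreeProperties S
  open Multiset S
  open Involution S ν ν-involutive
  open Func ν

  antisymmetrize : A → Formal
  antisymmetrize s = ⟦ s ⟧ ⊕ ⊖ ⟦ to s ⟧

  module _ (B : AbelianGroup ℓ ℓ) (f : GroupHom freeAbelianGroup B) where
    private
      module B = AbelianGroup B
      module BP = AbelianGroupProperties B
      module f = GroupHomomorphism f

      ι : Formal → Formal
      ι = lift freeAbelianGroup antisymmetrize

      signed : Formal → List A
      signed u = positive u ++ map to (negative u)

      positive-ι : ∀ u → positive (ι u) ↭ signed u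
      negative-ι : ∀ u → negative (ι u) ↭ map to (positive u) ++ negative u
      positive-ι ⟦ s ⟧   = ↭-refl
      positive-ι 𝟘       = ↭-refl
      positive-ι (u ⊕ v) = ↭-trans (++⁺ (positive-ι u) (positive-ι v)) (↭-trans
        (rearrange (positive u ∷ map to (negative u) ∷ positive v ∷ map to (negative v) ∷ [])
          ((:v 0F :++ :v 1F) :++ (:v 2F :++ :v 3F))
          ((:v 0F :++ :v 2F) :++ (:v 1F :++ :v 3F)) ≡.refl)
        (++⁺ˡ (positive u ++ positive v) (↭-reflexive (≡.sym (List.map-++ to (negative u) _)))))
      positive-ι (⊖ u)   = ↭-trans (negative-ι u) (++-comm (map to (positive u)) (negative u))
      negative-ι ⟦ s ⟧   = ↭-refl
      negative-ι 𝟘       = ↭-refl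
      negative-ι (u ⊕ v) = ↭-trans (++⁺ (negative-ι u) (negative-ι v)) (↭-trans
        (rearrange (map to (positive u) ∷ negative u ∷ map to (positive v) ∷ negative v ∷ [])
          ((:v 0F :++ :v 1F) :++ (:v 2F :++ :v 3F))
          ((:v 0F :++ :v 2F) :++ (:v 1F :++ :v 3F)) ≡.refl)
        (++⁺ʳ (negative u ++ negative v) (↭-reflexive (≡.sym (List.map-++ to (positive u) _)))))
      negative-ι (⊖ u)   = ↭-trans (positive-ι u) (++-comm (positive u) (map to (negative u)))

      map-involutive : ∀ xs → xs ↭ map to (map to xs)
      map-involutive []       = ↭-refl
      map-involutive (x ∷ xs) = prep (Setoid.sym S (ν-involutive x)) (map-involutive xs)

    module _ (f-ν : ∀ x → f.⟦ ⟦ x ⟧ ⟧ B.∙ f.⟦ ⟦ to x ⟧ ⟧ B.≈ B.ε)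
             (f-fixed : ∀ {x} → to x ≈ x → f.⟦ ⟦ x ⟧ ⟧ B.≈ B.ε) where
      private
        f-paired : ∀ {xs} → Paired xs → f.⟦ sumList xs ⟧ B.≈ B.ε
        f-paired empty         = f.ε-homo
        f-paired (fixed e q P) = B.trans (f.⟦⟧-cong (sumList-↭ q))
          (B.trans (f.homo _ _) (B.trans (B.∙-cong (f-fixed e) (f-paired P)) (B.identityˡ B.ε)))
        f-paired (pair {x} {xs} q P) = B.trans (f.⟦⟧-cong (≋-trans (sumList-↭ q) (≋-sym (⊕-assoc ⟦ x ⟧ ⟦ to x ⟧ (sumList xs)))))
          (B.trans (f.homo _ _) (B.trans (B.∙-cong (B.trans (f.homo _ _) (f-ν x)) (f-paired P)) (B.identityˡ B.ε)))

        f-map : ∀ xs → f.⟦ sumList (map to xs) ⟧ B.≈ f.⟦ sumList xs ⟧ B.⁻¹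
        f-map []       = B.trans f.ε-homo (B.sym (B.trans (B.⁻¹-cong f.ε-homo) BP.ε⁻¹≈ε))
        f-map (x ∷ xs) = B.trans (f.homo _ _) (B.trans (B.∙-cong (BP.inverseʳ-unique _ _ (f-ν x)) (f-map xs))
          (B.trans (BP.⁻¹-∙-comm _ _) (B.⁻¹-cong (B.sym (f.homo _ _)))))

        f-signed : ∀ u → f.⟦ u ⟧ B.≈ f.⟦ sumList (signed u) ⟧
        f-signed u = B.trans (f.⟦⟧-cong (≋-positive-negative u)) (B.trans (f.homo _ _)
          (B.trans (B.∙-congˡ (B.trans (f.⁻¹-homo _) (B.sym (f-map (negative u)))))
            (B.trans (B.sym (f.homo _ _)) (B.sym (f.⟦⟧-cong (sumList-++ (positive u) _))))))

      -- Replacing each negative symbol by its image under `ν` does not change the value of `f`. If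
      -- `ι u` vanishes, the resulting multiset is stable under `ν`, hence made of pairs and fixed
      -- points. Fixed points have their own hypothesis because `f-ν` kills only twice such a
      -- symbol.
      antisymmetrize-kernel : ∀ u → ι u ≋ 𝟘 → f.⟦ u ⟧ B.≈ B.ε
      antisymmetrize-kernel u e = B.trans (f-signed u) (f-paired (paired symmetric))
        where
        symmetric : signed u ↭ map to (signed u)
        symmetric = ↭-trans (↭-sym (positive-ι u))
          (↭-trans (↭-sym (++-identityʳ (positive (ι u))))
          (↭-trans (balance e)
          (↭-trans (negative-ι u)
          (↭-trans (++⁺ˡ (map to (positive u)) (map-involutive (negative u)))
            (↭-reflexive (≡.sym (List.map-++ to (positive u) _)))))))

module _ {S : Setoid ℓ ℓ} (B : AbelianGroup ℓ ℓ) where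
  open Free S
  private module B = AbelianGroup B

  freeGroup-ext : (f g : GroupHom freeAbelianGroup B) →
                  (∀ s → GroupHomomorphism.⟦_⟧ f ⟦ s ⟧ B.≈ GroupHomomorphism.⟦_⟧ g ⟦ s ⟧) →
                  ∀ u → GroupHomomorphism.⟦_⟧ f u B.≈ GroupHomomorphism.⟦_⟧ g u
  freeGroup-ext f g e = go
    where
    module f = GroupHomomorphism f
    module g = GroupHomomorphism g
    go : ∀ u → f.⟦ u ⟧ B.≈ g.⟦ u ⟧
    go ⟦ s ⟧   = e s
    go 𝟘       = B.trans f.ε-homo (B.sym g.ε-homo)
    go (u ⊕ v) = B.trans (f.homo u v) (B.trans (B.∙-cong (go u) (go v)) (B.sym (g.homo u v)))
    go (⊖ u)   = B.trans (f.⁻¹-homo u) (B.trans (B.⁻¹-cong (go u)) (B.sym (g.⁻¹-homo u)))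

_∘ᵍ_ : {A B C : AbelianGroup ℓ ℓ} → GroupHom B C → GroupHom A B → GroupHom A C
_∘ᵍ_ {A = A} {C = C} g f = mkGroupHom A C (λ x → g.⟦ f.⟦ x ⟧ ⟧) (λ e → g.⟦⟧-cong (f.⟦⟧-cong e))
  (λ x y → AbelianGroup.trans C (g.⟦⟧-cong (f.homo x y)) (g.homo _ _))
  where
  module f = GroupHomomorphism f
  module g = GroupHomomorphism g

-- p-th powers in commutative rings

prime∤! : ∀ {p} → Prime p → ∀ j → j ℕ.< p → ¬ p ∣ j !
prime∤! {p} pr zero    j<p p∣1 with ∣⇒≤ p∣1
... | ℕ.s≤s ℕ.z≤n = ¬prime[1] pr
... | ℕ.z≤n       = ¬prime[0] pr
prime∤! pr (suc j) j<p p∣ with euclidsLemma (suc j) (j !) pr p∣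
... | inj₁ p∣1+j = ℕ.<⇒≱ j<p (∣⇒≤ p∣1+j)
... | inj₂ p∣j!  = prime∤! pr j (ℕ.<-trans (ℕ.n<1+n j) j<p) p∣j!

prime∣C : ∀ {p} → Prime p → ∀ k → suc k ℕ.< p → p ∣ p choose suc k
prime∣C {zero}      pr k k<p = ⊥-elim (¬prime[0] pr)
prime∣C {p@(suc n)} pr k k<p with euclidsLemma (p choose suc k) (suc k ! ℕ.* (p ℕ.∸ suc k) !) pr p∣product
  where
  instance _ = (suc k) ℕ.!* (p ℕ.∸ suc k) !≢0
  p∣product : p ∣ (p choose suc k) ℕ.* (suc k ! ℕ.* (p ℕ.∸ suc k) !)
  p∣product = ≡.subst (p ∣_)
    (≡.sym (≡.trans (≡.cong (ℕ._* (suc k ! ℕ.* (p ℕ.∸ suc k) !)) (nCk≡n!/k![n-k]! (ℕ.<⇒≤ k<p)))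
      (m/n*n≡m (k![n∸k]!∣n! (ℕ.<⇒≤ k<p)))))
    (∣m⇒∣m*n (n !) ∣-refl)
... | inj₁ p∣C = p∣C
... | inj₂ p∣! with euclidsLemma (suc k !) _ pr p∣!
...   | inj₁ q = ⊥-elim (prime∤! pr (suc k) k<p q)
...   | inj₂ q = ⊥-elim (prime∤! pr (p ℕ.∸ suc k) (ℕ.s≤s (ℕ.m∸n≤m n k)) q)

prime-≥2 : ∀ {p} → Prime p → ∃[ q ] p ≡ suc (suc q)
prime-≥2 {zero}        pr = ⊥-elim (¬prime[0] pr)
prime-≥2 {suc zero}    pr = ⊥-elim (¬prime[1] pr)
prime-≥2 {suc (suc q)} pr = q , ≡.refl

-- The successor on `h` records that p is at least 3 and not merely odd; `cube` relies on it.
prime-odd : ∀ {p} → Prime p → p ≢ 2 → ∃[ h ] p ≡ suc (suc h ℕ.* 2)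
prime-odd {p} pr p≢2 with p ℕ.% 2 | p ℕ./ 2 | m≡m%n+[m/n]*n p 2 | m%n<n p 2
... | zero  | h | e | _ with prime⇒irreducible pr (divides h e)
...   | inj₁ ()
...   | inj₂ 2≡p = ⊥-elim (p≢2 (≡.sym 2≡p))
prime-odd {p} pr p≢2 | suc zero | zero  | e | _ = ⊥-elim (¬prime[1] (≡.subst Prime e pr))
prime-odd {p} pr p≢2 | suc zero | suc h | e | _ = h , e
prime-odd {p} pr p≢2 | suc (suc r) | h | e | ℕ.s≤s (ℕ.s≤s ())

module _ (A : CommutativeRing ℓ ℓ) where
  open CommutativeRing A hiding (zero)
  open RingProperties ring
  open Exp semiring using (_^_)
  open ≈-Reasoning setoid

  -‿^-odd : ∀ h x → (- x) ^ suc (h ℕ.* 2) ≈ - (x ^ suc (h ℕ.* 2))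
  -‿^-odd zero    x = trans (*-identityʳ (- x)) (-‿cong (sym (*-identityʳ x)))
  -‿^-odd (suc h) x = begin
    - x * (- x * (- x) ^ suc (h ℕ.* 2))   ≈⟨ *-congˡ (*-congˡ (-‿^-odd h x)) ⟩
    - x * (- x * - (x ^ suc (h ℕ.* 2)))   ≈⟨ *-congˡ (-‿distribˡ-* x _) ⟨
    - x * - (x * - (x ^ suc (h ℕ.* 2)))   ≈⟨ *-congˡ (-‿cong (-‿distribʳ-* x _)) ⟨
    - x * - - (x * x ^ suc (h ℕ.* 2))     ≈⟨ *-congˡ (-‿involutive _) ⟩
    - x * (x * x ^ suc (h ℕ.* 2))         ≈⟨ -‿distribˡ-* x _ ⟨
    - (x * (x * x ^ suc (h ℕ.* 2)))       ∎

module _ (A : CommutativeRing ℓ ℓ) {p : ℕ} (pr : Prime p) where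
  open CommutativeRing A hiding (zero)
  open Exp semiring using (_^_)
  open RawMult +-rawMonoid using () renaming (_×_ to infixr 8 _·_)
  open SemiringMult semiring using (×-congʳ; ×-assoc-*; ×-assocˡ; ×-homo-1)
  open MonoidSum +-monoid using (sum; sum-init-last)
  open RingSolver commutativeSemiring using (solve; _:=_; _:+_; _:*_)
  open ≈-Reasoning setoid

  ·≈* : ∀ n x → n · x ≈ n · 1# * x
  ·≈* n x = trans (×-congʳ n (sym (*-identityˡ x))) (sym (×-assoc-* n 1# x))

  private
    P : Carrier
    P = p · 1#

    Tail : ∀ {n} → Carrier → Vector Carrier n → Set ℓ
    Tail v t = ∀ i → ∃[ g ] t i ≈ P * (v * (v * g))

    sum-tail : ∀ n v (t : Vector Carrier n) → Tail v t → ∃[ g ] sum t ≈ P * (v * (v * g))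
    sum-tail zero    v t div = 0# , sym (trans (*-congˡ (*-congˡ (zeroʳ v))) (trans (*-congˡ (zeroʳ v)) (zeroʳ P)))
    sum-tail (suc n) v t div = let (g , e) = div zero ; (h , e′) = sum-tail n v (t ∘ suc) (div ∘ suc) in
      g + h , trans (+-cong e e′)
        (solve 4 (λ P v g h → P :* (v :* (v :* g)) :+ P :* (v :* (v :* h)) := P :* (v :* (v :* (g :+ h)))) refl P v g h)

    expansion : ∀ q → p ≡ suc (suc q) → ∀ u v →
                ∃[ g ] (v + u) ^ p ≈ u ^ p + v ^ p + P * (u ^ suc q * v) + P * (v * (v * g))
    expansion q ≡.refl u v = g , (begin
      (v + u) ^ p
        ≈⟨ Binomial.theorem commutativeSemiring p v u ⟩
      term 0 + (term 1 + sum (λ (k : Fin (suc q)) → term (suc (suc (toℕ k)))))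
        ≈⟨ +-congˡ (+-congˡ (sum-init-last (λ (k : Fin (suc q)) → term (suc (suc (toℕ k)))))) ⟩
      term 0 + (term 1 + (sum middle + term (suc (suc (toℕ (fromℕ q))))))
        ≈⟨ +-cong first (+-cong second (+-cong (proj₂ middle-divisible) final)) ⟩
      u ^ p + (P * (u ^ suc q * v) + (P * (v * (v * g)) + v ^ p))
        ≈⟨ solve 4 (λ a b c d → a :+ (b :+ (c :+ d)) := a :+ d :+ b :+ c) refl _ _ _ _ ⟩
      u ^ p + v ^ p + P * (u ^ suc q * v) + P * (v * (v * g)) ∎)
      where
      term : ℕ → Carrier
      term k = (p choose k) · (v ^ k * u ^ (p ℕ.∸ k))

      -- The indices from 2 to p - 1: the binomial coefficient is divisible by p, and the power of
      -- `v` contains v².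
      middle : Vector Carrier q
      middle k = term (suc (suc (toℕ (inject₁ k))))

      first : term 0 ≈ u ^ p
      first = trans (×-homo-1 _) (*-identityˡ _)

      second : term 1 ≈ P * (u ^ suc q * v)
      second = trans (reflexive (≡.cong (_· (v ^ 1 * u ^ suc q)) (nC1≡n p)))
        (trans (·≈* p _) (*-congˡ (trans (*-congʳ (*-identityʳ v)) (*-comm v _))))

      final : term (suc (suc (toℕ (fromℕ q)))) ≈ v ^ p
      final = begin
        term (suc (suc (toℕ (fromℕ q))))  ≡⟨ ≡.cong (λ k → term (suc (suc k))) (Fin.toℕ-fromℕ q) ⟩
        term p                           ≡⟨ ≡.cong₂ (λ m n → m · (v ^ p * u ^ n)) (nCn≡1 p) (ℕ.n∸n≡0 p) ⟩
        1 · (v ^ p * 1#)                 ≈⟨ ×-homo-1 _ ⟩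
        v ^ p * 1#                       ≈⟨ *-identityʳ _ ⟩
        v ^ p                            ∎

      middle-divisible : ∃[ g ] sum middle ≈ P * (v * (v * g))
      middle-divisible = sum-tail q v middle λ k → divisible k (toℕ (inject₁ k))
        (ℕ.s≤s (ℕ.s≤s (≡.subst (ℕ._< q) (≡.sym (Fin.toℕ-inject₁ k)) (Fin.toℕ<n k))))
        where
        divisible : Fin q → ∀ k → suc (suc k) ℕ.< p → ∃[ g ] term (suc (suc k)) ≈ P * (v * (v * g))
        divisible _ k k<p with divides c e ← prime∣C pr (suc k) k<p = c · (v ^ k * w) , (begin
          term (suc (suc k))
            ≡⟨ ≡.cong (_· (v ^ suc (suc k) * w)) (≡.trans e (ℕ.*-comm c p)) ⟩
          (p ℕ.* c) · (v ^ suc (suc k) * w)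
            ≈⟨ ×-assocˡ _ p c ⟨
          p · c · (v ^ suc (suc k) * w)
            ≈⟨ ·≈* p _ ⟩
          P * (c · (v ^ suc (suc k) * w))
            ≈⟨ *-congˡ (·≈* c _) ⟩
          P * (c · 1# * (v ^ suc (suc k) * w))
            ≈⟨ solve 5 (λ P c v y w → P :* (c :* (v :* (v :* y) :* w)) := P :* (v :* (v :* (c :* (y :* w)))))
                 refl P (c · 1#) v (v ^ k) w ⟩
          P * (v * (v * (c · 1# * (v ^ k * w))))
            ≈⟨ *-congˡ (*-congˡ (*-congˡ (·≈* c _))) ⟨
          P * (v * (v * (c · (v ^ k * w)))) ∎)
          where w = u ^ (p ℕ.∸ suc (suc k))
      g = proj₁ middle-divisible

  -- The term linear in `v` is kept explicit because, for `v` divisible by p, it is the one carrying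
  -- the lowest power of p besides `u ^ p`; `raise` divides by that power.
  prime-binomial : ∀ u v → ∃[ g ] (u + v) ^ p ≈ u ^ p + v ^ p + P * (u ^ ℕ.pred p * v) + P * (v * (v * g))
  prime-binomial u v = let (q , e) = prime-≥2 pr ; (g , e′) = expansion q e u v in
    g , trans (Exp.^-congˡ semiring p (+-comm u v))
      (trans e′ (+-congʳ (+-congˡ (*-congˡ (*-congʳ (reflexive (≡.cong (λ n → u ^ ℕ.pred n) (≡.sym e))))))))

  frobenius : ∀ u v → ∃[ h ] (u + v) ^ p ≈ u ^ p + v ^ p + P * h
  frobenius u v = let (g , e) = prime-binomial u v in
    u ^ ℕ.pred p * v + v * (v * g) ,
    trans e (solve 4 (λ a P b c → a :+ P :* b :+ P :* c := a :+ P :* (b :+ c)) refl _ P _ _)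

-- In a p-torsion free ring which is reduced modulo p and p-adically
-- separated, p-th powers are injective: if rᵖ = sᵖ and r - s = pᵐ d, then
-- for every j ≤ m some multiple c s is divisible by pʲ where c is such that
-- p ∣ c d implies p ∣ d; for j = m the binomial formula gives p ∣ (c d)ᵖ.
module PowerInjective (A : CommutativeRing ℓ ℓ) {p : ℕ} (pr : Prime p) (p≢2 : p ≢ 2) where
  open CommutativeRing A hiding (zero)
  open Exp semiring using (_^_; ^-assocʳ; ^-congˡ; ^-homo-*)
  open RawMult +-rawMonoid using () renaming (_×_ to infixr 8 _·_)
  open RingProperties ring using (-‿distribʳ-*)
  open AbelianGroupProperties +-abelianGroup
    using (inverseˡ-unique; identityʳ-unique; x∙y⁻¹≈ε⇒x≈y; xyx⁻¹≈y)
  open RingSolver commutativeSemiring using (solve; _:=_; _:+_; _:*_; con)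
  open SemiringMult semiring using (×-assocˡ)
  open CommutativeExp commutativeSemiring using (^-distrib-*)
  open ≈-Reasoning setoid

  module _ (torsion-free : ∀ {x y} → p · x ≈ p · y → x ≈ y)
           (reduced : ∀ {x y} → x ^ p ≈ p · y → ∃[ z ] x ≈ p · z)
           (adically-separated : ∀ x → (∀ n → ∃[ y ] x ≈ (p ℕ.^ n) · y) → x ≈ 0#) where

    private
      P : Carrier
      P = p · 1#

      cancel-P : ∀ {x y} → P * x ≈ P * y → x ≈ y
      cancel-P e = torsion-free (trans (·≈* A pr p _) (trans e (sym (·≈* A pr p _))))

      cancel-P^ : ∀ n {x y} → P ^ n * x ≈ P ^ n * y → x ≈ y
      cancel-P^ zero    e = trans (sym (*-identityˡ _)) (trans e (*-identityˡ _))
      cancel-P^ (suc n) e = cancel-P^ n (cancel-P (trans (sym (*-assoc _ _ _)) (trans e (*-assoc _ _ _))))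

      Divisible : Carrier → Set _
      Divisible x = ∃[ z ] x ≈ P * z

      reduced-P : ∀ {x y} → x ^ p ≈ P * y → Divisible x
      reduced-P e = let (z , e′) = reduced (trans e (sym (·≈* A pr p _))) in z , trans e′ (·≈* A pr p z)

      p-1 : ℕ
      p-1 = ℕ.pred p

      ^-p : ∀ x → x ^ p ≈ x * x ^ p-1
      ^-p x = let (q , e) = prime-≥2 pr in
        reflexive (≡.subst (λ n → x ^ n ≡ x * x ^ ℕ.pred n) (≡.sym e) ≡.refl)

      square-reduced : ∀ {x y} → x * x ≈ P * y → Divisible x
      square-reduced {x} {y} e = let (q , e′) = prime-≥2 pr in reduced-P {y = y * x ^ q} (begin
        x ^ p               ≡⟨ ≡.cong (x ^_) e′ ⟩
        x * (x * x ^ q)     ≈⟨ *-assoc x x _ ⟨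
        x * x * x ^ q       ≈⟨ *-congʳ e ⟩
        P * y * x ^ q       ≈⟨ *-assoc P y _ ⟩
        P * (y * x ^ q)     ∎)

      -- For v = p w the linear term of the binomial formula carries p². The pure power vᵖ must
      -- carry more, which v³ ensures and v² would not.
      cube : ∀ v → ∃[ g ] v ^ p ≈ v * (v * (v * g))
      cube v = let (h , e) = prime-odd pr p≢2 in v ^ (h ℕ.* 2) , reflexive (≡.cong (v ^_) e)

      isolate : ∀ {x y} → 0# ≈ x + P * y → x ≈ P * - y
      isolate {x} {y} e = trans (inverseˡ-unique _ _ (sym e)) (-‿distribʳ-* P y)

      excess : ∀ {a b} → a ≈ a + b → 0# ≈ b
      excess {a} {b} e = sym (identityʳ-unique a b (sym e))

      -- Cancelling `P ^ (k + 2)` in the binomial formula leaves 0 = w uᵖ⁻¹ + p · rest. As w uᵖ⁻¹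
      -- divides (w u)ᵖ, that power is divisible by p, and reducedness applies to w u.
      raise : ∀ k u w → (u + P ^ suc k * w) ^ p ≈ u ^ p → Divisible (w * u)
      raise k u w e = reduced-P (begin
        (w * u) ^ p                ≈⟨ ^-distrib-* w u p ⟩
        w ^ p * u ^ p              ≈⟨ *-cong (^-p w) (^-p u) ⟩
        w * w ^ p-1 * (u * u ^ p-1)
          ≈⟨ solve 4 (λ w w′ u u′ → w :* w′ :* (u :* u′) := (w :* u′) :* (w′ :* u)) refl w (w ^ p-1) u (u ^ p-1) ⟩
        w * u ^ p-1 * (w ^ p-1 * u)
          ≈⟨ *-congʳ (isolate wu) ⟩
        P * - rest * (w ^ p-1 * u)
          ≈⟨ *-assoc P (- rest) _ ⟩
        P * (- rest * (w ^ p-1 * u)) ∎)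
        where
        Q = P ^ k
        v = P * Q * w
        g = proj₁ (prime-binomial A pr u v)
        h = proj₁ (cube v)
        rest = w * (Q * (w * g)) + Q * (w * (w * (Q * (w * h))))

        wu : 0# ≈ w * u ^ p-1 + P * rest
        wu = cancel-P^ (suc (suc k)) (begin
          P * (P * Q) * 0#
            ≈⟨ zeroʳ _ ⟩
          0#
            ≈⟨ excess (begin
                 u ^ p
                   ≈⟨ e ⟨
                 (u + v) ^ p
                   ≈⟨ proj₂ (prime-binomial A pr u v) ⟩
                 u ^ p + v ^ p + P * (u ^ p-1 * v) + P * (v * (v * g))
                   ≈⟨ solve 4 (λ a b c d → a :+ b :+ c :+ d := a :+ (b :+ c :+ d)) refl _ _ _ _ ⟩
                 u ^ p + (v ^ p + P * (u ^ p-1 * v) + P * (v * (v * g))) ∎) ⟩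
          v ^ p + P * (u ^ p-1 * v) + P * (v * (v * g))
            ≈⟨ +-congʳ (+-congʳ (proj₂ (cube v))) ⟩
          v * (v * (v * h)) + P * (u ^ p-1 * v) + P * (v * (v * g))
            ≈⟨ solve 6 (λ P Q w u g h → let v = P :* Q :* w in
                 v :* (v :* (v :* h)) :+ P :* (u :* v) :+ P :* (v :* (v :* g)) :=
                 P :* (P :* Q) :* (w :* u :+ P :* (w :* (Q :* (w :* g)) :+ Q :* (w :* (w :* (Q :* (w :* h)))))))
                 refl P Q w (u ^ p-1) g h ⟩
          P * (P * Q) * (w * u ^ p-1 + P * rest) ∎)

      raise-last : ∀ u w → (u + w) ^ p ≈ u ^ p → Divisible w
      raise-last u w e = reduced-P (isolate (excess (begin
        u ^ p                    ≈⟨ e ⟨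
        (u + w) ^ p              ≈⟨ proj₂ (frobenius A pr u w) ⟩
        u ^ p + w ^ p + P * _    ≈⟨ +-assoc _ _ _ ⟩
        u ^ p + (w ^ p + P * _)  ∎)))

    module _ {r s : Carrier} (rᵖ≈sᵖ : r ^ p ≈ s ^ p) where

      private
        module Step (m : ℕ) (d : Carrier) (r≈s+d : r ≈ s + P ^ m * d) where

          Claim : ℕ → Set _
          Claim j = ∃[ c ] ∃[ u ] c * s ≈ P ^ j * u × (Divisible (c * d) → Divisible d)

          -- c r = pʲ (u + pᵏ c d) and c s = pʲ u have the same p-th power.
          same-power : ∀ j k → j ℕ.+ k ≡ m → ∀ {c u} → c * s ≈ P ^ j * u →
                       (u + P ^ k * (c * d)) ^ p ≈ u ^ p
          same-power j k e {c} {u} cs = cancel-P^ (j ℕ.* p) (begin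
            P ^ (j ℕ.* p) * (u + P ^ k * (c * d)) ^ p
              ≈⟨ *-congʳ (^-assocʳ P j p) ⟨
            (P ^ j) ^ p * (u + P ^ k * (c * d)) ^ p
              ≈⟨ ^-distrib-* _ _ p ⟨
            (P ^ j * (u + P ^ k * (c * d))) ^ p
              ≈⟨ ^-congˡ p (begin
                   P ^ j * (u + P ^ k * (c * d))
                     ≈⟨ solve 5 (λ Pʲ u Pᵏ c d → Pʲ :* (u :+ Pᵏ :* (c :* d)) := Pʲ :* u :+ c :* (Pʲ :* Pᵏ :* d))
                          refl (P ^ j) u (P ^ k) c d ⟩
                   P ^ j * u + c * (P ^ j * P ^ k * d)
                     ≈⟨ +-cong (sym cs) (*-congˡ (*-congʳ (sym (^-homo-* P j k)))) ⟩
                   c * s + c * (P ^ (j ℕ.+ k) * d)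
                     ≡⟨ ≡.cong (λ n → c * s + c * (P ^ n * d)) e ⟩
                   c * s + c * (P ^ m * d)
                     ≈⟨ distribˡ c s _ ⟨
                   c * (s + P ^ m * d)
                     ≈⟨ *-congˡ r≈s+d ⟨
                   c * r ∎) ⟩
            (c * r) ^ p         ≈⟨ ^-distrib-* c r p ⟩
            c ^ p * r ^ p       ≈⟨ *-congˡ rᵖ≈sᵖ ⟩
            c ^ p * s ^ p       ≈⟨ ^-distrib-* c s p ⟨
            (c * s) ^ p         ≈⟨ ^-congˡ p cs ⟩
            (P ^ j * u) ^ p     ≈⟨ ^-distrib-* _ u p ⟩
            (P ^ j) ^ p * u ^ p ≈⟨ *-congʳ (^-assocʳ P j p) ⟩
            P ^ (j ℕ.* p) * u ^ p ∎)

          claim : ∀ j k → j ℕ.+ k ≡ m → Claim j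
          claim zero    k e = 1# , s , refl , λ (z , f) → z , trans (sym (*-identityˡ d)) f
          claim (suc j) k e =
            let (c , u , cs , back) = claim j (suc k) (≡.trans (ℕ.+-suc j k) e)
                w = c * d
                (u′ , wu) = raise k u w (same-power j (suc k) (≡.trans (ℕ.+-suc j k) e) cs)
            -- The new multiplier is c² d. Its product with d is the square (c d)², so divisibility
            -- by p returns to c d by reducedness and from there to d.
            in c * w , u′ ,
               (begin
                 c * w * s            ≈⟨ solve 3 (λ c w s → c :* w :* s := w :* (c :* s)) refl c w s ⟩
                 w * (c * s)          ≈⟨ *-congˡ cs ⟩
                 w * (P ^ j * u)      ≈⟨ solve 3 (λ w Pʲ u → w :* (Pʲ :* u) := Pʲ :* (w :* u)) refl w (P ^ j) u ⟩
                 P ^ j * (w * u)      ≈⟨ *-congˡ wu ⟩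
                 P ^ j * (P * u′)     ≈⟨ solve 3 (λ Pʲ P u → Pʲ :* (P :* u) := P :* Pʲ :* u) refl (P ^ j) P u′ ⟩
                 P * P ^ j * u′       ∎) ,
               λ (z , f) → back (square-reduced (trans
                 (solve 2 (λ c d → c :* d :* (c :* d) := c :* (c :* d) :* d) refl c d) f))

          divisible : Divisible d
          divisible = let (c , u , cs , back) = claim m 0 (ℕ.+-identityʳ m) in
            back (raise-last u (c * d) (trans
              (^-congˡ p (+-congˡ (sym (*-identityˡ _))))
              (same-power m 0 (ℕ.+-identityʳ m) cs)))

        approximate : ∀ m → ∃[ d ] r ≈ s + P ^ m * d
        approximate zero    = r - s , (begin
          r                      ≈⟨ +-identityʳ r ⟨
          r + 0#                 ≈⟨ +-congˡ (-‿inverseʳ s) ⟨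
          r + (s - s)            ≈⟨ solve 3 (λ r s s′ → r :+ (s :+ s′) := s :+ con 1 :* (r :+ s′)) refl r s (- s) ⟩
          s + 1# * (r - s)       ∎)
        approximate (suc m) = let (d , e) = approximate m ; (d′ , e′) = Step.divisible m d e in
          d′ , trans e (+-congˡ (trans (*-congˡ e′)
            (solve 3 (λ Pᵐ P d → Pᵐ :* (P :* d) := P :* Pᵐ :* d) refl (P ^ m) P d′)))

        P^≈ : ∀ n → P ^ n ≈ (p ℕ.^ n) · 1#
        P^≈ zero    = sym (+-identityʳ 1#)
        P^≈ (suc n) = trans (*-congˡ (P^≈ n)) (trans (sym (·≈* A pr p _)) (×-assocˡ 1# p (p ℕ.^ n)))

      ^-p-injective : r ≈ s
      ^-p-injective = x∙y⁻¹≈ε⇒x≈y r s (adically-separated (r - s) λ n → let (d , e) = approximate n in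
        d , (begin
          r - s                 ≈⟨ +-congʳ e ⟩
          s + P ^ n * d - s     ≈⟨ xyx⁻¹≈y s _ ⟩
          P ^ n * d             ≈⟨ *-congʳ (P^≈ n) ⟩
          (p ℕ.^ n) · 1# * d    ≈⟨ ·≈* A pr (p ℕ.^ n) d ⟨
          (p ℕ.^ n) · d         ∎))

-- Arithmetic of ℤ[S] modulo powers of p

n<m^n : ∀ {m} n → 1 ℕ.< m → n ℕ.< m ℕ.^ n
n<m^n zero    1<m = ℕ.s≤s ℕ.z≤n
n<m^n {m} (suc n) 1<m = ℕ.≤-trans (ℕ.s≤s (n<m^n n 1<m)) (ℕ.^-monoʳ-< m 1<m (ℕ.n<1+n n))

module PolynomialRing (S : Setoid ℓ ℓ) {p : ℕ} (pr : Prime p) (p≢2 : p ≢ 2) where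
  open CommutativeRing ℤ[ S ] hiding (zero)
  open Exp semiring using (_^_; ^-congˡ)
  open RawMult +-rawMonoid using () renaming (_×_ to infixr 8 _·_)
  open Polynomial S using (⟦_⟧; _⊕_; ⊖_; 𝟘; Poly; lift; freeAbelianGroup)
  open GroupMult +-abelianGroup
  open GroupSolver +-abelianGroup using (prove)
  open Multiset S using (copies; copies-cong; copies-injective; ↭-setoid)
  private
    module FP = FreeProperties ↭-setoid
  open ≈-Reasoning setoid

  private
    n = proj₁ (prime-≥2 pr)
    p≡ : p ≡ suc (suc n)
    p≡ = proj₂ (prime-≥2 pr)

  torsion-free : ∀ {x y} → p · x ≈ p · y → x ≈ y
  torsion-free e = FP.·-injective (suc n) (≡.subst (λ k → k · _ ≈ k · _) p≡ e)

  p·-zero : TorsionFree +-abelianGroup p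
  p·-zero x e = torsion-free (trans e (sym (·-ε p)))

  adically-separated : ∀ x → (∀ n → ∃[ y ] x ≈ (p ℕ.^ n) · y) → x ≈ 0#
  adically-separated x = FP.·-separated x (p ℕ.^_)
    λ n → n<m^n n (≡.subst (1 ℕ.<_) (≡.sym p≡) (ℕ.s≤s (ℕ.s≤s ℕ.z≤n)))

  private
    power : Func ↭-setoid ↭-setoid
    power = record { to = copies p ; cong = copies-cong p }

    ψ : Poly → Poly
    ψ = lift freeAbelianGroup (⟦_⟧ ∘ copies p)

    ⟦⟧^ : ∀ k m → ⟦ m ⟧ ^ k ≡ ⟦ copies k m ⟧
    ⟦⟧^ zero    m = ≡.refl
    ⟦⟧^ (suc k) m = ≡.cong (λ v → ⟦ m ⟧ * v) (⟦⟧^ k m)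

    0^p : 0# ^ p ≈ 0#
    0^p = trans (reflexive (≡.cong (0# ^_) p≡)) (zeroˡ (0# ^ suc n))

    -- xᵖ is congruent modulo p to the Frobenius lift ψ x, which is additive.
    ^p≈ψ : ∀ x → ∃[ h ] x ^ p ≈ ψ x + p · h
    ^p≈ψ ⟦ m ⟧   = 0# , trans (reflexive (⟦⟧^ p m)) (sym (trans (+-congˡ (·-ε p)) (+-identityʳ _)))
    ^p≈ψ 𝟘       = 0# , trans 0^p (sym (trans (+-congˡ (·-ε p)) (+-identityʳ _)))
    ^p≈ψ (x ⊕ y) = let (h , e) = frobenius ℤ[ S ] pr x y ; (f , e₁) = ^p≈ψ x ; (g , e₂) = ^p≈ψ y in
      f + g + h , (begin
        (x + y) ^ p                                ≈⟨ e ⟩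
        x ^ p + y ^ p + p · 1# * h                 ≈⟨ +-cong (+-cong e₁ e₂) (sym (·≈* ℤ[ S ] pr p h)) ⟩
        ψ x + p · f + (ψ y + p · g) + p · h
          ≈⟨ prove (ψ x ∷ p · f ∷ ψ y ∷ p · g ∷ p · h ∷ [])
               (v0 ⊞ v1 ⊞ (v2 ⊞ v3) ⊞ v4) (v0 ⊞ v2 ⊞ (v1 ⊞ v3 ⊞ v4)) ≡.refl ⟩
        ψ x + ψ y + (p · f + p · g + p · h)        ≈⟨ +-congˡ (+-congʳ (·-∙ f g p)) ⟨
        ψ x + ψ y + (p · (f + g) + p · h)          ≈⟨ +-congˡ (·-∙ (f + g) h p) ⟨
        ψ x + ψ y + p · (f + g + h) ∎)
    ^p≈ψ (⊖ x)   = let (h , e) = frobenius ℤ[ S ] pr (- x) x ; (f , e₁) = ^p≈ψ x in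
      - (f + h) , (begin
        (- x) ^ p
          ≈⟨ prove ((- x) ^ p ∷ x ^ p ∷ p · 1# * h ∷ []) v0 ((v0 ⊞ v1 ⊞ v2) ⊟ (v1 ⊞ v2)) ≡.refl ⟩
        ((- x) ^ p + x ^ p + p · 1# * h) - (x ^ p + p · 1# * h)
          ≈⟨ +-cong (trans (sym e) (trans (^-congˡ p (-‿inverseˡ x)) 0^p))
                    (-‿cong (+-cong e₁ (sym (·≈* ℤ[ S ] pr p h)))) ⟩
        0# - (ψ x + p · f + p · h)
          ≈⟨ prove (ψ x ∷ p · f ∷ p · h ∷ []) (nil ⊟ (v0 ⊞ v1 ⊞ v2)) (⊟ v0 ⊟ (v1 ⊞ v2)) ≡.refl ⟩
        - ψ x - (p · f + p · h)
          ≈⟨ +-congˡ (-‿cong (·-∙ f h p)) ⟨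
        - ψ x - p · (f + h)
          ≈⟨ +-congˡ (·-⁻¹ p (f + h)) ⟨
        - ψ x + p · - (f + h) ∎)

  -- Modulo p the power xᵖ is `ψ x`, and `ψ` comes from the injective map m ↦ mᵖ on monomials. It
  -- therefore only relabels coefficients, and divisibility of `ψ x` is divisibility of `x`.
  reduced : ∀ {x y} → x ^ p ≈ p · y → ∃[ z ] x ≈ p · z
  reduced {x} {y} e = let
      (h , e₁) = ^p≈ψ x
      ψx : ψ x ≈ p · (y - h)
      ψx = begin
        ψ x                    ≈⟨ prove (ψ x ∷ p · h ∷ []) v0 ((v0 ⊞ v1) ⊟ v1) ≡.refl ⟩
        (ψ x + p · h) - p · h  ≈⟨ +-congʳ (trans (sym e₁) e) ⟩
        p · y - p · h          ≈⟨ ·-- p y h ⟨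
        p · (y - h)            ∎
      (z , e₂) = freeMap-divisible power (λ {a} {b} q → copies-injective (suc n) a
                   (≡.subst (λ k → Multiset._↭_ S (copies k a) (copies k b)) p≡ q)) (suc n)
                   (trans ψx (·-≡ (y - h) p≡))
    in z , trans e₂ (·-≡ z (≡.sym p≡))

  ^p-injective : ∀ {r s} → r ^ p ≈ s ^ p → r ≈ s
  ^p-injective = PowerInjective.^-p-injective ℤ[ S ] pr p≢2 torsion-free reduced adically-separated

-- The universal property of G(R)

module _ {A B : VGroup ℓ} (f : VHom A B) where
  private
    module A = VGroup A
    module B = VGroup B
  open VHom f
  open GroupSolver B.group using (prove)

  kernel-- : ∀ {x y} → ⟦ x A.- y ⟧ B.≈ B.0# → ⟦ x ⟧ B.≈ ⟦ y ⟧
  kernel-- {x} {y} e = B.x∙y⁻¹≈ε⇒x≈y _ _ (B.trans (B.sym (-homo x y)) e)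

  Span-kernel : ∀ {S : Pred A.Carrier ℓ} → (∀ {x} → x ∈ S → ⟦ x ⟧ B.≈ B.0#) →
                ∀ {x} → x ∈ Span A S → ⟦ x ⟧ B.≈ B.0#
  Span-kernel k (gen s)    = k s
  Span-kernel k (resp e q) = B.trans (⟦⟧-cong (A.sym e)) (Span-kernel k q)
  Span-kernel k zer        = ε-homo
  Span-kernel k (add q r)  =
    B.trans (∙-homo _ _) (B.trans (B.∙-cong (Span-kernel k q) (Span-kernel k r)) (B.identityˡ B.0#))
  Span-kernel k (neg q)    = B.trans (⁻¹-homo _) (B.trans (B.⁻¹-cong (Span-kernel k q)) B.ε⁻¹≈ε)

  -- The topologies are parameters because `X`, the target of the ghost map, is shown to be
  -- separated in the product topology, while the other applications are V-adic.
  Closure-kernel : (U : Topology A) (W : Topology B) → (∀ y → (∀ n → VSubgroup.mem (W n) y) → y B.≈ B.0#) →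
                   (∀ n {x} → VSubgroup.mem (U n) x → VSubgroup.mem (W n) ⟦ x ⟧) →
                   ∀ {S : Pred A.Carrier ℓ} → (∀ {x} → x ∈ S → ⟦ x ⟧ B.≈ B.0#) →
                   ∀ {x} → Closure A U S x → ⟦ x ⟧ B.≈ B.0#
  Closure-kernel U W separated continuous k {x} (closure approx) = separated ⟦ x ⟧ λ n →
    let (s , s∈ , d) = approx n in
    VSubgroup.resp (W n)
      (B.trans (-homo x s) (B.trans (B.∙-congˡ (B.⁻¹-cong (Span-kernel k s∈)))
        (prove (⟦ x ⟧ ∷ []) (v0 ⊟ nil) v0 ≡.refl)))
      (continuous n d)

  V-adic-Closure-kernel : IsVComplete B → ∀ {S : Pred A.Carrier ℓ} → (∀ {x} → x ∈ S → ⟦ x ⟧ B.≈ B.0#) →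
                          ∀ {x} → Closure A (V-adic A) S x → ⟦ x ⟧ B.≈ B.0#
  V-adic-Closure-kernel complete =
    Closure-kernel (V-adic A) (V-adic B) (VComplete.separated B complete) (V-adic-map f)

  module _ (p : ℕ) (torsion-free : TorsionFree B.group p) where

    torsion-free^ : ∀ k y → (p ℕ.^ k) B.· y B.≈ B.0# → y B.≈ B.0#
    torsion-free^ zero    y e = B.trans (B.sym (B.identityʳ y)) e
    torsion-free^ (suc k) y e =
      torsion-free^ k y (torsion-free _ (B.trans (B.×-assocˡ y p (p ℕ.^ k)) e))

    Torsion-kernel : ∀ {x} → x ∈ Torsion A p → ⟦ x ⟧ B.≈ B.0#
    Torsion-kernel {x} (k , e) = torsion-free^ k _
      (B.trans (B.sym (×-homo (p ℕ.^ k) x)) (B.trans (⟦⟧-cong e) ε-homo))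

    saturation-kernel : (P : VSubgroup A) → (∀ {x} → VSubgroup.mem P x → ⟦ x ⟧ B.≈ B.0#) →
                        ∀ {x} → VSubgroup.mem (saturation A P p) x → ⟦ x ⟧ B.≈ B.0#
    saturation-kernel P P-kernel {x} (k , m) =
      torsion-free^ k _ (B.trans (B.sym (×-homo (p ℕ.^ k) x)) (P-kernel m))

  quotientLift : (P : VSubgroup A) → (∀ {x} → VSubgroup.mem P x → ⟦ x ⟧ B.≈ B.0#) → VHom (A / P) B
  quotientLift P k .VHom.hom = mkGroupHom (VGroup.group (A / P)) B.group ⟦_⟧
    (λ { (congruent q) → kernel-- (k q) }) ∙-homo
  quotientLift P k .VHom.V-homo = V-homo

  completionLift : IsVComplete B → VHom (completion A) B
  completionLift complete .VHom.hom = mkGroupHom (VGroup.group (completion A)) B.group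
    (λ x → limit (map-coherent f x))
    (λ {x} {y} e → ≈-limit λ n → VSubgroup.resp (V-adic B n)
      (prove (limit (map-coherent f x) ∷ ⟦ seq x n ⟧ ∷ ⟦ seq y n ⟧ ∷ limit (map-coherent f y) ∷ [])
        ((v0 ⊟ v1) ⊞ (v1 ⊟ v2) ⊟ (v3 ⊟ v2)) (v0 ⊟ v3) ≡.refl)
      (∸-mem B (V-adic B n)
        (VSubgroup.+-mem (V-adic B n) (limit-near (map-coherent f x) n)
          (VSubgroup.resp (V-adic B n) (-homo _ _) (V-adic-map f n (Quotient._~_.difference (_≈ᶜ_.coordinate e n)))))
        (limit-near (map-coherent f y) n)))
    (λ x y → ≈-limit λ n → VSubgroup.resp (V-adic B n)
      (B.trans (B.∙-congʳ (B.∙-congˡ (B.⁻¹-cong (∙-homo (seq x n) (seq y n)))))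
        (prove (limit (map-coherent f (_+ᶜ_ A x y)) ∷ ⟦ seq x n ⟧ ∷ ⟦ seq y n ⟧ ∷
                limit (map-coherent f x) ∷ limit (map-coherent f y) ∷ [])
          (v0 ⊟ (v1 ⊞ v2) ⊟ ((v3 ⊟ v1) ⊞ (v4 ⊟ v2))) (v0 ⊟ (v3 ⊞ v4)) ≡.refl))
      (∸-mem B (V-adic B n) (limit-near (map-coherent f (_+ᶜ_ A x y)) n)
        (VSubgroup.+-mem (V-adic B n) (limit-near (map-coherent f x) n) (limit-near (map-coherent f y) n))))
    where
    open VComplete B complete
    open Coherent
  completionLift complete .VHom.V-homo x = ≈-limit λ n → VSubgroup.resp (V-adic B n)
      (B.trans (B.∙-cong (B.∙-congˡ (B.⁻¹-cong (V-homo (seq x n)))) (B.⁻¹-cong (B.V-- _ _)))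
        (prove (limit (map-coherent f (V-coherent A x)) ∷ B.V ⟦ seq x n ⟧ ∷ B.V (limit (map-coherent f x)) ∷ [])
          (v0 ⊟ v1 ⊟ (v2 ⊟ v1)) (v0 ⊟ v2) ≡.refl))
      (∸-mem B (V-adic B n) (limit-near (map-coherent f (V-coherent A x)) n)
        (VSubgroup.V-mem (V-adic B n) (limit-near (map-coherent f x) n)))
    where
    open VComplete B complete
    open Coherent

  completionLift-near : (complete : IsVComplete B) → ∀ x n →
                        V^Image B n (VHom.⟦_⟧ (completionLift complete) x B.- ⟦ Coherent.seq x n ⟧)
  completionLift-near complete x = VComplete.limit-near B complete (map-coherent f x)

  completionLift-toCompletion : (complete : IsVComplete B) → ∀ x →
                                VHom.⟦_⟧ (completionLift complete) (toCompletion A x) B.≈ ⟦ x ⟧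
  completionLift-toCompletion complete x =
    VComplete.≈-limit B complete (completionLift-near complete (toCompletion A x))

_∘ᵛ_ : {A B C : VGroup ℓ} → VHom B C → VHom A B → VHom A C
_∘ᵛ_ {A = A} {B = B} {C = C} g f = record
  { hom    = mkGroupHom (VGroup.group A) (VGroup.group C) (λ x → g.⟦ f.⟦ x ⟧ ⟧)
               (λ e → g.⟦⟧-cong (f.⟦⟧-cong e))
               (λ x y → C.trans (g.⟦⟧-cong (f.∙-homo x y)) (g.∙-homo _ _))
  ; V-homo = λ x → C.trans (g.⟦⟧-cong (f.V-homo x)) (g.V-homo _) }
  where
  module f = VHom f
  module g = VHom g
  module C = VGroup C

-- Maps R → B subject to the axioms (1) and (2) of a weak pre-Witt functor.
record TeichmüllerMap (p : ℕ) (R : Ring ℓ ℓ) (B : VGroup ℓ) : Set ℓ where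
  private
    module R = Ring R
    module B = VGroup B
  open Exp R.semiring using (_^_)
  field
    teich      : R.Carrier → B.Carrier
    teich-cong : Congruent R._≈_ B._≈_ teich
    teich-0    : teich R.0# B.≈ B.0#
    teich-neg  : ∀ x → teich (R.- x) B.≈ B.- teich x

  δ : R.Carrier → B.Carrier
  δ z = B.V (teich (z ^ p)) B.- p B.· teich z

  field
    additive : ∀ x y → δ (x R.+ y) B.≈ δ x B.+ δ y

module Extension (p : ℕ) (R : Ring ℓ ℓ) (B : VGroup ℓ) (τ : TeichmüllerMap p R B)
                 (torsion-free : TorsionFree (VGroup.group B) p) where
  private
    module R = Ring R
    module B = VGroup B
  open TeichmüllerMap τ
  open Exp R.semiring using (_^_)
  open G-construction p R
  open GroupSolver B.group using (prove)
  private
    module Rel = Relations p R G̃ v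

  fromFree : VHom freeVGroup B
  fromFree .VHom.hom = mkGroupHom (VGroup.group freeVGroup) B.group
    (F.lift B.group λ (n , r) → B.V^ n (teich r))
    (F.lift-cong B.group λ { {n , _} (≡.refl , e) → V^-cong B n (teich-cong e) })
    (λ _ _ → B.refl)
  fromFree .VHom.V-homo = go
    where
    go : ∀ u → F.lift B.group _ (VGroup.V freeVGroup u) B.≈ B.V (F.lift B.group _ u)
    go F.⟦ s ⟧   = B.refl
    go F.𝟘       = B.sym B.V-0
    go (u F.⊕ w) = B.trans (B.∙-cong (go u) (go w)) (B.sym (B.V-+ _ _))
    go (F.⊖ u)   = B.trans (B.⁻¹-cong (go u)) (B.sym (B.V-neg _))

  fromG̃ : VHom G̃ B
  fromG̃ = quotientLift fromFree zeroSymbols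
    (Span-kernel fromFree λ { (zeroSymbol n) → B.trans (V^-cong B n teich-0) (V^-0 B n) })

  private
    fromδ : ∀ n x → VHom.⟦_⟧ fromG̃ (Rel.δ n x) B.≈ B.V^ n (δ x)
    fromδ n x = B.trans (VHom.-homo fromG̃ (v (suc n) (x ^ p)) (p G̃.· v n x)) (B.trans
      (B.∙-cong (V-V^ B n _) (B.⁻¹-cong (B.trans (VHom.×-homo fromG̃ p (v n x)) (V^-· n _))))
      (B.sym (V^-∸ B n _ _)))
      where
      V^-· : ∀ n y → p B.· B.V^ n y B.≈ B.V^ n (p B.· y)
      V^-· zero    y = B.refl
      V^-· (suc n) y = B.trans (B.sym (B.V-· p _)) (B.V-cong (V^-· n y))

    fromRelation : ∀ {u} → u ∈ Rel.Relation → VHom.⟦_⟧ fromG̃ u B.≈ B.0#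
    fromRelation (Rel.additive n x y) = begin
      f ((Rel.δ n (x R.+ y) G̃.- Rel.δ n x) G̃.- Rel.δ n y)
        ≈⟨ B.trans (VHom.-homo fromG̃ (Rel.δ n (x R.+ y) G̃.- Rel.δ n x) (Rel.δ n y))
             (B.∙-congʳ (VHom.-homo fromG̃ (Rel.δ n (x R.+ y)) (Rel.δ n x))) ⟩
      (f (Rel.δ n (x R.+ y)) B.- f (Rel.δ n x)) B.- f (Rel.δ n y)
        ≈⟨ B.∙-cong (B.∙-cong (fromδ n _) (B.⁻¹-cong (fromδ n x))) (B.⁻¹-cong (fromδ n y)) ⟩
      (B.V^ n (δ (x R.+ y)) B.- B.V^ n (δ x)) B.- B.V^ n (δ y)
        ≈⟨ B.∙-congʳ (B.∙-congʳ (B.trans (V^-cong B n (additive x y)) (V^-+ B n _ _))) ⟩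
      ((B.V^ n (δ x) B.+ B.V^ n (δ y)) B.- B.V^ n (δ x)) B.- B.V^ n (δ y)
        ≈⟨ prove (B.V^ n (δ x) ∷ B.V^ n (δ y) ∷ []) ((v0 ⊞ v1) ⊟ v0 ⊟ v1) nil ≡.refl ⟩
      B.0# ∎
      where
      f = VHom.⟦_⟧ fromG̃
      open ≈-Reasoning B.setoid
    fromRelation (Rel.odd n r) = B.trans (B.∙-congˡ (B.trans (V^-cong B n (teich-neg r)) (V^-neg B n _)))
      (B.inverseʳ _)

  -- Torsion freeness of `B` carries the vanishing on H over to its p-saturation. The ghost map is
  -- an instance of this map.
  fromΓ : VHom (G̃ / H̃) B
  fromΓ = quotientLift fromG̃ H̃ (saturation-kernel fromG̃ p torsion-free H (Span-kernel fromG̃ fromRelation))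

  module Completed (complete : IsVComplete B) where

    fromG⁰ : VHom G⁰ B
    fromG⁰ = completionLift fromΓ complete

    fromG : VHom G B
    fromG = quotientLift fromG⁰ T λ {x} → V-adic-Closure-kernel fromG⁰ complete
      (λ {x} → Torsion-kernel fromG⁰ p torsion-free {x}) {x}

    fromG-symbol : ∀ n r → VHom.⟦_⟧ fromG (symbol n r) B.≈ B.V^ n (teich r)
    fromG-symbol n r = completionLift-toCompletion fromΓ complete (v n r)

-- The ghost map on Γ

module GhostMap (A : CommutativeRing ℓ ℓ) {p : ℕ} (pr : Prime p) (p≢2 : p ≢ 2)
                (p·-zero : TorsionFree (CommutativeRing.+-abelianGroup A) p) where
  open CommutativeRing A hiding (zero)
  open RawMult +-rawMonoid using () renaming (_×_ to infixr 8 _·_)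
  open Exp semiring using (_^_; ^-congˡ; ^-assocʳ)
  open GroupMult +-abelianGroup using (·-cong; ·-∙; ·-ε)
  open GroupSolver +-abelianGroup using (prove)
  open X-construction p A
  private module 𝒮 = VGroup sequences
  open ≈-Reasoning setoid

  -^p : ∀ x → (- x) ^ p ≈ - (x ^ p)
  -^p x = let (h , e) = prime-odd pr p≢2 in
    ≡.subst (λ n → (- x) ^ n ≈ - (x ^ n)) (≡.sym e) (-‿^-odd A (suc h) x)

  0^p : 0# ^ p ≈ 0#
  0^p = let (q , e) = prime-≥2 pr in trans (reflexive (≡.cong (0# ^_) e)) (zeroˡ (0# ^ suc q))

  powers-suc : ∀ x i → powers x (suc i) ≈ powers (x ^ p) i
  powers-suc x i = sym (^-assocʳ x p (p ℕ.^ i))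

  powers-0 : ∀ i → powers 0# i ≈ 0#
  powers-0 zero    = *-identityʳ 0#
  powers-0 (suc i) = trans (powers-suc 0# i) (trans (^-congˡ (p ℕ.^ i) 0^p) (powers-0 i))

  powers-neg : ∀ x i → powers (- x) i ≈ - powers x i
  powers-neg x zero    = trans (*-identityʳ (- x)) (-‿cong (sym (*-identityʳ x)))
  powers-neg x (suc i) = trans (powers-suc (- x) i) (trans (^-congˡ (p ℕ.^ i) (-^p x))
    (trans (powers-neg (x ^ p) i) (-‿cong (sym (powers-suc x i)))))

  ·-pointwise : ∀ n b i → (n 𝒮.· b) i ≡ n · b i
  ·-pointwise zero    b i = ≡.refl
  ·-pointwise (suc n) b i = ≡.cong (λ y → b i + y) (·-pointwise n b i)

  δ : Carrier → 𝒮.Carrier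
  δ z = 𝒮.V (powers (z ^ p)) 𝒮.- p 𝒮.· powers z

  δ-zero : ∀ z → δ z 0 ≈ - (p · z)
  δ-zero z = trans (+-identityˡ _) (-‿cong (trans (reflexive (·-pointwise p (powers z) 0)) (·-cong p (*-identityʳ z))))

  δ-suc : ∀ z i → δ z (suc i) ≈ 0#
  δ-suc z i = trans (+-congˡ (-‿cong (trans (reflexive (·-pointwise p (powers z) (suc i))) (·-cong p (powers-suc z i)))))
    (-‿inverseʳ _)

  -- Only component 0 of `δ` is nonzero, because V⟨zᵖ⟩ and p⟨z⟩ agree in all later components, and
  -- component 0 is linear in `z`.
  δ-additive : ∀ x y → δ (x + y) 𝒮.≈ (δ x 𝒮.+ δ y)
  δ-additive x y zero = begin
    δ (x + y) 0             ≈⟨ δ-zero (x + y) ⟩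
    - (p · (x + y))         ≈⟨ -‿cong (·-∙ x y p) ⟩
    - (p · x + p · y)       ≈⟨ prove (p · x ∷ p · y ∷ []) (⊟ (v0 ⊞ v1)) (⊟ v0 ⊞ ⊟ v1) ≡.refl ⟩
    - (p · x) + - (p · y)   ≈⟨ +-cong (δ-zero x) (δ-zero y) ⟨
    δ x 0 + δ y 0           ∎
  δ-additive x y (suc i) = trans (δ-suc (x + y) i)
    (sym (trans (+-cong (δ-suc x i) (δ-suc y i)) (+-identityˡ 0#)))

  open G-construction p (CommutativeRing.ring A) using (G̃; H̃)
  private module Γ = VGroup (G̃ / H̃)

  private
    powersMap : TeichmüllerMap p (CommutativeRing.ring A) sequences
    powersMap = record
      { teich = powers ; teich-cong = powers-cong ; teich-0 = powers-0 ; teich-neg = powers-neg ; additive = δ-additive }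

    sequences-torsion-free : TorsionFree 𝒮.group p
    sequences-torsion-free b e i = p·-zero _ (trans (reflexive (≡.sym (·-pointwise p b i))) (e i))

  ghost : VHom (G̃ / H̃) sequences
  ghost = Extension.fromΓ p (CommutativeRing.ring A) sequences powersMap sequences-torsion-free

  V^-productTopology : ∀ n b → VSubgroup.mem (productTopology n) (𝒮.V^ n b)
  V^-productTopology (suc n) b zero    i<n = refl
  V^-productTopology (suc n) b (suc i) (ℕ.s≤s i<n) =
    trans (·-cong p (V^-productTopology n b i i<n)) (·-ε p)

  image-productTopology : ∀ n {b} → V^Image sequences n b → VSubgroup.mem (productTopology n) b
  image-productTopology n (image {y} e) i i<n = trans (e i) (V^-productTopology n y i i<n)

  ghost-image : ∀ n {u} → V^Image (G̃ / H̃) n u → VSubgroup.mem (productTopology n) (VHom.⟦_⟧ ghost u)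
  ghost-image n i = image-productTopology n (V-adic-map ghost n i)

idᵛ : (A : VGroup ℓ) → VHom A A
idᵛ A = record
  { hom    = mkGroupHom (VGroup.group A) (VGroup.group A) (λ x → x) (λ e → e) (λ _ _ → VGroup.refl A)
  ; V-homo = λ _ → VGroup.refl A }

projection : (A : VGroup ℓ) (P : VSubgroup A) → VHom A (A / P)
projection A P = record
  { hom    = mkGroupHom (VGroup.group A) (VGroup.group (A / P)) (λ x → x)
               (Quotient.≈⇒~ A P) (λ _ _ → VGroup.refl (A / P))
  ; V-homo = λ _ → VGroup.refl (A / P) }

quotient-· : (A : VGroup ℓ) (P : VSubgroup A) → ∀ n x → VGroup._·_ (A / P) n x ≡ VGroup._·_ A n x
quotient-· A P zero    x = ≡.refl
quotient-· A P (suc n) x = ≡.cong (VGroup._+_ A x) (quotient-· A P n x)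

module _ {A B : VGroup ℓ} (f : VHom A B) (g : VHom B A)
         (f∘g : ∀ y → VGroup._≈_ B (VHom.⟦_⟧ f (VHom.⟦_⟧ g y)) y) where
  private
    module A = VGroup A
    module B = VGroup B
    module f = VHom f
    module g = VHom g

    partialSum-map : ∀ y n → f.⟦ partialSum A (λ i → g.⟦ y i ⟧) n ⟧ B.≈ partialSum B y n
    partialSum-map y zero    = f.ε-homo
    partialSum-map y (suc n) = B.trans (f.∙-homo _ _)
      (B.∙-cong (partialSum-map y n) (B.trans (f.V^-homo n _) (V^-cong B n (f∘g (y n)))))

  -- The section `g` suffices: separatedness is pulled back along it, and series are lifted through
  -- it before taking the limit in `A`.
  isVComplete-iso : IsVComplete A → IsVComplete B
  isVComplete-iso complete = isVComplete B
    (λ x x∈ → B.trans (B.sym (f∘g x)) (B.trans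
      (f.⟦⟧-cong (VComplete.separated A complete g.⟦ x ⟧ λ n → V-adic-map g n (x∈ n))) f.ε-homo))
    (λ y → let (x , near) = VComplete.seriesConverge A complete (λ i → g.⟦ y i ⟧) in
      f.⟦ x ⟧ , λ n → VSubgroup.resp (V-adic B n)
        (B.trans (f.-homo x _) (B.∙-congˡ (B.⁻¹-cong (partialSum-map y n))))
        (V-adic-map f n (near n)))

completionUnit : (Γ : VGroup ℓ) → VHom Γ (completion Γ)
completionUnit Γ = record
  { hom    = mkGroupHom Γ.group (VGroup.group (completion Γ)) (toCompletion Γ)
               (λ e → coordinatewise λ n → Quotient.≈⇒~ Γ (V-adic Γ n) e)
               (λ _ _ → coordinatewise λ n → Quotient.≈⇒~ Γ (V-adic Γ n) Γ.refl)
  ; V-homo = λ _ → coordinatewise λ n → Quotient.≈⇒~ Γ (V-adic Γ n) Γ.refl }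
  where module Γ = VGroup Γ

-- Completeness, generation and torsion of G(R)

module GProperties (p : ℕ) (R : Ring ℓ ℓ) where
  private module R = Ring R
  open Exp R.semiring using (_^_)
  open G-construction p R
  private
    module Γ = VGroup (G̃ / H̃)
    module G⁰ = VGroup G⁰
    module ΓS = GroupSolver Γ.group

  G-isVComplete : IsVComplete G
  G-isVComplete = quotient-isVComplete G⁰ T (completion-isVComplete (G̃ / H̃))
    (Closure-idempotent G⁰ (Torsion G⁰ p))

  fromΓ : VHom (G̃ / H̃) G
  fromΓ = projection G⁰ T ∘ᵛ completionUnit (G̃ / H̃)

  symbol-near : ∀ x n → V^Image G n (x G.- VHom.⟦_⟧ fromΓ (Coherent.seq x n))
  symbol-near x n = image-quotient G⁰ T n (completion-near (G̃ / H̃) x n)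

  -- Modulo Vⁿ an element of `G` is the image of its n-th representative, a finite combination of
  -- symbols. Separatedness of `B` turns agreement modulo every Vⁿ into equality.
  G-ext : {B : VGroup ℓ} → IsVComplete B → (f g : VHom G B) →
          (∀ n r → VGroup._≈_ B (VHom.⟦_⟧ f (symbol n r)) (VHom.⟦_⟧ g (symbol n r))) →
          ∀ x → VGroup._≈_ B (VHom.⟦_⟧ f x) (VHom.⟦_⟧ g x)
  G-ext {B} complete f g e x = VComplete.≈-limit B complete λ n →
      VSubgroup.resp (V-adic B n)
        (B.trans (B.∙-cong (f.-homo x (s n)) (B.⁻¹-cong (B.trans (g.-homo x (s n)) (B.∙-congˡ (B.⁻¹-cong (B.sym (agree (seq x n))))))))
          (prove (f.⟦ x ⟧ ∷ f.⟦ s n ⟧ ∷ g.⟦ x ⟧ ∷ []) ((v0 ⊟ v1) ⊟ (v2 ⊟ v1)) (v0 ⊟ v2) ≡.refl))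
        (∸-mem B (V-adic B n) (V-adic-map f n (symbol-near x n)) (V-adic-map g n (symbol-near x n)))
    where
    module B = VGroup B
    module f = VHom f
    module g = VHom g
    open GroupSolver B.group using (prove)
    open Coherent
    s : ℕ → G.Carrier
    s n = VHom.⟦_⟧ fromΓ (seq x n)

    restrict-free : VHom G B → GroupHom F.freeAbelianGroup B.group
    restrict-free f = mkGroupHom F.freeAbelianGroup B.group (λ u → VHom.⟦_⟧ f (VHom.⟦_⟧ fromΓ u))
      (λ {u} {w} e → VHom.⟦⟧-cong f (G-≈ {VHom.⟦_⟧ fromΓ u} {VHom.⟦_⟧ fromΓ w} λ _ → e))
      (λ u w → B.trans (VHom.⟦⟧-cong f (VHom.∙-homo fromΓ u w)) (VHom.∙-homo f _ _))

    agree : ∀ u → f.⟦ VHom.⟦_⟧ fromΓ u ⟧ B.≈ g.⟦ VHom.⟦_⟧ fromΓ u ⟧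
    agree = freeGroup-ext B.group (restrict-free f) (restrict-free g) λ (n , r) → e n r

  H⇒Γ : ∀ {u} → u ∈ Span G̃ (Relations.Relation p R G̃ v) → u Γ.≈ Γ.0#
  H⇒Γ {u} m = congruent (0 , VSubgroup.resp H (G̃.sym (Quotient.≈⇒~ freeVGroup zeroSymbols
    (GroupSolver.prove F.freeAbelianGroup (u ∷ []) ((v0 ⊟ nil) ⊞ nil) v0 ≡.refl))) m)

  v-0 : ∀ n → v n R.0# Γ.≈ Γ.0#
  v-0 n = Quotient.≈⇒~ G̃ H̃ (congruent (resp
    (GroupSolver.prove F.freeAbelianGroup (v n R.0# ∷ []) v0 (v0 ⊟ nil) ≡.refl) (gen (zeroSymbol n))))

  v-neg : ∀ n r → v n (R.- r) Γ.≈ Γ.- v n r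
  v-neg n r = Γ.inverseʳ-unique _ _ (H⇒Γ (gen (Relations.odd n r)))

  δΓ : R.Carrier → Γ.Carrier
  δΓ x = v 1 (x ^ p) Γ.- p Γ.· v 0 x

  δΓ-additive : ∀ x y → δΓ (x R.+ y) Γ.≈ δΓ x Γ.+ δΓ y
  δΓ-additive x y = begin
    δΓ (x R.+ y)
      ≈⟨ ΓS.prove (δΓ (x R.+ y) ∷ δΓ x ∷ δΓ y ∷ []) v0 (((v0 ⊟ v1) ⊟ v2) ⊞ (v1 ⊞ v2)) ≡.refl ⟩
    ((δΓ (x R.+ y) Γ.- δΓ x) Γ.- δΓ y) Γ.+ (δΓ x Γ.+ δΓ y)
      ≡⟨ ≡.cong₂ (λ a b → ((a Γ.- b) Γ.- δΓ y) Γ.+ (δΓ x Γ.+ δΓ y)) (δ≡ (x R.+ y)) (δ≡ x) ⟩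
    ((δ (x R.+ y) Γ.- δ x) Γ.- δΓ y) Γ.+ (δΓ x Γ.+ δΓ y)
      ≡⟨ ≡.cong (λ b → ((δ (x R.+ y) Γ.- δ x) Γ.- b) Γ.+ (δΓ x Γ.+ δΓ y)) (δ≡ y) ⟩
    ((δ (x R.+ y) Γ.- δ x) Γ.- δ y) Γ.+ (δΓ x Γ.+ δΓ y)
      ≈⟨ Γ.∙-congʳ (H⇒Γ (gen (Relations.additive 0 x y))) ⟩
    Γ.0# Γ.+ (δΓ x Γ.+ δΓ y)
      ≈⟨ Γ.identityˡ _ ⟩
    δΓ x Γ.+ δΓ y ∎
    where
    open ≈-Reasoning Γ.setoid
    δ = Relations.δ p R G̃ v 0
    δ≡ : ∀ x → δΓ x ≡ δ x
    δ≡ x = ≡.cong (λ y → v 1 (x ^ p) Γ.- y) (quotient-· G̃ H̃ p (v 0 x))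

  V^-v : ∀ n r → Γ.V^ n (v 0 r) ≡ v n r
  V^-v zero    r = ≡.refl
  V^-v (suc n) r = ≡.cong Γ.V (V^-v n r)

  module _ (Γ-divide : ∀ n u → V^Image (G̃ / H̃) (suc n) (p Γ.· u) → V^Image (G̃ / H̃) n u) where

    private
      seq-· : ∀ n x k → Coherent.seq (n G⁰.· x) k ≡ n Γ.· Coherent.seq x k
      seq-· zero    x k = ≡.refl
      seq-· (suc n) x k = ≡.cong (Γ._+_ (Coherent.seq x k)) (seq-· n x k)

    -- The power of V lost in `Γ-divide` is regained by applying it to the coordinate of index n +
    -- 1, which agrees with that of index n modulo Vⁿ.
    G⁰-torsion-free : TorsionFree G⁰.group p
    G⁰-torsion-free x (coordinatewise e) = completion-separated (G̃ / H̃) x λ n →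
      seq-completion-image (G̃ / H̃) n {x} (VSubgroup.resp (V-adic (G̃ / H̃) n)
        (ΓS.prove (seq (suc n) ∷ seq n ∷ []) (v0 ⊟ (v0 ⊟ v1)) v1 ≡.refl)
        (∸-mem (G̃ / H̃) (V-adic (G̃ / H̃) n)
          (Γ-divide n (seq (suc n)) (VSubgroup.resp (V-adic (G̃ / H̃) (suc n))
            (Γ.trans (ΓS.prove (Coherent.seq (p G⁰.· x) (suc n) ∷ []) (v0 ⊟ nil) v0 ≡.refl) (Γ.reflexive (seq-· p x (suc n))))
            (Quotient._~_.difference (e (suc n)))))
          (Quotient._~_.difference (coherent n))))
      where open Coherent x

    T-trivial : ∀ {x} → VSubgroup.mem T x → x G⁰.≈ G⁰.0#
    T-trivial {x} = V-adic-Closure-kernel (idᵛ G⁰) (completion-isVComplete (G̃ / H̃))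
      (λ {x} → Torsion-kernel (idᵛ G⁰) p G⁰-torsion-free {x}) {x}

    G-torsion-free : TorsionFree G.group p
    G-torsion-free x (congruent m) = Quotient.≈⇒~ G⁰ T (G⁰-torsion-free x
      (G⁰.trans (G⁰.reflexive (≡.sym (quotient-· G⁰ T p x)))
        (G⁰.x∙y⁻¹≈ε⇒x≈y _ _ (T-trivial {(p G.· x) G⁰.- G⁰.0#} m))))

-- p-torsion in G(ℤ[S])

module GammaTorsion (S : Setoid ℓ ℓ) {p : ℕ} (pr : Prime p) (p≢2 : p ≢ 2) where
  private
    module A = CommutativeRing ℤ[ S ]
    module AP = PolynomialRing S pr p≢2
    module AG = GhostMap ℤ[ S ] pr p≢2 AP.p·-zero
  open Exp A.semiring using (_^_; ^-congˡ)
  open G-construction p A.ring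
  open F using (⟦_⟧; 𝟘; _⊕_; ⊖_; Formal; _≋_; ≋-refl; ≋-sym; ≋-trans; ⊕-cong; ⊖-cong; ⟦⟧-cong;
                ⊕-assoc; ⊕-identityˡ; lift; lift-cong; freeAbelianGroup)
  private
    module VF = VGroup freeVGroup
    module Γ = VGroup (G̃ / H̃)
    module FP = FreeProperties Symbol
    module X = X-construction p ℤ[ S ]
    module 𝒮 = VGroup X.sequences
    module ghost = VHom AG.ghost
    module GS = GroupSolver VF.group
    module ΓS = GroupSolver Γ.group
  open VF using (V; V^; V-cong; _-_; _·_)
  open GroupMult freeAbelianGroup

  F⇒Γ : ∀ {u w} → u ≋ w → u Γ.≈ w
  F⇒Γ e = Quotient.≈⇒~ G̃ H̃ (Quotient.≈⇒~ freeVGroup zeroSymbols e)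

  open GProperties p A.ring using (H⇒Γ; v-0; δΓ; δΓ-additive)

  private
    G̃-· : ∀ n u → n G̃.· u ≡ n · u
    G̃-· = quotient-· freeVGroup zeroSymbols

    Γ-· : ∀ n u → n Γ.· u ≡ n · u
    Γ-· n u = ≡.trans (quotient-· G̃ H̃ n u) (G̃-· n u)

  Γ-symbol-0 : ∀ n {r} → r A.≈ A.0# → ⟦ n , r ⟧ Γ.≈ 𝟘
  Γ-symbol-0 n e = Γ.trans (F⇒Γ (⟦⟧-cong (≡.refl , e))) (v-0 n)

  private
    End : Set _
    End = GroupHom freeAbelianGroup freeAbelianGroup

    app : End → Formal → Formal
    app = GroupHomomorphism.⟦_⟧

    induced : (k : Setoid.Carrier Symbol → Formal) → Congruent (Setoid._≈_ Symbol) _≋_ k → End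
    induced k k-cong = mkGroupHom freeAbelianGroup freeAbelianGroup (lift freeAbelianGroup k)
      (lift-cong freeAbelianGroup k-cong) (λ _ _ → ≋-refl)

    ext : (f g : End) → (∀ s → app f ⟦ s ⟧ ≋ app g ⟦ s ⟧) → ∀ u → app f u ≋ app g u
    ext = freeGroup-ext freeAbelianGroup

    infixr 9 _∘ᵉ_
    _∘ᵉ_ : End → End → End
    _∘ᵉ_ = _∘ᵍ_ {A = freeAbelianGroup} {B = freeAbelianGroup} {C = freeAbelianGroup}

    -- The map ι embeds freeVGroup modulo the symbols Vⁿᵣ + Vⁿ₋ᵣ into freeVGroup,
    -- and u = h u + V (t u) with h u supported on the symbols V⁰ᵣ.
    idᵉ Vᵉ φᵉ ιᵉ hᵉ tᵉ : End
    idᵉ = mkGroupHom freeAbelianGroup freeAbelianGroup (λ u → u) (λ e → e) (λ _ _ → ≋-refl)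
    Vᵉ = VGroup.endo freeVGroup

    power negate : Func Symbol Symbol
    power = record { to = λ (n , r) → n , r ^ p ; cong = λ (e , e′) → e , ^-congˡ p e′ }
    negate = record { to = λ (n , r) → n , A.- r ; cong = λ (e , e′) → e , A.-‿cong e′ }

    negate-involutive : ∀ s → Setoid._≈_ Symbol (Func.to negate (Func.to negate s)) s
    negate-involutive (n , r) = ≡.refl , RingProperties.-‿involutive A.ring r

    φᵉ = induced (⟦_⟧ ∘ Func.to power) (λ e → ⟦⟧-cong (Func.cong power e))

    ιᵉ = induced (antisymmetrize Symbol negate negate-involutive)
      (λ e → ⊕-cong (⟦⟧-cong e) (⊖-cong (⟦⟧-cong (Func.cong negate e))))

    hᵉ = induced (λ { (zero , r) → ⟦ zero , r ⟧ ; (suc n , r) → 𝟘 })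
      λ { {zero , _} (≡.refl , e) → ⟦⟧-cong (≡.refl , e) ; {suc n , _} (≡.refl , e) → ≋-refl }
    tᵉ = induced (λ { (zero , r) → 𝟘 ; (suc n , r) → ⟦ n , r ⟧ })
      λ { {zero , _} (≡.refl , e) → ≋-refl ; {suc n , _} (≡.refl , e) → ⟦⟧-cong (≡.refl , e) }

    φ ι h t : Formal → Formal
    φ = app φᵉ
    ι = app ιᵉ
    h = app hᵉ
    t = app tᵉ

    module φ where
      open GroupHomomorphism φᵉ public
      open GroupHomProperties {A = freeAbelianGroup} {B = freeAbelianGroup} φᵉ public
    module ι where
      open GroupHomomorphism ιᵉ public
      open GroupHomProperties {A = freeAbelianGroup} {B = freeAbelianGroup} ιᵉ public
    module h where
      open GroupHomomorphism hᵉ public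
      open GroupHomProperties {A = freeAbelianGroup} {B = freeAbelianGroup} hᵉ public
    module t where
      open GroupHomomorphism tᵉ public
      open GroupHomProperties {A = freeAbelianGroup} {B = freeAbelianGroup} tᵉ public

    ι-V : ∀ u → ι (V u) ≋ V (ι u)
    ι-V = ext (ιᵉ ∘ᵉ Vᵉ) (Vᵉ ∘ᵉ ιᵉ) λ _ → ≋-refl

    ι-V^ : ∀ n u → ι (V^ n u) ≋ V^ n (ι u)
    ι-V^ zero    u = ≋-refl
    ι-V^ (suc n) u = ≋-trans (ι-V (V^ n u)) (V-cong (ι-V^ n u))

    φ-V : ∀ u → φ (V u) ≋ V (φ u)
    φ-V = ext (φᵉ ∘ᵉ Vᵉ) (Vᵉ ∘ᵉ φᵉ) λ _ → ≋-refl

    ι-φ : ∀ u → ι (φ u) ≋ φ (ι u)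
    ι-φ = ext (ιᵉ ∘ᵉ φᵉ) (φᵉ ∘ᵉ ιᵉ) λ (n , r) →
      ⊕-cong ≋-refl (⊖-cong (⟦⟧-cong (≡.refl , A.sym (AG.-^p r))))

    h-ι : ∀ u → h (ι u) ≋ ι (h u)
    h-ι = ext (hᵉ ∘ᵉ ιᵉ) (ιᵉ ∘ᵉ hᵉ) λ { (zero , r) → ≋-refl ; (suc n , r) → ⊕-inverseʳ 𝟘 }
      where ⊕-inverseʳ = AbelianGroup.inverseʳ freeAbelianGroup

    t-ι : ∀ u → t (ι u) ≋ ι (t u)
    t-ι = ext (tᵉ ∘ᵉ ιᵉ) (ιᵉ ∘ᵉ tᵉ) λ { (zero , r) → ⊕-inverseʳ 𝟘 ; (suc n , r) → ≋-refl }
      where ⊕-inverseʳ = AbelianGroup.inverseʳ freeAbelianGroup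

    h-φ : ∀ u → h (φ u) ≋ φ (h u)
    h-φ = ext (hᵉ ∘ᵉ φᵉ) (φᵉ ∘ᵉ hᵉ) λ { (zero , r) → ≋-refl ; (suc n , r) → ≋-refl }

    t-φ : ∀ u → t (φ u) ≋ φ (t u)
    t-φ = ext (tᵉ ∘ᵉ φᵉ) (φᵉ ∘ᵉ tᵉ) λ { (zero , r) → ≋-refl ; (suc n , r) → ≋-refl }

    t-V : ∀ u → t (V u) ≋ u
    t-V = ext (tᵉ ∘ᵉ Vᵉ) idᵉ λ _ → ≋-refl

    h-V : ∀ u → h (V u) ≋ 𝟘
    h-V = ext (hᵉ ∘ᵉ Vᵉ)
      (mkGroupHom freeAbelianGroup freeAbelianGroup (λ _ → 𝟘) (λ _ → ≋-refl) (λ _ _ → ≋-sym (⊕-identityˡ 𝟘)))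
      λ _ → ≋-refl

    head-tail : ∀ u → u ≋ h u ⊕ V (t u)
    head-tail = ext idᵉ (mkGroupHom freeAbelianGroup freeAbelianGroup (λ u → h u ⊕ V (t u))
        (λ e → ⊕-cong (h.⟦⟧-cong e) (V-cong (t.⟦⟧-cong e)))
        (λ u w → GS.prove (h u ∷ h w ∷ V (t u) ∷ V (t w) ∷ [])
          ((v0 ⊞ v1) ⊞ (v2 ⊞ v3)) ((v0 ⊞ v2) ⊞ (v1 ⊞ v3)) ≡.refl))
      λ { (zero , r) → ≋-sym (VF.identityʳ _) ; (suc n , r) → ≋-sym (⊕-identityˡ _) }

    ι-ι : ∀ u → ι (ι u) ≋ ι u ⊕ ι u
    ι-ι = ext (ιᵉ ∘ᵉ ιᵉ) (mkGroupHom freeAbelianGroup freeAbelianGroup (λ u → ι u ⊕ ι u)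
        (λ e → ⊕-cong (ι.⟦⟧-cong e) (ι.⟦⟧-cong e))
        (λ u w → GS.prove (ι u ∷ ι w ∷ []) ((v0 ⊞ v1) ⊞ (v0 ⊞ v1)) ((v0 ⊞ v0) ⊞ (v1 ⊞ v1)) ≡.refl))
      λ s → ≋-trans (⊕-cong ≋-refl (⊖-cong (⊕-cong ≋-refl (⊖-cong (⟦⟧-cong (negate-involutive s))))))
        (GS.prove (⟦ s ⟧ ∷ ⟦ Func.to negate s ⟧ ∷ [])
          ((v0 ⊟ v1) ⊟ (v1 ⊟ v0)) ((v0 ⊟ v1) ⊞ (v0 ⊟ v1)) ≡.refl)

    F-torsion-free : ∀ {x y} → p · x ≋ p · y → x ≋ y
    F-torsion-free {x} {y} e = let (n , p≡) = prime-≥2 pr in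
      FP.·-injective (suc n) (≡.subst (λ k → k · x ≋ k · y) p≡ e)

    -- From ι u = p k one gets p (u - e k) = u up to ι for p = 1 + 2 e, because
    -- ι (ι u) = 2 ι u.
    φι-divisible : ∀ {u k} → φ (ι u) ≋ p · k → ∃[ w ] ι u ≋ p · ι w
    φι-divisible {u} {k} q = u - (e · k′) , ≋-sym (begin
      p · ι (u - (e · k′))
        ≈⟨ ·-cong p (≋-trans (ι.-homo u (e · k′)) (⊕-cong ≋-refl (⊖-cong (ι.×-homo e k′)))) ⟩
      p · (ι u - (e · ι k′))           ≈⟨ ·-- p (ι u) (e · ι k′) ⟩
      p · ι u - p · e · ι k′           ≈⟨ ⊕-cong ≋-refl (⊖-cong (·-comm p e (ι k′))) ⟩
      p · ι u - e · p · ι k′           ≈⟨ ⊕-cong ≋-refl (⊖-cong (·-cong e (ι.×-homo p k′))) ⟨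
      p · ι u - e · ι (p · k′)         ≈⟨ ⊕-cong ≋-refl (⊖-cong (·-cong e (ι.⟦⟧-cong ιu))) ⟨
      p · ι u - e · ι (ι u)            ≈⟨ ⊕-cong ≋-refl (⊖-cong (·-cong e (≋-trans (ι-ι u) (⊕-cong ≋-refl (≋-sym (VF.identityʳ _)))))) ⟩
      p · ι u - e · 2 · ι u            ≈⟨ ⊕-cong (·-≡ (ι u) p≡) (⊖-cong (·-assoc (ι u) e 2)) ⟩
      suc (e ℕ.* 2) · ι u - (e ℕ.* 2) · ι u
        ≈⟨ GS.prove (ι u ∷ ((e ℕ.* 2) · ι u) ∷ []) ((v0 ⊞ v1) ⊟ v1) v0 ≡.refl ⟩
      ι u                              ∎)
      where
      open ≈-Reasoning VF.setoid
      e = suc (proj₁ (prime-odd pr p≢2))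
      p≡ : p ≡ suc (e ℕ.* 2)
      p≡ = proj₂ (prime-odd pr p≢2)
      divided : ∃[ k′ ] ι u ≋ suc (e ℕ.* 2) · k′
      divided = freeMap-divisible power (λ (e , e′) → e , AP.^p-injective e′) (e ℕ.* 2)
        (≋-trans q (·-≡ k p≡))
      k′ = proj₁ divided
      ιu : ι u ≋ p · k′
      ιu = ≋-trans (proj₂ divided) (·-≡ k′ (≡.sym p≡))

    Δ : Formal → Formal
    Δ u = V (φ u) - (p · u)

    Δᵉ : End
    Δᵉ = mkGroupHom freeAbelianGroup freeAbelianGroup Δ
      (λ e → ⊕-cong (V-cong (φ.⟦⟧-cong e)) (⊖-cong (·-cong p e)))
      (λ u w → ≋-trans (⊕-cong ≋-refl (⊖-cong (·-∙ u w p)))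
        (GS.prove (V (φ u) ∷ V (φ w) ∷ p · u ∷ p · w ∷ [])
          ((v0 ⊞ v1) ⊟ (v2 ⊞ v3)) ((v0 ⊟ v2) ⊞ (v1 ⊟ v3)) ≡.refl))

    module Δ where
      open GroupHomomorphism Δᵉ public
      open GroupHomProperties {A = freeAbelianGroup} {B = freeAbelianGroup} Δᵉ public

    Δ-ι : ∀ u → ι (Δ u) ≋ Δ (ι u)
    Δ-ι u = ≋-trans (ι.-homo (V (φ u)) (p · u))
      (⊕-cong (≋-trans (ι-V (φ u)) (V-cong (ι-φ u))) (⊖-cong (ι.×-homo p u)))

    Δ-V : ∀ u → Δ (V u) ≋ V (Δ u)
    Δ-V u = ≋-trans (⊕-cong (V-cong (φ-V u)) (⊖-cong (≋-sym (VF.V-· p u)))) (≋-sym (VF.V-- (V (φ u)) (p · u)))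

    Δ-V^ : ∀ n u → Δ (V^ n u) ≋ V^ n (Δ u)
    Δ-V^ zero    u = ≋-refl
    Δ-V^ (suc n) u = ≋-trans (Δ-V (V^ n u)) (V-cong (Δ-V^ n u))

    ιᵛ : VHom G̃ freeVGroup
    ιᵛ = quotientLift {A = freeVGroup} {B = freeVGroup} (record { hom = ιᵉ ; V-homo = ι-V }) zeroSymbols
      (Span-kernel {A = freeVGroup} {B = freeVGroup} (record { hom = ιᵉ ; V-homo = ι-V })
        λ { (zeroSymbol n) → ≋-trans (⊕-cong ≋-refl (⊖-cong (⟦⟧-cong (≡.refl , RingProperties.-0#≈0# A.ring))))
              (VF.inverseʳ ⟦ n , A.0# ⟧) })

    ι-relation : ∀ {u} → u ∈ Span G̃ (Relations.Relation p A.ring G̃ v) → ∃[ g ] ι u ≋ Δ (ι g)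
    ι-relation (gen (Relations.additive n x y)) = g ,
      ≋-trans (ι.⟦⟧-cong (≋-trans (⊕-cong (⊕-cong (δ≋Δ (x A.+ y)) (⊖-cong (δ≋Δ x))) (⊖-cong (δ≋Δ y))) (≋-sym Δg))) (Δ-ι g)
      where
      δ≋Δ : ∀ x → Relations.δ p A.ring G̃ v n x ≋ Δ ⟦ n , x ⟧
      δ≋Δ x = ⊕-cong ≋-refl (⊖-cong (VF.reflexive (G̃-· p ⟦ n , x ⟧)))
      g : Formal
      g = (⟦ n , x A.+ y ⟧ - ⟦ n , x ⟧) - ⟦ n , y ⟧
      Δg : Δ g ≋ (Δ ⟦ n , x A.+ y ⟧ - Δ ⟦ n , x ⟧) - Δ ⟦ n , y ⟧
      Δg = ≋-trans (Δ.-homo (⟦ n , x A.+ y ⟧ - ⟦ n , x ⟧) ⟦ n , y ⟧)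
        (⊕-cong (Δ.-homo ⟦ n , x A.+ y ⟧ ⟦ n , x ⟧) ≋-refl)
    ι-relation (gen (Relations.odd n r)) = 𝟘 , ≋-trans
      (⊕-cong ≋-refl (⊕-cong ≋-refl (⊖-cong (⟦⟧-cong (negate-involutive (n , r))))))
      (≋-trans (GS.prove (⟦ n , r ⟧ ∷ ⟦ n , A.- r ⟧ ∷ []) ((v0 ⊟ v1) ⊞ (v1 ⊟ v0)) nil ≡.refl)
        (≋-sym Δ.ε-homo))
    ι-relation (resp e m) = let (g , e′) = ι-relation m in
      g , ≋-trans (VHom.⟦⟧-cong ιᵛ (G̃.sym e)) e′
    ι-relation zer = 𝟘 , ≋-sym Δ.ε-homo
    ι-relation (add m m′) = let (g , e) = ι-relation m ; (g′ , e′) = ι-relation m′ in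
      g ⊕ g′ , ≋-trans (⊕-cong e e′) (≋-sym (Δ.homo (ι g) (ι g′)))
    ι-relation (neg m) = let (g , e) = ι-relation m in
      ⊖ g , ≋-trans (⊖-cong e) (≋-sym (Δ.⁻¹-homo (ι g)))

    -- This disposes of the saturation in H̃. If `Δ (ι g)` is divisible by p, then so is
    -- `V (φ (ι g))`, hence `ι g` by injectivity of φ modulo p, and one factor p cancels.
    Δι-saturated : ∀ k {u g} → (p ℕ.^ k) · ι u ≋ Δ (ι g) → ∃[ g′ ] ι u ≋ Δ (ι g′)
    Δι-saturated zero    {u} {g} e = g , ≋-trans (≋-sym (VF.identityʳ _)) e
    Δι-saturated (suc k) {u} {g} e = Δι-saturated k {u} {proj₁ divided} (F-torsion-free (begin
      p · (p ℕ.^ k) · ι u     ≈⟨ ·-assoc (ι u) p (p ℕ.^ k) ⟩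
      (p ℕ.^ suc k) · ι u     ≈⟨ e ⟩
      Δ (ι g)                 ≈⟨ Δ.⟦⟧-cong (proj₂ divided) ⟩
      Δ (p · ι g′)            ≈⟨ Δ.×-homo p (ι g′) ⟩
      p · Δ (ι g′)            ∎))
      where
      open ≈-Reasoning VF.setoid
      y = (p ℕ.^ k) · ι u
      Vφ : V (φ (ι g)) ≋ p · (y ⊕ ι g)
      Vφ = begin
        V (φ (ι g))             ≈⟨ GS.prove (V (φ (ι g)) ∷ p · ι g ∷ []) v0 ((v0 ⊟ v1) ⊞ v1) ≡.refl ⟩
        Δ (ι g) ⊕ p · ι g       ≈⟨ ⊕-cong (≋-trans (≋-sym e) (≋-sym (·-assoc (ι u) p (p ℕ.^ k)))) ≋-refl ⟩
        p · y ⊕ p · ι g         ≈⟨ ·-∙ y (ι g) p ⟨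
        p · (y ⊕ ι g)           ∎
      divided : ∃[ g′ ] ι g ≋ p · ι g′
      divided = φι-divisible {g} {t (y ⊕ ι g)} (begin
        φ (ι g)                 ≈⟨ t-V _ ⟨
        t (V (φ (ι g)))         ≈⟨ t.⟦⟧-cong Vφ ⟩
        t (p · (y ⊕ ι g))       ≈⟨ t.×-homo p (y ⊕ ι g) ⟩
        p · t (y ⊕ ι g)         ∎)
      g′ = proj₁ divided

    -- In degrees below n the term `V^ n w` is invisible, so φ (ι g) is divisible by p there. The
    -- degrees are treated one at a time: `h` isolates the lowest and `t` shifts the others down.
    divisible-below : ∀ n x g w → p · x ≋ φ (ι g) ⊕ V^ n w →
                      ∃[ g′ ] ∃[ g″ ] ι g ≋ p · ι g′ ⊕ V^ n (ι g″)
    divisible-below zero    x g w e = 𝟘 , g , ≋-sym (≋-trans (⊕-cong (·-ε p) ≋-refl) (⊕-identityˡ (ι g)))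
    divisible-below (suc n) x g w e = g₀ ⊕ V g₁ , g₂ , (begin
      ι g                                      ≈⟨ ι.⟦⟧-cong (head-tail g) ⟩
      ι (h g) ⊕ ι (V (t g))                    ≈⟨ ⊕-cong (proj₂ head) (ι-V (t g)) ⟩
      p · ι g₀ ⊕ V (ι (t g))                   ≈⟨ ⊕-cong ≋-refl (V-cong (proj₂ (proj₂ tail))) ⟩
      p · ι g₀ ⊕ V (p · ι g₁ ⊕ V^ n (ι g₂))    ≈⟨ ⊕-assoc (p · ι g₀) _ _ ⟨
      p · ι g₀ ⊕ V (p · ι g₁) ⊕ V^ (suc n) (ι g₂)
        ≈⟨ ⊕-cong (⊕-cong ≋-refl (≋-trans (VF.V-· p (ι g₁)) (·-cong p (≋-sym (ι-V g₁))))) ≋-refl ⟩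
      p · ι g₀ ⊕ p · ι (V g₁) ⊕ V^ (suc n) (ι g₂)
        ≈⟨ ⊕-cong (·-∙ (ι g₀) (ι (V g₁)) p) ≋-refl ⟨
      p · ι (g₀ ⊕ V g₁) ⊕ V^ (suc n) (ι g₂)    ∎)
      where
      open ≈-Reasoning VF.setoid
      head : ∃[ g₀ ] ι (h g) ≋ p · ι g₀
      head = φι-divisible {h g} {h x} (begin
        φ (ι (h g))                     ≈⟨ φ.⟦⟧-cong (h-ι g) ⟨
        φ (h (ι g))                     ≈⟨ h-φ (ι g) ⟨
        h (φ (ι g))                     ≈⟨ VF.identityʳ _ ⟨
        h (φ (ι g)) ⊕ 𝟘                 ≈⟨ ⊕-cong ≋-refl (h-V (V^ n w)) ⟨
        h (φ (ι g) ⊕ V^ (suc n) w)      ≈⟨ h.⟦⟧-cong e ⟨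
        h (p · x)                       ≈⟨ h.×-homo p x ⟩
        p · h x                         ∎)
      tail : ∃[ g₁ ] ∃[ g₂ ] ι (t g) ≋ p · ι g₁ ⊕ V^ n (ι g₂)
      tail = divisible-below n (t x) (t g) w (begin
        p · t x                         ≈⟨ t.×-homo p x ⟨
        t (p · x)                       ≈⟨ t.⟦⟧-cong e ⟩
        t (φ (ι g)) ⊕ t (V^ (suc n) w)  ≈⟨ ⊕-cong (≋-trans (t-φ (ι g)) (φ.⟦⟧-cong (t-ι g))) (t-V (V^ n w)) ⟩
        φ (ι (t g)) ⊕ V^ n w            ∎)
      g₀ = proj₁ head
      g₁ = proj₁ tail
      g₂ = proj₁ (proj₂ tail)

    -- The components of `x` in degrees below n are killed by p and vanish, the group being free.
    V^-saturated : ∀ n x y → p · x ≋ V^ n y → ∃[ y′ ] x ≋ V^ n y′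
    V^-saturated zero    x y e = x , ≋-refl
    V^-saturated (suc n) x y e = y′ , (begin
      x                    ≈⟨ head-tail x ⟩
      h x ⊕ V (t x)        ≈⟨ ⊕-cong hx (V-cong (proj₂ tail)) ⟩
      𝟘 ⊕ V^ (suc n) y′    ≈⟨ ⊕-identityˡ _ ⟩
      V^ (suc n) y′        ∎)
      where
      open ≈-Reasoning VF.setoid
      hx : h x ≋ 𝟘
      hx = F-torsion-free (begin
        p · h x            ≈⟨ h.×-homo p x ⟨
        h (p · x)          ≈⟨ h.⟦⟧-cong e ⟩
        h (V^ (suc n) y)   ≈⟨ h-V (V^ n y) ⟩
        𝟘                  ≈⟨ ·-ε p ⟨
        p · 𝟘              ∎)
      tail : ∃[ y′ ] t x ≋ V^ n y′
      tail = V^-saturated n (t x) y (begin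
        p · t x            ≈⟨ t.×-homo p x ⟨
        t (p · x)          ≈⟨ t.⟦⟧-cong e ⟩
        t (V^ (suc n) y)   ≈⟨ t-V (V^ n y) ⟩
        V^ n y             ∎)
      y′ = proj₁ tail

    -- Pairs of symbols vanish by the odd relations. A symbol fixed by negation has 2 r = 0, so r =
    -- 0 because ℤ[S] has no 2-torsion, and Vⁿ₀ is zero; the argument 1 of `·-injective` encodes the
    -- factor 2.
    ι-kernel : ∀ u → ι u ≋ 𝟘 → u Γ.≈ 𝟘
    ι-kernel = antisymmetrize-kernel Symbol negate negate-involutive Γ.group
        (mkGroupHom freeAbelianGroup Γ.group (λ u → u) F⇒Γ (λ _ _ → Γ.refl))
        (λ (n , r) → H⇒Γ (gen (Relations.odd n r)))
        (λ { {n , r} (_ , e) → Γ-symbol-0 n (fixed-zero r e) })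
      where
      fixed-zero : ∀ r → A.- r A.≈ r → r A.≈ A.0#
      fixed-zero r e = FreeProperties.·-injective _ 1 (A.trans (A.+-congˡ (A.+-identityʳ r))
        (A.trans (A.+-congʳ (A.sym e)) (A.trans (A.-‿inverseˡ r) (A.sym (GroupMult.·-ε A.+-abelianGroup 2)))))

    Γ-image : ℕ → Formal → Set _
    Γ-image = V^Image (G̃ / H̃)

    Γ-V^ : ∀ n u → Γ.V^ n u ≡ V^ n u
    Γ-V^ zero    u = ≡.refl
    Γ-V^ (suc n) u = ≡.cong V (Γ-V^ n u)

    image-step : ∀ n {u w} → u Γ.≈ V w → Γ-image n w → Γ-image (suc n) u
    image-step n e (image e′) = image (Γ.trans e (Γ.V-cong e′))

    -- Divisibility upstairs kills the head of `ι u`. The head of `u` is then in the kernel of `ι`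
    -- and disappears in Γ, so that a factor V can be taken out.
    ι-image : ∀ n u y → ι u ≋ V^ n y → Γ-image n u
    ι-image zero    u y e = image Γ.refl
    ι-image (suc n) u y e = image-step n {u} {t u}
      (Γ.trans (F⇒Γ (head-tail u)) (Γ.trans (Γ.∙-congʳ (ι-kernel (h u) hu)) (Γ.identityˡ (V (t u)))))
      (ι-image n (t u) y (begin
        ι (t u)             ≈⟨ t-ι u ⟨
        t (ι u)             ≈⟨ t.⟦⟧-cong e ⟩
        t (V^ (suc n) y)    ≈⟨ t-V (V^ n y) ⟩
        V^ n y              ∎))
      where
      open ≈-Reasoning VF.setoid
      hu : ι (h u) ≋ 𝟘
      hu = begin
        ι (h u)             ≈⟨ h-ι u ⟨
        h (ι u)             ≈⟨ h.⟦⟧-cong e ⟩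
        h (V^ (suc n) y)    ≈⟨ h-V (V^ n y) ⟩
        𝟘                   ∎

    Δ-symbol-0 : ∀ {r} → r A.≈ A.0# → Δ ⟦ 0 , r ⟧ Γ.≈ 𝟘
    Δ-symbol-0 {r} e = Γ.trans
      (Γ.∙-cong (Γ-symbol-0 1 (A.trans (^-congˡ p e) AG.0^p)) (Γ.⁻¹-cong
        (Γ.trans (Γ.reflexive (≡.sym (Γ-· p ⟦ 0 , r ⟧)))
          (Γ.trans (GroupMult.·-cong Γ.group p (Γ-symbol-0 0 e)) (GroupMult.·-ε Γ.group p)))))
      (Γ.inverseʳ 𝟘)

    Δ-additive : ∀ x y → Δ ⟦ 0 , x A.+ y ⟧ Γ.≈ Δ ⟦ 0 , x ⟧ ⊕ Δ ⟦ 0 , y ⟧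
    Δ-additive x y = Γ.trans (Γ.reflexive (≡.sym (δ≡Δ (x A.+ y))))
      (Γ.trans (δΓ-additive x y) (Γ.reflexive (≡.cong₂ _⊕_ (δ≡Δ x) (δ≡Δ y))))
      where
      δ≡Δ : ∀ x → δΓ x ≡ Δ ⟦ 0 , x ⟧
      δ≡Δ x = ≡.cong (λ u → ⟦ 1 , x ^ p ⟧ - u) (Γ-· p ⟦ 0 , x ⟧)

    -- Because δ is additive in Γ, all symbols of degree 0 in `g` can be merged under `Δ` into a
    -- single one. Its argument is the sum of theirs, with signs.
    level₀ : Formal → A.Carrier
    level₀ = lift A.+-abelianGroup λ { (zero , r) → r ; (suc n , r) → A.0# }

    Δ-head : ∀ g → Δ (h g) Γ.≈ Δ ⟦ 0 , level₀ g ⟧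
    Δ-head ⟦ zero , r ⟧  = Γ.refl
    Δ-head ⟦ suc n , r ⟧ = Γ.trans (F⇒Γ Δ.ε-homo) (Γ.sym (Δ-symbol-0 A.refl))
    Δ-head 𝟘             = Γ.trans (F⇒Γ Δ.ε-homo) (Γ.sym (Δ-symbol-0 A.refl))
    Δ-head (u ⊕ w)       = Γ.trans (F⇒Γ (Δ.homo (h u) (h w)))
      (Γ.trans (Γ.∙-cong (Δ-head u) (Δ-head w)) (Γ.sym (Δ-additive (level₀ u) (level₀ w))))
    Δ-head (⊖ u)         = Γ.trans (F⇒Γ (Δ.⁻¹-homo (h u))) (Γ.trans (Γ.⁻¹-cong (Δ-head u))
      (Γ.sym (Γ.inverseˡ-unique _ _ (Γ.trans (Γ.sym (Δ-additive (A.- level₀ u) (level₀ u)))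
        (Δ-symbol-0 (A.-‿inverseˡ (level₀ u)))))))

    Δ-split : ∀ g → Δ g Γ.≈ Δ ⟦ 0 , level₀ g ⟧ ⊕ V (Δ (t g))
    Δ-split g = Γ.trans (F⇒Γ (≋-trans (Δ.⟦⟧-cong (head-tail g)) (Δ.homo (h g) (V (t g)))))
      (Γ.∙-cong (Δ-head g) (F⇒Γ (Δ-V (t g))))

    ghost-Δ-symbol : ∀ r → ghost.⟦ Δ ⟦ 0 , r ⟧ ⟧ 𝒮.≈ AG.δ r
    ghost-Δ-symbol r = 𝒮.trans (ghost.-homo ⟦ 1 , r ^ p ⟧ (p · ⟦ 0 , r ⟧))
      (𝒮.∙-congˡ (𝒮.⁻¹-cong (𝒮.trans (𝒮.reflexive (≡.cong ghost.⟦_⟧ (≡.sym (Γ-· p ⟦ 0 , r ⟧))))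
        (ghost.×-homo p ⟦ 0 , r ⟧))))

    ghost-Δ-split : ∀ g → ghost.⟦ Δ g ⟧ 𝒮.≈ (AG.δ (level₀ g) 𝒮.+ 𝒮.V ghost.⟦ Δ (t g) ⟧)
    ghost-Δ-split g = 𝒮.trans (ghost.⟦⟧-cong (Δ-split g))
      (𝒮.trans (ghost.∙-homo (Δ ⟦ 0 , level₀ g ⟧) (V (Δ (t g))))
        (𝒮.∙-cong (ghost-Δ-symbol (level₀ g)) (ghost.V-homo (Δ (t g)))))

    -- In Γ the element Δ g is Σⱼ Vʲ δ(aⱼ), with ghost components - pʲ⁺¹ aⱼ; those of
    -- index j < n vanish, hence so do the corresponding aⱼ.
    Δ-image : ∀ n g → VSubgroup.mem (X.productTopology n) ghost.⟦ Δ g ⟧ → Γ-image n (Δ g)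
    Δ-image zero    g vanish = image Γ.refl
    Δ-image (suc n) g vanish = image-step n {Δ g} {Δ (t g)}
      (Γ.trans (Δ-split g) (Γ.trans (Γ.∙-congʳ (Δ-symbol-0 a≈0)) (Γ.identityˡ _)))
      (Δ-image n (t g) λ i i<n → AP.p·-zero _ (A.trans
        (A.sym (A.trans (ghost-Δ-split g (suc i)) (A.trans (A.+-congʳ (AG.δ-suc (level₀ g) i)) (A.+-identityˡ _))))
        (vanish (suc i) (ℕ.s≤s i<n))))
      where
      a≈0 : level₀ g A.≈ A.0#
      a≈0 = AP.p·-zero _ (A.trans (A.sym (RingProperties.-‿involutive A.ring _))
        (A.trans (A.-‿cong (A.trans (A.sym (AG.δ-zero (level₀ g)))
          (A.trans (A.sym (A.+-identityʳ _)) (A.trans (A.sym (ghost-Δ-split g 0)) (vanish 0 (ℕ.s≤s ℕ.z≤n))))))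
          (RingProperties.-0#≈0# A.ring)))

  Γ-divide : ∀ n u → V^Image (G̃ / H̃) (suc n) (p Γ.· u) → V^Image (G̃ / H̃) n u
  Γ-divide n u divided@(image {w} (congruent (k , m))) = VSubgroup.resp (V-adic (G̃ / H̃) n)
      (ΓS.prove (u ∷ Δ g′ ∷ V^ n g″ ∷ [])
        (((v0 ⊟ v1) ⊞ v2) ⊞ (v1 ⊟ v2)) v0 ≡.refl)
      (VSubgroup.+-mem (V-adic (G̃ / H̃) n) u′-image (∸-mem (G̃ / H̃) (V-adic (G̃ / H̃) n) Δg′-image Vg″-image))
    where
    open ≈-Reasoning VF.setoid
    c : Formal
    c = (p · u) - V^ (suc n) w

    related : ∃[ g ] ι c ≋ Δ (ι g)
    related = let
        (g , e) = ι-relation m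
        c≡ : (p Γ.· u) - Γ.V^ (suc n) w ≡ c
        c≡ = ≡.cong₂ _-_ (Γ-· p u) (Γ-V^ (suc n) w)
      in Δι-saturated k {c} {g} (≋-trans
           (≋-trans (≋-sym (ι.×-homo (p ℕ.^ k) c))
             (ι.⟦⟧-cong (VF.reflexive (≡.trans (≡.cong ((p ℕ.^ k) ·_) (≡.sym c≡)) (≡.sym (G̃-· (p ℕ.^ k) _))))))
           e)
    g = proj₁ related

    pιu : p · ι u ≋ Δ (ι g) ⊕ V^ (suc n) (ι w)
    pιu = begin
      p · ι u
        ≈⟨ GS.prove (p · ι u ∷ V^ (suc n) (ι w) ∷ []) v0 ((v0 ⊟ v1) ⊞ v1) ≡.refl ⟩
      (p · ι u - V^ (suc n) (ι w)) ⊕ V^ (suc n) (ι w)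
        ≈⟨ ⊕-cong (≋-trans (⊕-cong (≋-sym (ι.×-homo p u)) (⊖-cong (≋-sym (ι-V^ (suc n) w))))
             (≋-trans (≋-sym (ι.-homo (p · u) (V^ (suc n) w))) (proj₂ related))) ≋-refl ⟩
      Δ (ι g) ⊕ V^ (suc n) (ι w) ∎

    below : ∃[ g′ ] ∃[ g″ ] ι g ≋ p · ι g′ ⊕ V^ n (ι g″)
    -- Adding p ι g to both sides of `pιu` gives p (ι u + ι g) = V (φ (ι g) + Vⁿ (ι w)). Removing
    -- the outer V by `t` is what lowers the exponent from n + 1 to n.
    below = divisible-below n (t (ι u ⊕ ι g)) g (ι w) (begin
      p · t (ι u ⊕ ι g)                           ≈⟨ t.×-homo p (ι u ⊕ ι g) ⟨
      t (p · (ι u ⊕ ι g))                         ≈⟨ t.⟦⟧-cong (·-∙ (ι u) (ι g) p) ⟩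
      t (p · ι u ⊕ p · ι g)                       ≈⟨ t.⟦⟧-cong {p · ι u ⊕ p · ι g} {(Δ (ι g) ⊕ V^ (suc n) (ι w)) ⊕ p · ι g} (⊕-cong pιu ≋-refl) ⟩
      t ((V (φ (ι g)) - (p · ι g)) ⊕ V^ (suc n) (ι w) ⊕ p · ι g)
        ≈⟨ t.⟦⟧-cong (GS.prove (V (φ (ι g)) ∷ p · ι g ∷ V^ (suc n) (ι w) ∷ [])
             (((v0 ⊟ v1) ⊞ v2) ⊞ v1) (v0 ⊞ v2) ≡.refl) ⟩
      t (V (φ (ι g))) ⊕ t (V^ (suc n) (ι w))      ≈⟨ ⊕-cong (t-V _) (t-V (V^ n (ι w))) ⟩
      φ (ι g) ⊕ V^ n (ι w)                        ∎)
    g′ = proj₁ below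
    g″ = proj₁ (proj₂ below)

    -- By `below`, Δ (ι g) = p Δ (ι g′) + Vⁿ Δ (ι g″). Subtracting `Δ g′` removes the first summand
    -- after multiplication by p, and adding `V^ n g″` cancels the part - p ι g″ of Δ (ι g″).
    u′ : Formal
    u′ = (u - Δ g′) ⊕ V^ n g″

    pιu′ : p · ι u′ ≋ V^ n (V (ι w) ⊕ V (φ (ι g″)))
    pιu′ = begin
      p · ι u′
        ≈⟨ ·-cong p (⊕-cong (≋-trans (ι.-homo u (Δ g′)) (⊕-cong ≋-refl (⊖-cong (Δ-ι g′)))) (ι-V^ n g″)) ⟩
      p · ((ι u - Δ (ι g′)) ⊕ V^ n (ι g″))
        ≈⟨ ≋-trans (·-∙ _ _ p) (⊕-cong (·-- p (ι u) (Δ (ι g′))) (≋-sym (V^-·p n (ι g″)))) ⟩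
      (p · ι u - p · Δ (ι g′)) ⊕ V^ n (p · ι g″)
        ≈⟨ ⊕-cong (⊕-cong pιu′′ ≋-refl) ≋-refl ⟩
      ((p · Δ (ι g′) ⊕ V^ n (Δ (ι g″))) ⊕ V^ (suc n) (ι w) - p · Δ (ι g′)) ⊕ V^ n (p · ι g″)
        ≈⟨ GS.prove (p · Δ (ι g′) ∷ V^ n (Δ (ι g″)) ∷ V^ (suc n) (ι w) ∷ V^ n (p · ι g″) ∷ [])
             ((((v0 ⊞ v1) ⊞ v2) ⊟ v0) ⊞ v3) (v2 ⊞ (v1 ⊞ v3)) ≡.refl ⟩
      V^ (suc n) (ι w) ⊕ (V^ n (Δ (ι g″)) ⊕ V^ n (p · ι g″))
        ≈⟨ ⊕-cong (V-V^ freeVGroup n (ι w)) (≋-trans (≋-sym (V^-+ freeVGroup n _ _)) (V^-cong freeVGroup n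
             (GS.prove (V (φ (ι g″)) ∷ p · ι g″ ∷ []) ((v0 ⊟ v1) ⊞ v1) v0 ≡.refl))) ⟩
      V^ n (V (ι w)) ⊕ V^ n (V (φ (ι g″)))
        ≈⟨ V^-+ freeVGroup n _ _ ⟨
      V^ n (V (ι w) ⊕ V (φ (ι g″))) ∎
      where
      V^-·p : ∀ n x → V^ n (p · x) ≋ p · V^ n x
      V^-·p zero    x = ≋-refl
      V^-·p (suc n) x = ≋-trans (V-cong (V^-·p n x)) (VF.V-· p _)

      pιu′′ : p · ι u ≋ (p · Δ (ι g′) ⊕ V^ n (Δ (ι g″))) ⊕ V^ (suc n) (ι w)
      pιu′′ = ≋-trans pιu (⊕-cong (≋-trans (Δ.⟦⟧-cong (proj₂ (proj₂ below)))
        (≋-trans (Δ.homo (p · ι g′) (V^ n (ι g″))) (⊕-cong (Δ.×-homo p (ι g′)) (Δ-V^ n (ι g″))))) ≋-refl)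

    u′-image : Γ-image n u′
    u′-image = let (y , e) = V^-saturated n (ι u′) _ pιu′ in ι-image n u′ y e

    Vg″-image : Γ-image n (V^ n g″)
    Vg″-image = image (Γ.reflexive (≡.sym (Γ-V^ n g″)))

    P : VSubgroup X.sequences
    P = X.productTopology n

    ghost-u : VSubgroup.mem P ghost.⟦ u ⟧
    ghost-u j j<n = AP.p·-zero _ (A.trans (A.reflexive (≡.sym (AG.·-pointwise p ghost.⟦ u ⟧ j)))
      (A.trans (A.sym (ghost.×-homo p u j)) (AG.ghost-image (suc n) divided j (ℕ.<-trans j<n (ℕ.n<1+n n)))))

    -- In Γ, Δ g′ = (u - u′) + Vⁿ g″, and the first n ghost components of all three terms vanish:
    -- for `u` by cancelling p, for the others because they lie in the image of Vⁿ.
    Δg′-image : Γ-image n (Δ g′)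
    Δg′-image = Δ-image n g′ (VSubgroup.resp P
      (𝒮.sym (𝒮.trans (ghost.⟦⟧-cong (ΓS.prove (u ∷ Δ g′ ∷ V^ n g″ ∷ [])
          v1 ((v0 ⊟ ((v0 ⊟ v1) ⊞ v2)) ⊞ v2) ≡.refl))
        (𝒮.trans (ghost.∙-homo (u - u′) (V^ n g″)) (𝒮.∙-congʳ (ghost.-homo u u′)))))
      (VSubgroup.+-mem P (∸-mem X.sequences P ghost-u (AG.ghost-image n u′-image)) (AG.ghost-image n Vg″-image)))

-- Universality of C

module _ (p : ℕ) (R : CommutativeRing ℓ ℓ) where
  private
    module R = CommutativeRing R
    module CC = C-construction p R
    P = CC.ℤR
    module P = CommutativeRing P
    module π = RingHomomorphism (present R)
  open G-construction p (CommutativeRing.ring CC.ℤR)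
  open GProperties p (CommutativeRing.ring CC.ℤR)
  private
    module C = VGroup CC.C
    module Γ = VGroup (G̃ / H̃)
  open Exp P.semiring using (_^_)
  open Exp R.semiring using () renaming (_^_ to _^ᴿ_)

  ⟪_⟫ : R.Carrier → P.Carrier
  ⟪ r ⟫ = Polynomial.var R.setoid r

  C-isVComplete : IsVComplete CC.C
  C-isVComplete = quotient-isVComplete G CC.G-I G-isVComplete
    (Closure-idempotent G (Difference G symbol (_≡I_ R)))

  ≡I-intro : ∀ {x y} → π.⟦ x ⟧ R.≈ π.⟦ y ⟧ → _≡I_ R x y
  ≡I-intro {x} {y} e = mod-I (R.trans (π.+-homo x (P.- y))
    (R.trans (R.+-cong e (π.-‿homo y)) (R.-‿inverseʳ π.⟦ y ⟧)))

  ≡I-elim : ∀ {x y} → _≡I_ R x y → π.⟦ x ⟧ R.≈ π.⟦ y ⟧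
  ≡I-elim {x} {y} (mod-I e) = AbelianGroupProperties.x∙y⁻¹≈ε⇒x≈y R.+-abelianGroup _ _
    (R.trans (R.+-congˡ (R.sym (π.-‿homo y))) (R.trans (R.sym (π.+-homo x (P.- y))) e))

  toC : VHom (G̃ / H̃) CC.C
  toC = projection G CC.G-I ∘ᵛ fromΓ

  private module toC = VHom toC

  symbol-≡I : ∀ n {x y} → π.⟦ x ⟧ R.≈ π.⟦ y ⟧ → toC.⟦ v n x ⟧ C.≈ toC.⟦ v n y ⟧
  symbol-≡I n {x} {y} e = congruent (Span⊆Closure G (V-adic G) (Difference G symbol (_≡I_ R))
    (gen (difference n x y (≡I-intro e))))

  -- A polynomial `x` and the variable attached to its value in `R` are congruent modulo I. This
  -- reduces arbitrary symbols to Teichmüller elements.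
  symbol-teich : ∀ n x → toC.⟦ v n x ⟧ C.≈ C.V^ n (CC.teichC π.⟦ x ⟧)
  symbol-teich n x = C.trans (symbol-≡I n (R.sym (present-var R π.⟦ x ⟧)))
    (C.trans (C.reflexive (≡.cong toC.⟦_⟧ (≡.sym (V^-v n ⟪ π.⟦ x ⟧ ⟫)))) (toC.V^-homo n (v 0 ⟪ π.⟦ x ⟧ ⟫)))

  C-teich-0 : CC.teichC R.0# C.≈ C.0#
  C-teich-0 = C.trans (symbol-≡I 0 {⟪ R.0# ⟫} {P.0#} (R.trans (present-var R R.0#) (R.sym π.0#-homo)))
    (toC.⟦⟧-cong (v-0 0))

  C-teich-neg : ∀ r → CC.teichC (R.- r) C.≈ C.- CC.teichC r
  C-teich-neg r = C.trans (symbol-≡I 0 {⟪ R.- r ⟫} {P.- ⟪ r ⟫}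
      (R.trans (present-var R (R.- r)) (R.sym (R.trans (π.-‿homo ⟪ r ⟫) (R.-‿cong (present-var R r))))))
    (C.trans (toC.⟦⟧-cong (v-neg 0 ⟪ r ⟫)) (toC.⁻¹-homo (v 0 ⟪ r ⟫)))

  C-additive : ∀ x y → let
      δ : R.Carrier → C.Carrier
      δ z = C.V (CC.teichC (z ^ᴿ p)) C.- p C.· CC.teichC z
    in δ (x R.+ y) C.≈ δ x C.+ δ y
  C-additive x y = begin
    δ (x R.+ y)                            ≈⟨ δ≈ {x R.+ y} {⟪ x ⟫ P.+ ⟪ y ⟫} (R.trans (present-var R _) (R.sym π+)) ⟩
    toC.⟦ δΓ (⟪ x ⟫ P.+ ⟪ y ⟫) ⟧           ≈⟨ toC.⟦⟧-cong (δΓ-additive ⟪ x ⟫ ⟪ y ⟫) ⟩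
    toC.⟦ δΓ ⟪ x ⟫ Γ.+ δΓ ⟪ y ⟫ ⟧          ≈⟨ toC.∙-homo (δΓ ⟪ x ⟫) (δΓ ⟪ y ⟫) ⟩
    toC.⟦ δΓ ⟪ x ⟫ ⟧ C.+ toC.⟦ δΓ ⟪ y ⟫ ⟧  ≈⟨ C.∙-cong (δ≈ {x} {⟪ x ⟫} R.refl) (δ≈ {y} {⟪ y ⟫} R.refl) ⟨
    δ x C.+ δ y                            ∎
    where
    open ≈-Reasoning C.setoid
    δ : R.Carrier → C.Carrier
    δ z = C.V (CC.teichC (z ^ᴿ p)) C.- p C.· CC.teichC z

    π+ : π.⟦ ⟪ x ⟫ P.+ ⟪ y ⟫ ⟧ R.≈ x R.+ y
    π+ = R.trans (π.+-homo ⟪ x ⟫ ⟪ y ⟫) (R.+-cong (present-var R x) (present-var R y))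

    -- Any lift `w` of `z` computes δ z, since `w ^ p` and the variable of zᵖ have the same value in
    -- `R`. Thus the variable of x + y may be exchanged for the sum of two variables, where the
    -- relation of Γ applies.
    δ≈ : ∀ {z w} → π.⟦ ⟪ z ⟫ ⟧ R.≈ π.⟦ w ⟧ → δ z C.≈ toC.⟦ δΓ w ⟧
    δ≈ {z} {w} e = C.sym (C.trans (toC.-homo (v 1 (w ^ p)) (p Γ.· v 0 w)) (C.∙-cong
      (C.trans (symbol-≡I 1 {w ^ p} {⟪ z ^ᴿ p ⟫} π^) (toC.V-homo (v 0 ⟪ z ^ᴿ p ⟫)))
      (C.⁻¹-cong (C.trans (toC.×-homo p (v 0 w)) (C.×-congʳ p (symbol-≡I 0 (R.sym e)))))))
      where
      π^ : π.⟦ w ^ p ⟧ R.≈ π.⟦ ⟪ z ^ᴿ p ⟫ ⟧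
      π^ = R.trans (RingPowers.^-homo {R = CommutativeRing.ring CC.ℤR} {S = R.ring} (present R) p w)
        (R.trans (Exp.^-congˡ R.semiring p (R.trans (R.sym e) (present-var R z))) (R.sym (present-var R (z ^ᴿ p))))

module _ (p : ℕ) (F′ : V⟨⟩-Functor ℓ) (weak : IsWeakPreWitt p F′) where
  private
    module F′ = V⟨⟩-Functor F′
    module W = IsWeakPreWitt weak

  F′-map : ∀ {R S} → RingHom R S → VHom (F′.value R) (F′.value S)
  F′-map {R} {S} f = record { hom = F′.F₁ R S f ; V-homo = F′.V-natural R S f }

  module _ (R : CommutativeRing ℓ ℓ) where
    private
      module R = CommutativeRing R
      module CC = C-construction p R
      P = CC.ℤR
      module P = CommutativeRing P
      module π = RingHomomorphism (present R)
      module B = VGroup (F′.value R)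
    open G-construction p (CommutativeRing.ring CC.ℤR)
    open GProperties p (CommutativeRing.ring CC.ℤR)
    private
      teichMap : TeichmüllerMap p (CommutativeRing.ring CC.ℤR) (F′.value P)
      teichMap = record
        { teich = F′.teich P ; teich-cong = F′.teich-cong P ; teich-0 = W.teich-0 P
        ; teich-neg = W.teich-neg P ; additive = W.additive P }

      module E = Extension p (CommutativeRing.ring CC.ℤR) (F′.value P) teichMap (W.p-torsion-free R.setoid)
      module E′ = E.Completed (W.complete P)

    -- Torsion freeness is available only over polynomial rings. The universal property of `G` is
    -- therefore used with target F′(ℤ⟨R⟩), and the result is pushed down along `present R`.
    fromG : VHom G (F′.value R)
    fromG = F′-map (present R) ∘ᵛ E′.fromG

    fromG-symbol : ∀ n u → VHom.⟦_⟧ fromG (symbol n u) B.≈ B.V^ n (F′.teich R π.⟦ u ⟧)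
    fromG-symbol n u = B.trans (VHom.⟦⟧-cong (F′-map (present R)) (E′.fromG-symbol n u))
      (B.trans (VHom.V^-homo (F′-map (present R)) n _) (V^-cong (F′.value R) n (F′.teich-natural P R (present R) u)))

    fromC : VHom CC.C (F′.value R)
    fromC = quotientLift fromG CC.G-I (λ {x} → V-adic-Closure-kernel fromG (W.complete R) (λ { (difference n x y e) →
      B.trans (VHom.-homo fromG (symbol n x) (symbol n y)) (B.x≈y⇒x∙y⁻¹≈ε
        (B.trans (fromG-symbol n x) (B.trans (V^-cong (F′.value R) n (F′.teich-cong R (≡I-elim p R e)))
          (B.sym (fromG-symbol n y))))) }) {x})

  fromC-natural : ∀ R S (f : RingHom R S) x → AbelianGroup._≈_ (F′.F₀ S)
                  (VHom.⟦_⟧ (fromC S) (VHom.⟦_⟧ (C-map p {R = R} {S = S} f) x)) (F′.map₁ R S f (VHom.⟦_⟧ (fromC R) x))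
  fromC-natural R S f = GProperties.G-ext p (CommutativeRing.ring (C-construction.ℤR p R)) (W.complete S)
    ((fromC S ∘ᵛ C-map p {R = R} {S = S} f) ∘ᵛ projection GR.G (C-construction.G-I p R))
    (F′-map f ∘ᵛ fromG R)
    λ n u → begin
      VHom.⟦_⟧ (fromG S) (VHom.⟦_⟧ (G-map p {R = CommutativeRing.ring (C-construction.ℤR p R)}
          {S = CommutativeRing.ring (C-construction.ℤR p S)} (ℤ⟨⟩-map {R = R} {S = S} f)) (GR.symbol n u))
        ≈⟨ VHom.⟦⟧-cong (fromG S) {_} {GS.symbol n ℤf.⟦ u ⟧} (GS.G-≈ λ _ → GS.F.≋-refl) ⟩
      VHom.⟦_⟧ (fromG S) (GS.symbol n ℤf.⟦ u ⟧)
        ≈⟨ fromG-symbol S n ℤf.⟦ u ⟧ ⟩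
      B.V^ n (F′.teich S (πS.⟦ ℤf.⟦ u ⟧ ⟧))
        ≈⟨ V^-cong (F′.value S) n (F′.teich-cong S (present-natural {R = R} {S = S} f u)) ⟩
      B.V^ n (F′.teich S (f.⟦ πR.⟦ u ⟧ ⟧))
        ≈⟨ V^-cong (F′.value S) n (F′.teich-natural R S f _) ⟨
      B.V^ n (F′.map₁ R S f (F′.teich R πR.⟦ u ⟧))
        ≈⟨ VHom.V^-homo (F′-map f) n _ ⟨
      F′.map₁ R S f (VGroup.V^ (F′.value R) n (F′.teich R πR.⟦ u ⟧))
        ≈⟨ VHom.⟦⟧-cong (F′-map f) (fromG-symbol R n u) ⟨
      F′.map₁ R S f (VHom.⟦_⟧ (fromG R) (GR.symbol n u)) ∎
    where
    module B = VGroup (F′.value S)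
    module GR = G-construction p (CommutativeRing.ring (C-construction.ℤR p R))
    module GS = G-construction p (CommutativeRing.ring (C-construction.ℤR p S))
    module f = RingHomomorphism f
    module ℤf = RingHomomorphism (ℤ⟨⟩-map {R = R} {S = S} f)
    module πR = RingHomomorphism (present R)
    module πS = RingHomomorphism (present S)
    open ≈-Reasoning B.setoid

  C-initial : C p ⟶ F′
  C-initial ._⟶_.component R = VHom.hom (fromC R)
  C-initial ._⟶_.natural = fromC-natural
  C-initial ._⟶_.V-compat R = VHom.V-homo (fromC R)
  C-initial ._⟶_.teich-compat R r = AbelianGroup.trans (F′.F₀ R)
    (fromG-symbol R 0 (Polynomial.var (CommutativeRing.setoid R) r))
    (F′.teich-cong R (present-var R r))

  C-unique : (θ θ′ : C p ⟶ F′) → ∀ R x → AbelianGroup._≈_ (F′.F₀ R) (_⟶_.at θ R x) (_⟶_.at θ′ R x)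
  C-unique θ θ′ R = GProperties.G-ext p (CommutativeRing.ring (C-construction.ℤR p R)) (W.complete R)
      (at θ ∘ᵛ projection GR.G CC.G-I) (at θ′ ∘ᵛ projection GR.G CC.G-I)
      λ n u → B.trans (at-symbol θ n u) (B.sym (at-symbol θ′ n u))
    where
    module CC = C-construction p R
    module GR = G-construction p (CommutativeRing.ring (C-construction.ℤR p R))
    module B = VGroup (F′.value R)
    module π = RingHomomorphism (present R)
    at : C p ⟶ F′ → VHom CC.C (F′.value R)
    at θ = record { hom = _⟶_.component θ R ; V-homo = _⟶_.V-compat θ R }

    at-symbol : ∀ θ n u → VHom.⟦_⟧ (at θ) (GR.symbol n u) B.≈ B.V^ n (F′.teich R π.⟦ u ⟧)
    at-symbol θ n u = B.trans (VHom.⟦⟧-cong (at θ) (symbol-teich p R n u))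
      (B.trans (VHom.V^-homo (at θ) n _) (V^-cong (F′.value R) n (_⟶_.teich-compat θ R π.⟦ u ⟧)))

-- Torsion freeness of C(ℤ[S])

module _ (S : Setoid ℓ ℓ) {p : ℕ} (pr : Prime p) (p≢2 : p ≢ 2) where
  private
    module R = CommutativeRing ℤ[ S ]
    module CC = C-construction p ℤ[ S ]
    P = CC.ℤR
    module P = CommutativeRing P
    module π = RingHomomorphism (present ℤ[ S ])
    module GP = G-construction p (CommutativeRing.ring CC.ℤR)
    module GA = G-construction p (CommutativeRing.ring ℤ[ S ])
    module C = VGroup CC.C

    varvar : Func S P.setoid
    varvar = record
      { to   = λ s → Polynomial.var R.setoid (Polynomial.var S s)
      ; cong = λ e → var-cong ℤ[ S ] (Free.⟦⟧-cong (Permutation.prep e (Permutation.↭-refl S))) }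

    -- Freeness of ℤ[S] provides a ring homomorphism splitting the presentation: each variable is
    -- lifted to the variable named after it.
    section : RingHom ℤ[ S ] P
    section = eval P varvar

    module section = RingHomomorphism section

    π∘section : ∀ x → π.⟦ section.⟦ x ⟧ ⟧ R.≈ x
    π∘section = polynomialRing-ext {S = S} {R = ℤ[ S ]} (composeRing ℤ[ S ] P ℤ[ S ] (present ℤ[ S ]) section) (idRing ℤ[ S ])
      λ s → R.trans (π.⟦⟧-cong (eval-var P varvar s)) (present-var ℤ[ S ] (Polynomial.var S s))

    Gπ : VHom GP.G GA.G
    Gπ = G-map p {R = CommutativeRing.ring CC.ℤR} {S = CommutativeRing.ring ℤ[ S ]} (present ℤ[ S ])

    Gσ : VHom GA.G GP.G
    Gσ = G-map p {R = CommutativeRing.ring ℤ[ S ]} {S = CommutativeRing.ring CC.ℤR} section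

    Gπ-kernel : ∀ {x} → VSubgroup.mem CC.G-I x → VHom.⟦_⟧ Gπ x GA.G.≈ GA.G.0#
    Gπ-kernel {x} = V-adic-Closure-kernel Gπ (GProperties.G-isVComplete p (CommutativeRing.ring ℤ[ S ]))
      (λ { (difference n x y e) → GA.G.trans (VHom.-homo Gπ (GP.symbol n x) (GP.symbol n y))
        (GA.G.x≈y⇒x∙y⁻¹≈ε (GA.G-≈ λ _ → GA.F.⟦⟧-cong (≡.refl , ≡I-elim p ℤ[ S ] e))) }) {x}

    project : VHom GP.G CC.C
    project = projection GP.G CC.G-I

    -- As x and section (π x) are congruent modulo I, C(ℤ[S]) is a retract of G(ℤ[S]).
    retract : ∀ x → x C.≈ VHom.⟦_⟧ Gσ (VHom.⟦_⟧ Gπ x)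
    retract = GProperties.G-ext p (CommutativeRing.ring CC.ℤR) (C-isVComplete p ℤ[ S ]) project (project ∘ᵛ (Gσ ∘ᵛ Gπ))
      λ n u → C.trans (symbol-≡I p ℤ[ S ] n (R.sym (π∘section π.⟦ u ⟧)))
        (VHom.⟦⟧-cong project {GP.symbol n section.⟦ π.⟦ u ⟧ ⟧} (GP.G-≈ λ _ → GP.F.≋-refl))

  -- `Gπ` kills `G-I`, so p x = 0 in C gives p · Gπ x = 0 in the torsion free group G(ℤ[S]). Hence
  -- Gπ x = 0, and `x` is recovered from it by `retract`.
  C-torsion-free : TorsionFree C.group p
  C-torsion-free x (congruent m) = C.trans (retract x) (VHom.⟦⟧-cong project
    (GP.G.trans (VHom.⟦⟧-cong Gσ Gπx≈0) (VHom.ε-homo Gσ)))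
    where
    Gπx≈0 : VHom.⟦_⟧ Gπ x GA.G.≈ GA.G.0#
    Gπx≈0 = GProperties.G-torsion-free p (CommutativeRing.ring ℤ[ S ]) (GammaTorsion.Γ-divide S pr p≢2) (VHom.⟦_⟧ Gπ x)
      (GA.G.trans (GA.G.sym (VHom.×-homo Gπ p x))
        (GA.G.trans (VHom.⟦⟧-cong Gπ (GP.G.reflexive (≡.sym (quotient-· GP.G CC.G-I p x))))
          (GA.G.trans (kernel-- Gπ {_} {GP.G.0#} (Gπ-kernel m)) (VHom.ε-homo Gπ))))

-- The axioms of a weak pre-Witt functor for C

module _ (p : ℕ) (R : CommutativeRing ℓ ℓ) where
  private
    module CC = C-construction p R
    module C = VGroup CC.C
    B : VGroup _
    B = V⟨⟩-Functor.value (C p) R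

  -- As `VGroup` has no eta equality, `value (C p) R` and `C-construction.C p R` are distinct
  -- records with the same fields. The identity map transports statements between them.
  toValue : VHom CC.C B
  toValue .VHom.hom = mkGroupHom C.group C.group (λ x → x) (λ e → e) (λ _ _ → C.refl)
  toValue .VHom.V-homo _ = C.refl

  fromValue : VHom B CC.C
  fromValue .VHom.hom = mkGroupHom C.group C.group (λ x → x) (λ e → e) (λ _ _ → C.refl)
  fromValue .VHom.V-homo _ = C.refl

  C-complete : IsVComplete B
  C-complete = isVComplete-iso toValue fromValue (λ _ → C.refl) (C-isVComplete p R)

value-torsion-free : (p : ℕ) (R : CommutativeRing ℓ ℓ) → TorsionFree (VGroup.group (C-construction.C p R)) p →
                     TorsionFree (VGroup.group (V⟨⟩-Functor.value (C p) R)) p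
value-torsion-free p R torsion-free x e = VHom.⟦⟧-cong (toValue p R) (torsion-free x
  (C.trans (C.sym (VHom.×-homo (fromValue p R) p x)) (VHom.⟦⟧-cong (fromValue p R) e)))
  where module C = VGroup (C-construction.C p R)

value-additive : (p : ℕ) (R : CommutativeRing ℓ ℓ) → let
    module R = CommutativeRing R
    module B = VGroup (V⟨⟩-Functor.value (C p) R)
    δ : R.Carrier → B.Carrier
    δ z = B.V (C-construction.teichC p R (Exp._^_ R.semiring z p)) B.- p B.· C-construction.teichC p R z
  in ∀ x y → δ (x R.+ y) B.≈ δ x B.+ δ y
value-additive p R x y = VHom.⟦⟧-cong (toValue p R)
  (C.trans (δ≈ (x R.+ y)) (C.trans (C-additive p R x y) (C.∙-cong (C.sym (δ≈ x)) (C.sym (δ≈ y)))))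
  where
  module R = CommutativeRing R
  module C = VGroup (C-construction.C p R)
  module B = VGroup (V⟨⟩-Functor.value (C p) R)
  module CC = C-construction p R
  open Exp R.semiring using (_^_)
  δ≈ : ∀ z → (B.V (CC.teichC (z ^ p)) B.- p B.· CC.teichC z) C.≈ (C.V (CC.teichC (z ^ p)) C.- p C.· CC.teichC z)
  δ≈ z = C.∙-congˡ (C.⁻¹-cong (VHom.×-homo (fromValue p R) p (CC.teichC z)))

C-isWeakPreWitt : ∀ {p} → Prime p → p ≢ 2 → IsWeakPreWitt {ℓ} p (C p)
C-isWeakPreWitt {p = p} pr p≢2 = record
  { teich-0        = C-teich-0 p
  ; teich-neg      = C-teich-neg p
  ; additive       = value-additive p
  ; complete       = C-complete p
  ; p-torsion-free = λ S → value-torsion-free p ℤ[ S ] (C-torsion-free S pr p≢2) }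

C-isUniversal : ∀ {p} → Prime p → p ≢ 2 → IsUniversalWeakPreWitt {ℓ} p (C p)
C-isUniversal {p = p} pr p≢2 = record
  { isWeakPreWitt = C-isWeakPreWitt pr p≢2
  ; exists        = C-initial p
  ; unique        = C-unique p }

-- The transformation from C to E

-- The ghost map extends to G(A) → X(A): the i-th ghost component of a
-- coherent sequence is determined by its term of index i + 1.
module GhostG (A : CommutativeRing ℓ ℓ) {p : ℕ} (pr : Prime p) (p≢2 : p ≢ 2)
              (p·-zero : TorsionFree (CommutativeRing.+-abelianGroup A) p) where
  private
    module A = CommutativeRing A
    module GM = GhostMap A pr p≢2 p·-zero
    module ghost = VHom GM.ghost
  open X-construction p A
  open G-construction p (CommutativeRing.ring A)
  private
    module 𝒮 = VGroup sequences
    module XV = VGroup X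
    module Γ = VGroup (G̃ / H̃)
    module G⁰ = VGroup G⁰
    Γ-mem = λ n → VSubgroup.mem (V-adic (G̃ / H̃) n)
  open Coherent

  private
    agree : ∀ {u w} n → Γ-mem n (u Γ.- w) → ∀ i → i ℕ.< n → ghost.⟦ u ⟧ i A.≈ ghost.⟦ w ⟧ i
    agree {u} {w} n u-w i i<n = AbelianGroupProperties.x∙y⁻¹≈ε⇒x≈y A.+-abelianGroup _ _
      (A.trans (A.sym (ghost.-homo u w i)) (GM.ghost-image n u-w i i<n))

    limit : Coherent (G̃ / H̃) → 𝒮.Carrier
    limit x i = ghost.⟦ seq x (suc i) ⟧ i

    limit-near : ∀ x n i → i ℕ.< n → limit x i A.≈ ghost.⟦ seq x n ⟧ i
    limit-near x n i i<n = A.sym (≡.subst (λ m → ghost.⟦ seq x m ⟧ i A.≈ limit x i) (ℕ.m∸n+n≡m i<n)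
      (agree (suc i) (seq-tail (G̃ / H̃) x (suc i) (n ℕ.∸ suc i)) i (ℕ.n<1+n i)))

    ghost-Span : ∀ u → ghost.⟦ u ⟧ ∈ Span sequences Generator
    ghost-Span F.⟦ n , r ⟧ = gen (generator n r)
    ghost-Span F.𝟘         = zer
    ghost-Span (u F.⊕ w)   = add (ghost-Span u) (ghost-Span w)
    ghost-Span (F.⊖ u)     = neg (ghost-Span u)

    -- Each representative is a finite formal sum of symbols, so its ghost vector is a finite sum of
    -- generators. The n-th one matches the limit in the first n entries.
    limit-∈X : ∀ x → VSubgroup.mem closedGenerated (limit x)
    limit-∈X x = closure λ n → ghost.⟦ seq x n ⟧ , ghost-Span (seq x n) , λ i i<n →
      A.trans (A.+-congʳ (limit-near x n i i<n)) (A.-‿inverseʳ _)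

  fromG⁰ : VHom G⁰ X
  fromG⁰ .VHom.hom = mkGroupHom G⁰.group XV.group (λ x → limit x , limit-∈X x)
    (λ { (coordinatewise e) → underlying λ i →
      agree (suc i) (Quotient._~_.difference (e (suc i))) i (ℕ.n<1+n i) })
    (λ x y → underlying λ i → ghost.∙-homo (seq x (suc i)) (seq y (suc i)) i)
  fromG⁰ .VHom.V-homo x = underlying λ
    { zero    → ghost.V-homo (seq x 1) 0
    -- On the left the representative of index i + 2 is used, in `V (limit x)` that of index i + 1.
    -- Their ghost vectors agree in entry i.
    ; (suc i) → A.trans (ghost.V-homo (seq x (suc (suc i))) (suc i))
        (GroupMult.·-cong A.+-abelianGroup p (A.sym (limit-near x (suc (suc i)) i (ℕ.<-trans (ℕ.n<1+n i) (ℕ.n<1+n (suc i)))))) }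

  X-V^ : ∀ n y → proj₁ (XV.V^ n y) ≡ 𝒮.V^ n (proj₁ y)
  X-V^ zero    y = ≡.refl
  X-V^ (suc n) y = ≡.cong 𝒮.V (X-V^ n y)

  X-image : ∀ n {y} → V^Image X n y → VSubgroup.mem (X-topology n) y
  X-image n (image {z} (underlying e)) i i<n =
    A.trans (e i) (A.trans (A.reflexive (≡.cong (λ b → b i) (X-V^ n z))) (GM.V^-productTopology n (proj₁ z) i i<n))

  fromG⁰-continuous : ∀ n {x} → V^Image G⁰ n x → VSubgroup.mem (X-topology n) (VHom.⟦_⟧ fromG⁰ x)
  fromG⁰-continuous n {x} x∈ = X-image n (V-adic-map fromG⁰ n {x} x∈)

  private
    X-torsion-free : TorsionFree XV.group p
    X-torsion-free x (underlying e) = underlying λ i →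
      p·-zero _ (A.trans (A.reflexive (≡.sym (·-pointwise p i))) (e i))
      where
      ·-pointwise : ∀ n i → proj₁ (n XV.· x) i ≡ RawMult._×_ A.+-rawMonoid n (proj₁ x i)
      ·-pointwise zero    i = ≡.refl
      ·-pointwise (suc n) i = ≡.cong (λ y → proj₁ x i A.+ y) (·-pointwise n i)

    X-separated : ∀ y → (∀ n → VSubgroup.mem (X-topology n) y) → y XV.≈ XV.0#
    X-separated y y∈ = underlying λ i → y∈ (suc i) i (ℕ.n<1+n i)

    T-kernel : ∀ {x} → VSubgroup.mem T x → VHom.⟦_⟧ fromG⁰ x XV.≈ XV.0#
    T-kernel {x} = Closure-kernel fromG⁰ (V-adic G⁰) X-topology X-separated
      (λ n {x} → fromG⁰-continuous n {x})
      (λ {x} → Torsion-kernel fromG⁰ p X-torsion-free {x}) {x}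

  abstract
    toX : VHom G X
    toX = quotientLift fromG⁰ T (λ {x} → T-kernel {x})

    toX-component : ∀ x i → proj₁ (VHom.⟦_⟧ toX x) i A.≈ ghost.⟦ seq x (suc i) ⟧ i
    toX-component x i = A.refl

    toX-symbol : ∀ n r → VHom.⟦_⟧ toX (symbol n r) XV.≈ generatorX n r
    toX-symbol n r = underlying λ i → A.reflexive (≡.cong (λ b → b i) (≡.sym (X-V^ n _)))

  toX-continuous : ∀ n {x} → V^Image G n x → VSubgroup.mem (X-topology n) (VHom.⟦_⟧ toX x)
  toX-continuous n {x} x∈ = X-image n (V-adic-map toX n {x} x∈)

module QuotientToX (p : ℕ) (A : CommutativeRing ℓ ℓ)
  (f : VHom (G-construction.G p (CommutativeRing.ring A)) (X-construction.X p A))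
  (f-symbol : ∀ n r → VGroup._≈_ (X-construction.X p A)
    (VHom.⟦_⟧ f (G-construction.symbol p (CommutativeRing.ring A) n r)) (X-construction.generatorX p A n r))
  (f-continuous : ∀ n {x} → V^Image (G-construction.G p (CommutativeRing.ring A)) n x →
    VSubgroup.mem (X-construction.X-topology p A n) (VHom.⟦_⟧ f x))
  (_∼_ : Rel (CommutativeRing.Carrier A) ℓ) where
  open X-construction p A
  open G-construction p (CommutativeRing.ring A)

  G-differences : VSubgroup G
  G-differences = closedSubgroup G (V-adic G) (Difference G symbol _∼_) (Difference-V G symbol _∼_ V-symbol)

  X-differences : VSubgroup X
  X-differences = closedSubgroup X X-topology (Difference X generatorX _∼_) (Difference-V X generatorX _∼_ generatorX-V)

  f-Difference : ∀ {u} → u ∈ Difference G symbol _∼_ → VHom.⟦_⟧ f u ∈ Span X (Difference X generatorX _∼_)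
  f-Difference {u} = Difference-map {A = G} {B = X} f symbol _∼_ generatorX _∼_ (λ r → r) f-symbol (λ e → e) {u}

  -- Symbols go to generators with the same index and argument, so differences go to differences.
  -- Continuity from the V-adic to the product topology extends this to the closures.
  f-differences : ∀ {x} → VSubgroup.mem G-differences x → VSubgroup.mem X-differences (VHom.⟦_⟧ f x)
  f-differences {x} = Closure-map {A = G} {B = X} f (V-adic G) X-topology
    {S = Difference G symbol _∼_} {T = Difference X generatorX _∼_} f-continuous f-Difference {x}

  f-quotient : VHom (G / G-differences) (X / X-differences)
  f-quotient = quotientMap {A = G} {B = X} f G-differences X-differences f-differences

module _ {A A′ : CommutativeRing ℓ ℓ} (f : RingHom A A′) {p : ℕ} (pr : Prime p) (p≢2 : p ≢ 2)
  (p·-zero : TorsionFree (CommutativeRing.+-abelianGroup A) p)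
  (p·′-zero : TorsionFree (CommutativeRing.+-abelianGroup A′) p) where

  private
    module A = CommutativeRing A
    module A′ = CommutativeRing A′
    module X = X-construction p A
    module X′ = X-construction p A′
    module 𝒮 = VGroup X.sequences
    module 𝒮′ = VGroup X′.sequences
    module FA = Free (G-construction.Symbol p A.ring)
    module ghost = VHom (GhostMap.ghost A pr p≢2 p·-zero)
    module ghost′ = VHom (GhostMap.ghost A′ pr p≢2 p·′-zero)
    module f = RingHomomorphism f

    f-symbol : Func (G-construction.Symbol p A.ring) (G-construction.Symbol p A′.ring)
    f-symbol = record { to = λ (n , r) → n , f.⟦ r ⟧ ; cong = λ (e , e′) → e , f.⟦⟧-cong e′ }

    module FA′ = GroupHomomorphism (freeMap (G-construction.Symbol p A.ring) (G-construction.Symbol p A′.ring) f-symbol)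

    f⁺ : GroupHom A.+-abelianGroup A′.+-abelianGroup
    f⁺ = mkGroupHom A.+-abelianGroup A′.+-abelianGroup f.⟦_⟧ f.⟦⟧-cong f.+-homo

    V^-powers-map : ∀ n r i → 𝒮′.V^ n (X′.powers f.⟦ r ⟧) i A′.≈ f.⟦ 𝒮.V^ n (X.powers r) i ⟧
    V^-powers-map zero    r i       = A′.sym (RingPowers.^-homo {R = A.ring} {S = A′.ring} f (p ℕ.^ i) r)
    V^-powers-map (suc n) r zero    = A′.sym f.0#-homo
    V^-powers-map (suc n) r (suc i) = A′.trans (GroupMult.·-cong A′.+-abelianGroup p (V^-powers-map n r i))
      (A′.sym (GroupHomProperties.×-homo {A = A.+-abelianGroup} {B = A′.+-abelianGroup} f⁺ p (𝒮.V^ n (X.powers r) i)))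

    free-ghost : GroupHom FA.freeAbelianGroup 𝒮.group
    free-ghost = mkGroupHom FA.freeAbelianGroup 𝒮.group (λ u → ghost.⟦ u ⟧)
      (λ e → ghost.⟦⟧-cong (Quotient.≈⇒~ G̃ H̃ (Quotient.≈⇒~ freeVGroup zeroSymbols e))) (λ _ _ → 𝒮.refl)
      where open G-construction p A.ring

    free-ghost′ : GroupHom FA.freeAbelianGroup 𝒮′.group
    free-ghost′ = mkGroupHom FA.freeAbelianGroup 𝒮′.group (λ u → ghost′.⟦ FA′.⟦ u ⟧ ⟧)
      (λ e → ghost′.⟦⟧-cong (Quotient.≈⇒~ G̃ H̃ (Quotient.≈⇒~ freeVGroup zeroSymbols (FA′.⟦⟧-cong e)))) (λ _ _ → 𝒮′.refl)
      where open G-construction p A′.ring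

    f-ghost : GroupHom FA.freeAbelianGroup 𝒮′.group
    f-ghost = mkGroupHom FA.freeAbelianGroup 𝒮′.group (λ u i → f.⟦ ghost.⟦ u ⟧ i ⟧)
      (λ e i → f.⟦⟧-cong (GroupHomomorphism.⟦⟧-cong free-ghost e i)) (λ _ _ i → f.+-homo _ _)

  ghost-natural : ∀ u i → ghost′.⟦ formalMap p {R = A.ring} {S = A′.ring} f u ⟧ i A′.≈ f.⟦ ghost.⟦ u ⟧ i ⟧
  ghost-natural = freeGroup-ext 𝒮′.group free-ghost′ f-ghost λ (n , r) → V^-powers-map n r

module _ {ℓ : Level} {p : ℕ} (pr : Prime p) (p≢2 : p ≢ 2) where

  private
    module GX (R : CommutativeRing ℓ ℓ) =
      GhostG (C-construction.ℤR p R) pr p≢2 (PolynomialRing.p·-zero (CommutativeRing.setoid R) pr p≢2)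

  toE : (R : CommutativeRing ℓ ℓ) → VHom (C-construction.C p R) (E-construction.E p R)
  toE R = QuotientToX.f-quotient p (C-construction.ℤR p R)
    (GX.toX R) (GX.toX-symbol R) (λ n {x} → GX.toX-continuous R n {x}) (_≡I_ R)

  toE-natural : (R S : CommutativeRing ℓ ℓ) (f : RingHom R S) → ∀ x → VGroup._≈_ (E-construction.E p S)
    (VHom.⟦_⟧ (toE S) (VHom.⟦_⟧ (C-map p {R = R} {S = S} f) x)) (VHom.⟦_⟧ (E-map p {R = R} {S = S} f) (VHom.⟦_⟧ (toE R) x))
  toE-natural R S f x = E-construction.E-≈ p S λ i → A.trans
      (GX.toX-component S (VHom.⟦_⟧ (G-map p {R = CommutativeRing.ring (C-construction.ℤR p R)}
        {S = CommutativeRing.ring (C-construction.ℤR p S)} (ℤ⟨⟩-map {R = R} {S = S} f)) x) i)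
      (A.trans (ghost-natural {A = C-construction.ℤR p R} {A′ = C-construction.ℤR p S} (ℤ⟨⟩-map {R = R} {S = S} f) pr p≢2
          (PolynomialRing.p·-zero (CommutativeRing.setoid R) pr p≢2)
          (PolynomialRing.p·-zero (CommutativeRing.setoid S) pr p≢2) (Coherent.seq x (suc i)) i)
        (ℤf.⟦⟧-cong (B.sym (GX.toX-component R x i))))
    where
    module A = CommutativeRing ℤ⟨ S ⟩
    module B = CommutativeRing ℤ⟨ R ⟩
    module ℤf = RingHomomorphism (ℤ⟨⟩-map {R = R} {S = S} f)

  toE-teich : (R : CommutativeRing ℓ ℓ) → ∀ r → VGroup._≈_ (E-construction.E p R)
    (VHom.⟦_⟧ (toE R) (C-construction.teichC p R r)) (E-construction.teichE p R r)
  toE-teich R r = E-construction.E-≈ p R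
    (_≈ˢ_.equal (GX.toX-symbol R 0 (Polynomial.var (CommutativeRing.setoid R) r)))

  C⟶E : C {ℓ} p ⟶ E {ℓ} p
  C⟶E ._⟶_.component R = VHom.hom (toE R)
  C⟶E ._⟶_.natural = toE-natural
  C⟶E ._⟶_.V-compat R = VHom.V-homo (toE R)
  C⟶E ._⟶_.teich-compat = toE-teich

theorem3p6 : (ℓ : Level) (p : ℕ) → Prime p → p ≢ 2 →
    IsUniversalWeakPreWitt {ℓ} p (C p) × (C {ℓ} p ⟶ E {ℓ} p)
theorem3p6 ℓ p pr p≢2 = C-isUniversal pr p≢2 , C⟶E pr p≢2
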